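{- The algebra $\mathbf{Sym}^{(l)}$ is free (as an associative algebra) over the set $\{S_{\mathbf n}:\mathbf n\in\mathbb N^l,\ |\mathbf n|>0\}$. Moreover, $\mathbf{Sym}^{(l)}$ is a Hopf subalgebra of $\mathbf{FQSym}^{(l)}$. The coproduct of the generators is given by $$\Delta S_{\mathbf n}=\sum_{\mathbf i+\mathbf j=\mathbf n}S_{\mathbf i}\otimes S_{\mathbf j},$$ where the sum $\mathbf i+\mathbf j$ is taken in $\mathbb N^l$ (and $\mathbf i,\mathbf j\in\mathbb N^l$). In particular, $\mathbf{Sym}^{(l)}$ is cocommutative.
   Context: Here $\mathbb N=\{0,1,2,\dots\}$. Fix an integer $l\ge1$ and a set of colors $C=\{c_0,\dots,c_{l-1}\}$. A colored permutation of size $n\ge0$ is a pair $(\sigma,u)$ with $\sigma\in\mathfrak S_n$, $u\in C^n$ (permutations are written as words; color words are indexed by positions). $\mathrm{Std}$ denotes the usual standardization of words: the occurrences of the smallest letter are numbered $1,2,\dots$ from left to right, then those of the next smallest letter, etc. $\mathbf{FQSym}^{(l)}$ is the graded Hopf algebra over $\mathbb C$ with basis $(\mathbf G_{\sigma,u})$ indexed by all colored permutations (degree = size), with product $$\mathbf G_{\sigma',u'}\mathbf G_{\sigma'',u''}=\sum_{\sigma\in\sigma'*\sigma''}\mathbf G_{\sigma,u'\cdot u''},$$ where $u'\cdot u''$ is concatenation and $\sigma'*\sigma''$ is the set of permutations $\tau$ of size $|\sigma'|+|\sigma''|$ whose first $|\sigma'|$ letters standardize to $\sigma'$ and whose remaining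 letters standardize to $\sigma''$; and coproduct $$\Delta\mathbf G_{\sigma,u}=\sum_{i=0}^n\mathbf G_{(\sigma,u)_{[1,i]}}\otimes\mathbf G_{(\sigma,u)_{[i+1,n]}},$$ where $n$ is the size of $\sigma$ and $(\sigma,u)_{[a,b]}=(\mathrm{Std}(\sigma'),u')$, with $\sigma'$ the subword of $\sigma$ consisting of the letters (values) in $[a,b]$ and $u'$ the subword of $u$ at the same positions. For $\mathbf n=(n_0,\dots,n_{l-1})\in\mathbb N^l$ with weight $|\mathbf n|=\sum_i n_i=n$, the level $l$ complete homogeneous symmetric function is $$S_{\mathbf n}=\sum_{u\in C^n;\ |u|_i=n_i\ \forall i}\mathbf G_{12\cdots n,\,u},$$ where $|u|_i$ is the number of occurrences of the color $c_i$ in $u$; by convention $S_{\mathbf 0}=1$. $\mathbf{Sym}^{(l)}$ is the subalgebra of $\mathbf{FQSym}^{(l)}$ generated by all the $S_{\mathbf n}$. -}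

module Defs where

open import Algebra.Bundles using (CommutativeRing)
open import Algebra.Bundles.Raw using (RawRing)
open import Algebra.Module.Structures using (IsLeftModule)
open import Algebra.Morphism.Structures using (IsRingHomomorphism)
open import Algebra.Structures using (IsRing)
open import Data.Fin.Base as Fin using (Fin; toℕ; fromℕ<)
import Data.Fin.Properties as Fin
open import Data.List.Base as List using (List; []; _∷_; length; filter; concatMap; upTo)
open import Data.List.Membership.Propositional using (_∈_; lose)
open import Data.List.Membership.Propositional.Properties using (∈-allFin)
open import Data.List.Properties using (length-tabulate; filter-notAll)
import Data.Maybe.Base as Maybe
open import Data.List.Relation.Unary.Any using (here; there)
open import Data.Nat.Base as ℕ using (ℕ; zero; suc; z≤n; s≤s; _≤_; _<_)
import Data.Nat.Properties as ℕ
open import Data.Product.Base using (Σ; ∃; ∃-syntax; _×_; _,_; proj₁; proj₂; swap; map₂)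
import Data.Product.Properties as Product
open import Data.Sum.Base using (_⊎_; inj₁; inj₂)
open import Data.Vec.Base as Vec using (Vec; []; _∷_; lookup; tabulate; zipWith)
import Data.Vec.Properties as Vec
open import Data.Vec.Relation.Unary.AllPairs using (allPairs?)
open import Data.Vec.Relation.Unary.Unique.Propositional using (Unique)
open import Data.Vec.Relation.Unary.Unique.Propositional.Properties using (tabulate⁺)
open import Function.Base using (id)
open import Level using (Level; 0ℓ; _⊔_) renaming (suc to lsuc)
open import Relation.Binary.Core using (Rel)
open import Relation.Binary.Definitions using (DecidableEquality; tri<; tri≈; tri>)
open import Relation.Binary.PropositionalEquality using (_≡_; refl; sym; trans; cong; subst)
open import Relation.Nullary using (¬_; Dec; yes; no; contradiction)
open import Relation.Nullary.Decidable using (¬?; _×-dec_; _⊎-dec_; map′; dec⇒maybe)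
open import Relation.Unary using (Pred)
import Relation.Unary as Unary

private
  variable
    a b p x ℓa ℓb : Level

------------------------------------------------------------------------
-- Associative unital algebras over a commutative ring

module _ {c ℓ} (K : CommutativeRing c ℓ) where

  private module K = CommutativeRing K

  record RawAlgebra a ℓa : Set (c ⊔ lsuc (a ⊔ ℓa)) where
    infixr 7 _·_
    field
      rawRing : RawRing a ℓa
      _·_     : K.Carrier → RawRing.Carrier rawRing → RawRing.Carrier rawRing
    open RawRing rawRing public

  record IsAlgebra (A : RawAlgebra a ℓa) : Set (c ⊔ ℓ ⊔ a ⊔ ℓa) where
    open RawAlgebra A
    field
      isRing     : IsRing _≈_ _+_ _*_ -_ 0# 1#
      isModule   : IsLeftModule K.ring _≈_ _+_ 0# -_ _·_
      ·-*-assocˡ : ∀ k x y → ((k · x) * y) ≈ (k · (x * y))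
      ·-*-assocʳ : ∀ k x y → (x * (k · y)) ≈ (k · (x * y))

  record IsAlgebraHomomorphism (A : RawAlgebra a ℓa) (B : RawAlgebra b ℓb)
         (h : RawAlgebra.Carrier A → RawAlgebra.Carrier B)
         : Set (c ⊔ a ⊔ ℓa ⊔ ℓb) where
    private
      module A = RawAlgebra A
      module B = RawAlgebra B
    field
      isRingHomomorphism : IsRingHomomorphism A.rawRing B.rawRing h
      ·-homo             : ∀ k x → h (k A.· x) B.≈ (k B.· h x)

  record IsSubalgebra (A : RawAlgebra a ℓa)
         (P : Pred (RawAlgebra.Carrier A) p) : Set (c ⊔ a ⊔ ℓa ⊔ p) where
    open RawAlgebra A
    field
      resp       : ∀ {x y} → x ≈ y → P x → P y
      0-closed   : P 0#
      1-closed   : P 1#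
      +-closed   : ∀ {x y} → P x → P y → P (x + y)
      neg-closed : ∀ {x} → P x → P (- x)
      *-closed   : ∀ {x y} → P x → P y → P (x * y)
      ·-closed   : ∀ k {x} → P x → P (k · x)

  module _ (A : RawAlgebra a ℓa) {X : Set x} (g : X → RawAlgebra.Carrier A) where
    open RawAlgebra A

    -- Membership in the subalgebra of A generated by the family g.
    data Generated : Pred Carrier (c ⊔ a ⊔ ℓa ⊔ x) where
      generator : ∀ i → Generated (g i)
      resp      : ∀ {x y} → x ≈ y → Generated x → Generated y
      zero      : Generated 0#
      one       : Generated 1#
      add       : ∀ {x y} → Generated x → Generated y → Generated (x + y)
      neg       : ∀ {x} → Generated x → Generated (- x)
      mul       : ∀ {x y} → Generated x → Generated y → Generated (x * y)
      scale     : ∀ k {x} → Generated x → Generated (k · x)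

    -- Two elements are identified when they are equal in A: the membership
    -- proof carries no information.
    generatedSubalgebra : RawAlgebra (c ⊔ a ⊔ ℓa ⊔ x) ℓa
    generatedSubalgebra = record
      { rawRing = record
        { Carrier = ∃ Generated
        ; _≈_     = λ u v → proj₁ u ≈ proj₁ v
        ; _+_     = λ u v → proj₁ u + proj₁ v , add (proj₂ u) (proj₂ v)
        ; _*_     = λ u v → proj₁ u * proj₁ v , mul (proj₂ u) (proj₂ v)
        ; -_      = λ u → - proj₁ u , neg (proj₂ u)
        ; 0#      = 0# , zero
        ; 1#      = 1# , one
        }
      ; _·_ = λ k u → k · proj₁ u , scale k (proj₂ u)
      }

  -- A is a free associative algebra over the family g: every map from X to an
  -- associative algebra B (of levels b, ℓb) extends uniquely along g to a
  -- morphism of algebras.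
  record IsFree b ℓb (A : RawAlgebra a ℓa) {X : Set x}
         (g : X → RawAlgebra.Carrier A)
         : Set (c ⊔ ℓ ⊔ a ⊔ ℓa ⊔ x ⊔ lsuc (b ⊔ ℓb)) where
    private module A = RawAlgebra A
    field
      isAlgebra : IsAlgebra A
      existence : (B : RawAlgebra b ℓb) → IsAlgebra B →
                  let module B = RawAlgebra B in (f : X → B.Carrier) →
                  ∃[ h ] IsAlgebraHomomorphism A B h × (∀ i → h (g i) B.≈ f i)
      uniqueness : (B : RawAlgebra b ℓb) → IsAlgebra B →
                   let module B = RawAlgebra B in (h h′ : A.Carrier → B.Carrier) →
                   IsAlgebraHomomorphism A B h → IsAlgebraHomomorphism A B h′ →
                   (∀ i → h (g i) B.≈ h′ (g i)) → ∀ y → h y B.≈ h′ y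

------------------------------------------------------------------------
-- The free module on a set with decidable equality

  -- A list of (coefficient, basis element) pairs stands for the corresponding
  -- finite linear combination; equality compares all coefficients.
  Lin : ∀ {a} → Set a → Set (c ⊔ a)
  Lin B = List (K.Carrier × B)

  module Linear where

    infixl 6 _+ˡ_
    infixr 7 _·ˡ_

    _+ˡ_ : {B : Set b} → Lin B → Lin B → Lin B
    _+ˡ_ = List._++_

    _·ˡ_ : {B : Set b} → K.Carrier → Lin B → Lin B
    k ·ˡ x = List.map (λ (k′ , e) → k K.* k′ , e) x

    basis : {B : Set b} → B → Lin B
    basis e = (K.1# , e) ∷ []

    Σ[_] : {I : Set a} {B : Set b} → List I → (I → Lin B) → Lin B
    Σ[ is ] f = concatMap f is

    extend : {B : Set a} {C : Set b} → (B → Lin C) → Lin B → Lin C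
    extend f x = Σ[ x ] λ (k , e) → k ·ˡ f e

    infixr 7 _⊗_

    -- The tensor product of the free modules on B and C is the free module on
    -- B × C, the pair (e , e′) standing for e ⊗ e′.
    _⊗_ : {B : Set a} {C : Set b} → Lin B → Lin C → Lin (B × C)
    x ⊗ y = extend (λ e → extend (λ e′ → basis (e , e′)) y) x

    module Equality {B : Set b} (_≟_ : DecidableEquality B) where

      coeff : Lin B → B → K.Carrier
      coeff []            e = K.0#
      coeff ((k , e′) ∷ x) e with e′ ≟ e
      ... | yes _ = k K.+ coeff x e
      ... | no  _ = coeff x e

      infix 4 _≈ˡ_

      _≈ˡ_ : Rel (Lin B) (b ⊔ ℓ)
      x ≈ˡ y = ∀ e → coeff x e K.≈ coeff y e

------------------------------------------------------------------------
-- Permutations as words, and standardization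

record Perm (n : ℕ) : Set where
  constructor perm
  field
    word    : Vec (Fin n) n
    .unique : Unique word

open Perm public using (word)

-- The letters of a permutation of size n are 1, …, n; the element i of Fin n
-- encodes the letter toℕ i + 1.
letter : ∀ {n} → Fin n → ℕ
letter i = suc (toℕ i)

infix 4 _≟ᵖ_

_≟ᵖ_ : ∀ {n} → DecidableEquality (Perm n)
perm v p ≟ᵖ perm w q = map′ (λ { refl → refl }) (cong word) (Vec.≡-dec Fin._≟_ v w)

idPerm : ∀ n → Perm n
idPerm n = perm (Vec.allFin n) (tabulate⁺ id)

module _ {k m : ℕ} (w : Vec (Fin k) m) where

  -- The positions of w, in the order in which standardization numbers them.
  Precedes : Fin m → Fin m → Set
  Precedes j i = lookup w j Fin.< lookup w i ⊎ (lookup w j ≡ lookup w i × j Fin.< i)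

  precedes? : ∀ j i → Dec (Precedes j i)
  precedes? j i = (lookup w j Fin.<? lookup w i)
                  ⊎-dec ((lookup w j Fin.≟ lookup w i) ×-dec (j Fin.<? i))

  rank : Fin m → ℕ
  rank i = length (filter (λ j → precedes? j i) (List.allFin m))

  private

    precedes-irrefl : ∀ i → ¬ Precedes i i
    precedes-irrefl i (inj₁ lt)       = ℕ.<-irrefl refl lt
    precedes-irrefl i (inj₂ (_ , lt)) = ℕ.<-irrefl refl lt

    precedes-trans : ∀ {h i j} → Precedes h i → Precedes i j → Precedes h j
    precedes-trans (inj₁ p) (inj₁ q) = inj₁ (ℕ.<-trans p q)
    precedes-trans {h} (inj₁ p) (inj₂ (e , _)) =
      inj₁ (subst (λ y → lookup w h Fin.< y) e p)
    precedes-trans {j = j} (inj₂ (e , _)) (inj₁ q) =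
      inj₁ (subst (λ y → y Fin.< lookup w j) (sym e) q)
    precedes-trans (inj₂ (e , p)) (inj₂ (e′ , q)) = inj₂ (trans e e′ , ℕ.<-trans p q)

    precedes-connex : ∀ i j → i ≡ j ⊎ (Precedes i j ⊎ Precedes j i)
    precedes-connex i j with Fin.<-cmp (lookup w i) (lookup w j)
    ... | tri< lt _ _ = inj₂ (inj₁ (inj₁ lt))
    ... | tri> _ _ gt = inj₂ (inj₂ (inj₁ gt))
    ... | tri≈ _ e _ with Fin.<-cmp i j
    ...   | tri< lt _ _ = inj₂ (inj₁ (inj₂ (e , lt)))
    ...   | tri≈ _ i≡j _ = inj₁ i≡j
    ...   | tri> _ _ gt = inj₂ (inj₂ (inj₂ (sym e , gt)))

    filter-≤ : {P Q : Pred (Fin m) 0ℓ} (P? : Unary.Decidable P) (Q? : Unary.Decidable Q) →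
               (∀ {y} → P y → Q y) → ∀ ys →
               length (filter P? ys) ≤ length (filter Q? ys)
    filter-≤ P? Q? P⊆Q [] = z≤n
    filter-≤ P? Q? P⊆Q (y ∷ ys) with P? y | Q? y
    ... | yes _  | yes _  = s≤s (filter-≤ P? Q? P⊆Q ys)
    ... | yes py | no ¬qy = contradiction (P⊆Q py) ¬qy
    ... | no _   | yes _  = ℕ.m≤n⇒m≤1+n (filter-≤ P? Q? P⊆Q ys)
    ... | no _   | no _   = filter-≤ P? Q? P⊆Q ys

    filter-< : {P Q : Pred (Fin m) 0ℓ} (P? : Unary.Decidable P) (Q? : Unary.Decidable Q) →
               (∀ {y} → P y → Q y) → ∀ {z ys} → z ∈ ys → ¬ P z → Q z →
               length (filter P? ys) < length (filter Q? ys)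
    filter-< P? Q? P⊆Q {z} {_ ∷ ys} (here refl) ¬pz qz with P? z | Q? z
    ... | yes pz | _      = contradiction pz ¬pz
    ... | no _   | yes _  = s≤s (filter-≤ P? Q? P⊆Q ys)
    ... | no _   | no ¬qz = contradiction qz ¬qz
    filter-< P? Q? P⊆Q {z} {y ∷ ys} (there z∈) ¬pz qz with P? y | Q? y
    ... | yes _  | yes _  = s≤s (filter-< P? Q? P⊆Q z∈ ¬pz qz)
    ... | yes py | no ¬qy = contradiction (P⊆Q py) ¬qy
    ... | no _   | yes _  = ℕ.m≤n⇒m≤1+n (filter-< P? Q? P⊆Q z∈ ¬pz qz)
    ... | no _   | no _   = filter-< P? Q? P⊆Q z∈ ¬pz qz

  rank< : ∀ i → rank i < m
  rank< i = subst (rank i <_) (length-tabulate {n = m} id)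
    (filter-notAll (λ j → precedes? j i) (List.allFin m)
      (lose (∈-allFin i) (precedes-irrefl i)))

  rank-mono : ∀ {i j} → Precedes i j → rank i < rank j
  rank-mono {i} {j} i≺j = filter-< (λ h → precedes? h i) (λ h → precedes? h j)
    (λ h≺i → precedes-trans h≺i i≺j) (∈-allFin i) (precedes-irrefl i) i≺j

  rank-injective : ∀ {i j} → rank i ≡ rank j → i ≡ j
  rank-injective {i} {j} eq with precedes-connex i j
  ... | inj₁ i≡j        = i≡j
  ... | inj₂ (inj₁ i≺j) = contradiction eq (ℕ.<⇒≢ (rank-mono i≺j))
  ... | inj₂ (inj₂ j≺i) = contradiction (sym eq) (ℕ.<⇒≢ (rank-mono j≺i))

  std : Perm m
  std = perm (tabulate (λ i → fromℕ< (rank< i)))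
    (tabulate⁺ (λ {i} {j} eq → rank-injective
      (trans (sym (Fin.toℕ-fromℕ< (rank< i)))
        (trans (cong toℕ eq) (Fin.toℕ-fromℕ< (rank< j))))))

-- All words of length n over the alphabet listed by as.
words : {A : Set} → List A → ∀ n → List (Vec A n)
words as zero    = [] ∷ []
words as (suc n) = List.cartesianProductWith _∷_ as (words as n)

perms : ∀ n → List (Perm n)
perms n = List.mapMaybe
  (λ w → Maybe.map (λ u → perm w u) (dec⇒maybe (allPairs? (λ i j → ¬? (i Fin.≟ j)) w)))
  (words (List.allFin n) n)

infixl 7 _∗_

_∗_ : ∀ {m n} → Perm m → Perm n → List (Perm (m ℕ.+ n))
_∗_ {m} {n} σ′ σ″ = filter
  (λ τ → (std (Vec.take m (word τ)) ≟ᵖ σ′) ×-dec (std (Vec.drop m (word τ)) ≟ᵖ σ″))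
  (perms (m ℕ.+ n))

------------------------------------------------------------------------
-- FQSym⁽ˡ⁾ with coefficients in K

module FQSym {c ℓ} (K : CommutativeRing c ℓ) (l : ℕ) where

  private module K = CommutativeRing K
  open Linear K public

  Color : Set
  Color = Fin l

  ColoredPerm : Set
  ColoredPerm = Σ ℕ λ n → Perm n × Vec Color n

  infix 4 _≟ᶜ_

  _≟ᶜ_ : DecidableEquality ColoredPerm
  _≟ᶜ_ = Product.≡-dec ℕ._≟_ (Product.≡-dec _≟ᵖ_ (Vec.≡-dec Fin._≟_))

  FQ : Set c
  FQ = Lin K ColoredPerm

  FQ⊗FQ : Set c
  FQ⊗FQ = Lin K (ColoredPerm × ColoredPerm)

  open Equality _≟ᶜ_ public
  open Equality (Product.≡-dec _≟ᶜ_ _≟ᶜ_) public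
    using () renaming (coeff to coeff⊗; _≈ˡ_ to _≈⊗_)

  G : ∀ {n} → Perm n → Vec Color n → FQ
  G {n} σ u = basis (n , σ , u)

  𝟙 : FQ
  𝟙 = G (idPerm 0) []

  _*ᴳ_ : ColoredPerm → ColoredPerm → FQ
  (_ , σ′ , u′) *ᴳ (_ , σ″ , u″) = Σ[ σ′ ∗ σ″ ] λ σ → G σ (u′ Vec.++ u″)

  infixl 7 _*ˡ_

  _*ˡ_ : FQ → FQ → FQ
  x *ˡ y = extend (λ e → extend (λ e′ → e *ᴳ e′) y) x

  rawAlgebra : RawAlgebra K c ℓ
  rawAlgebra = record
    { rawRing = record
      { Carrier = FQ
      ; _≈_     = _≈ˡ_
      ; _+_     = _+ˡ_
      ; _*_     = _*ˡ_
      ; -_      = λ x → (K.- K.1#) ·ˡ x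
      ; 0#      = []
      ; 1#      = 𝟙
      }
    ; _·_ = _·ˡ_
    }

  -- The biword (σ , u) is restricted to the positions at which the letter of σ
  -- lies in the interval.
  restrict : ColoredPerm → ℕ → ℕ → ColoredPerm
  restrict (n , σ , u) lo hi =
    length biword
    , std (Vec.map proj₁ (Vec.fromList biword))
    , Vec.map proj₂ (Vec.fromList biword)
    where
    biword : List (Fin n × Color)
    biword = filter (λ (i , _) → (lo ℕ.≤? letter i) ×-dec (letter i ℕ.≤? hi))
                    (Vec.toList (Vec.zip (word σ) u))

  Δᴳ : ColoredPerm → FQ⊗FQ
  Δᴳ e@(n , _) = Σ[ upTo (suc n) ] λ i →
    basis (restrict e 1 i) ⊗ basis (restrict e (suc i) n)

  Δ : FQ → FQ⊗FQ
  Δ = extend Δᴳ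

  -- FQSym⁽ˡ⁾ is graded and connected, so its counit is the projection onto
  -- the degree 0 component, which is spanned by 𝟙.
  ε : FQ → K.Carrier
  ε x = coeff x (0 , idPerm 0 , [])

  record IsAntipode (s : FQ → FQ) : Set (c ⊔ ℓ) where
    field
      s-cong     : ∀ {x y} → x ≈ˡ y → s x ≈ˡ s y
      s-+-homo   : ∀ x y → s (x +ˡ y) ≈ˡ s x +ˡ s y
      s-·-homo   : ∀ k x → s (k ·ˡ x) ≈ˡ k ·ˡ s x
      s-inverseˡ : ∀ x → extend (λ (e , e′) → s (basis e) *ˡ basis e′) (Δ x) ≈ˡ ε x ·ˡ 𝟙
      s-inverseʳ : ∀ x → extend (λ (e , e′) → basis e *ˡ s (basis e′)) (Δ x) ≈ˡ ε x ·ˡ 𝟙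

  -- z lies in the image of P ⊗ P; scalars are absorbed in the left factors.
  _∈_⊗² : FQ⊗FQ → Pred FQ p → Set (c ⊔ ℓ ⊔ p)
  z ∈ P ⊗² = Σ (List (∃ P × ∃ P)) λ ts →
    z ≈⊗ Σ[ ts ] (λ (t , t′) → proj₁ t ⊗ proj₁ t′)

  record IsHopfSubalgebra (P : Pred FQ p) : Set (c ⊔ ℓ ⊔ p) where
    field
      isSubalgebra    : IsSubalgebra K rawAlgebra P
      Δ-closed        : ∀ {x} → P x → Δ x ∈ P ⊗²
      -- An antipode is unique when it exists, so s is the antipode.
      antipode-closed : ∀ {s} → IsAntipode s → ∀ {x} → P x → P (s x)

  IsCocommutative : Pred FQ p → Set (c ⊔ ℓ ⊔ p)
  IsCocommutative P = ∀ {x} → P x → List.map (map₂ swap) (Δ x) ≈⊗ Δ x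

------------------------------------------------------------------------
-- Sym⁽ˡ⁾

  Weight : Set
  Weight = Vec ℕ l

  ∣_∣ : Weight → ℕ
  ∣_∣ = Vec.sum

  infix 4 _≟ʷ_

  _≟ʷ_ : DecidableEquality Weight
  _≟ʷ_ = Vec.≡-dec ℕ._≟_

  content : ∀ {n} → Vec Color n → Weight
  content u = tabulate (λ i → Vec.count (Fin._≟ i) u)

  S : Weight → FQ
  S 𝐧 = Σ[ filter (λ u → content u ≟ʷ 𝐧) (words (List.allFin l) ∣ 𝐧 ∣) ] λ u →
    G (idPerm ∣ 𝐧 ∣) u

  IsSym : Pred FQ (c ⊔ ℓ)
  IsSym = Generated K rawAlgebra S

  Sym : RawAlgebra K (c ⊔ ℓ) ℓ
  Sym = generatedSubalgebra K rawAlgebra S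

  S⁺ : (Σ Weight λ 𝐧 → 0 < ∣ 𝐧 ∣) → ∃ IsSym
  S⁺ (𝐧 , _) = S 𝐧 , generator 𝐧

  -- The pairs (𝐢 , 𝐣) with 𝐢 + 𝐣 = 𝐧; all the entries of such 𝐢 and 𝐣 are at
  -- most |𝐧|, so the enumeration is complete.
  decompositions : Weight → List (Weight × Weight)
  decompositions 𝐧 = filter (λ (𝐢 , 𝐣) → zipWith ℕ._+_ 𝐢 𝐣 ≟ʷ 𝐧)
    (List.cartesianProduct box box)
    where
    box : List Weight
    box = words (upTo (suc ∣ 𝐧 ∣)) l

{-# OPTIONS --safe #-}
module Submission where

-- Send G_{σ,u} to the sum of all colored words whose standardization is (σ, u). This
-- embeds FQSym into noncommutative series: the product becomes the product of series,
-- i.e. it is dual to deconcatenation, and the coproduct is dual to the shifted shuffle of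
-- words. Hence FQSym is associative and its coproduct is multiplicative, because shuffles
-- and deconcatenation form a bialgebra. The series of S_𝐧 is the characteristic function
-- of the weakly increasing words of color content 𝐧. A shuffle of u with a word v on larger
-- letters is increasing only if it is uv with both factors increasing, which gives Δ S_𝐧,
-- and cocommutativity passes from the generators to products.
--
-- For freeness, evaluate a product S_𝐧₁ ⋯ S_𝐧ᵣ at the word made of constant blocks of
-- contents 𝐦₁, …, 𝐦ₛ with letters decreasing from block to block: an increasing factor
-- cannot cross a descent, so for r ≤ s the value is 1 if the two sequences agree and 0
-- otherwise. This triangularity makes the products linearly independent. The antipode of
-- such a product x is found by induction on the degree from Δ x = x ⊗ 1 + (terms with
-- left factors of smaller degree, again products of generators).

open import Defs
open import Algebra.Bundles using (CommutativeRing)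
open import Data.Nat.Base using (ℕ; _≤_)
open import Data.Product.Base using (_×_; _,_)

open import Algebra.Bundles using (CommutativeMonoid; Ring)
open import Algebra.Module.Bundles using (LeftModule)
import Algebra.Module.Construct.TensorUnit as TensorUnit
open import Algebra.Module.Structures using (IsLeftModule)
open import Algebra.Morphism.Structures using (IsRingHomomorphism)
open import Algebra.Structures using (IsAbelianGroup; IsRing)
open import Data.Bool.Base using (true; false; if_then_else_)
open import Data.Fin.Base as Fin using (Fin; zero; suc; toℕ; fromℕ<; _↑ˡ_; _↑ʳ_)
import Data.Fin.Properties as Fin
open import Data.List.Base as List using (List; []; _∷_; _++_; allFin; cartesianProductWith; concatMap; deduplicate;
    filter; length; mapMaybe; upTo)
import Data.List.Properties as List
open import Data.List.Membership.Propositional using (_∈_)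
open import Data.List.Membership.Propositional.Properties
open import Data.List.Relation.Binary.Permutation.Propositional using (_↭_; ↭-refl; ↭-sym; ↭-trans; prep)
open import Data.List.Relation.Binary.Permutation.Propositional.Properties using (↭-length; filter-↭; shift; ∈-resp-↭)
open import Data.List.Relation.Unary.All as All using (All; []; _∷_)
import Data.List.Relation.Unary.All.Properties as All
open import Data.List.Relation.Unary.AllPairs as AllPairs using (AllPairs; []; _∷_)
import Data.List.Relation.Unary.AllPairs.Properties as AllPairs
open import Data.List.Relation.Unary.Any using (here; there)
open import Data.List.Relation.Unary.Linked as Linked using (Linked; []; [-]; _∷_; linked?)
import Data.List.Relation.Unary.Linked.Properties as Linked
open import Data.List.Relation.Unary.Unique.DecPropositional.Properties using (deduplicate-!)
open import Data.List.Relation.Unary.Unique.Propositional using () renaming (Unique to Uniqueˡ)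
import Data.List.Relation.Unary.Unique.Propositional.Properties as Uniqueˡ
open import Data.Maybe.Base as Maybe using (Maybe; just; nothing; maybe′)
open import Data.Nat.Base as ℕ using (zero; suc; _<_; z≤n; s≤s)
open import Data.Nat.Induction using (<-wellFounded; Acc; acc)
import Data.Nat.Properties as ℕ
open import Data.Product.Base using (Σ; ∃; ∃-syntax; proj₁; proj₂; map₁; map₂; swap)
import Data.Product.Properties as Product
open import Data.Sum.Base using (_⊎_; inj₁; inj₂)
open import Data.Vec.Base as Vec using (Vec; []; _∷_; lookup; tabulate)
import Data.Vec.Properties as Vec
import Data.Vec.Relation.Unary.All as Vecᴬ
open import Data.Vec.Relation.Unary.AllPairs using (allPairs?; []; _∷_)
open import Data.Vec.Relation.Unary.Unique.Propositional using (Unique)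
open import Data.Vec.Relation.Unary.Unique.Propositional.Properties using (lookup-injective)
open import Function.Base using (_∘_; id; _on_)
open import Level using (Level; _⊔_)
open import Relation.Binary.Definitions using (DecidableEquality; tri<; tri≈; tri>)
open import Relation.Binary.PropositionalEquality as ≡ using (_≡_; _≢_)
open import Relation.Nullary using (¬_; Dec; yes; no; contradiction; does)
open import Relation.Nullary.Decidable using (¬?; _×-dec_; dec⇒maybe; recompute)
open import Relation.Unary using (Pred; Decidable)
open import Relation.Unary.Properties using (∁?)

-- The product and the coproduct of `FQSym` are both defined through standardization, so that
-- working with them directly would mean iterating it. On words both operations become recursions on
-- lists, and standardization has to be compared with each of them only once: corresponding factors
-- of order isomorphic words are order isomorphic, and so are corresponding shifted shuffles. No
-- infinite alphabet is involved. Words over `Fin k` for all `k` suffice, because a colored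
-- permutation of size `n` is itself a word over `Fin n`. The coefficients lie in an arbitrary
-- commutative ring, whose equality is not assumed decidable. An element is an unreduced list of
-- terms and cannot be brought into a normal form by dropping zero coefficients. Linear extensions
-- are therefore shown to be well defined by comparing coefficients over a common support, and
-- independence is obtained from a triangular matrix with unit diagonal, which requires no division.

private
  variable
    a i j p q r : Level
    I : Set i
    J : Set j
    X Y : Set a
    P Q : Set p
    k k′ m n : ℕ

-- Finite sums and free modules

module FiniteSums {m ℓm} (M : CommutativeMonoid m ℓm) where
  open CommutativeMonoid M renaming (_∙_ to _+_; ε to 0#; ∙-cong to +-cong; identityˡ to +-identityˡ;
    identityʳ to +-identityʳ; assoc to +-assoc; comm to +-comm)
  open import Relation.Binary.Reasoning.Setoid setoid
  open import Algebra.Properties.CommutativeSemigroup commutativeSemigroup using (interchange)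

  sum : List I → (I → Carrier) → Carrier
  sum []       f = 0#
  sum (i ∷ is) f = f i + sum is f

  sum-cong-∈ : ∀ (is : List I) {f g} → (∀ {i} → i ∈ is → f i ≈ g i) → sum is f ≈ sum is g
  sum-cong-∈ []       eq = refl
  sum-cong-∈ (i ∷ is) eq = +-cong (eq (here ≡.refl)) (sum-cong-∈ is (eq ∘ there))

  sum-cong : ∀ (is : List I) {f g} → (∀ i → f i ≈ g i) → sum is f ≈ sum is g
  sum-cong is eq = sum-cong-∈ is (λ {i} _ → eq i)

  sum-0 : ∀ (is : List I) {f} → (∀ {i} → i ∈ is → f i ≈ 0#) → sum is f ≈ 0#
  sum-0 []       eq = refl
  sum-0 (i ∷ is) eq = trans (+-cong (eq (here ≡.refl)) (sum-0 is (eq ∘ there))) (+-identityˡ 0#)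

  sum-++ : ∀ (is js : List I) f → sum (is ++ js) f ≈ sum is f + sum js f
  sum-++ []       js f = sym (+-identityˡ _)
  sum-++ (i ∷ is) js f = trans (+-cong refl (sum-++ is js f)) (sym (+-assoc _ _ _))

  sum-map : ∀ (h : I → J) is f → sum (List.map h is) f ≡ sum is (f ∘ h)
  sum-map h []       f = ≡.refl
  sum-map h (i ∷ is) f = ≡.cong (f (h i) +_) (sum-map h is f)

  sum-concatMap : ∀ (h : I → List J) is f → sum (concatMap h is) f ≈ sum is (λ i → sum (h i) f)
  sum-concatMap h []       f = refl
  sum-concatMap h (i ∷ is) f = trans (sum-++ (h i) _ f) (+-cong refl (sum-concatMap h is f))

  sum-+ : ∀ (is : List I) f g → sum is (λ i → f i + g i) ≈ sum is f + sum is g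
  sum-+ []       f g = sym (+-identityˡ 0#)
  sum-+ (i ∷ is) f g = trans (+-cong refl (sum-+ is f g)) (interchange _ _ _ _)

  sum-swap : ∀ (is : List I) (js : List J) (f : I → J → Carrier) →
             sum is (λ i → sum js (f i)) ≈ sum js (λ j → sum is (λ i → f i j))
  sum-swap []       js f = sym (sum-0 js (λ _ → refl))
  sum-swap (i ∷ is) js f = trans (+-cong refl (sum-swap is js f)) (sym (sum-+ js _ _))

  sum-cartesianProductWith : ∀ {k} {L : Set k} (h : I → J → L) is js f →
    sum (cartesianProductWith h is js) f ≈ sum is (λ i → sum js (f ∘ h i))
  sum-cartesianProductWith h []       js f = refl
  sum-cartesianProductWith h (i ∷ is) js f =
    trans (sum-++ (List.map (h i) js) _ f)
      (+-cong (reflexive (sum-map (h i) js f)) (sum-cartesianProductWith h is js f))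

  sum-filter : ∀ {P : Pred I p} (P? : Decidable P) is f →
               sum (filter P? is) f ≈ sum is (λ i → if does (P? i) then f i else 0#)
  sum-filter P? []       f = refl
  sum-filter P? (i ∷ is) f with P? i
  ... | yes _ = +-cong refl (sum-filter P? is f)
  ... | no _  = trans (sum-filter P? is f) (sym (+-identityˡ _))

  sum-mapMaybe : ∀ (h : I → Maybe J) is f →
                 sum (mapMaybe h is) f ≈ sum is (λ i → maybe′ f 0# (h i))
  sum-mapMaybe h []       f = refl
  sum-mapMaybe h (i ∷ is) f with h i
  ... | just _  = +-cong refl (sum-mapMaybe h is f)
  ... | nothing = trans (sum-mapMaybe h is f) (sym (+-identityˡ _))

  sum-single : ∀ {is : List I} {i} f → Uniqueˡ is → i ∈ is → (∀ {j} → j ∈ is → j ≢ i → f j ≈ 0#) →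
               sum is f ≈ f i
  sum-single {is = _ ∷ is} f (i∉ ∷ _) (here ≡.refl) eq =
    trans (+-cong refl (sum-0 is (λ j∈ → eq (there j∈) (λ { ≡.refl → All.lookup i∉ j∈ ≡.refl })))) (+-identityʳ _)
  sum-single f (j∉ ∷ u) (there i∈) eq =
    trans (+-cong (eq (here ≡.refl) (λ { ≡.refl → All.lookup j∉ i∈ ≡.refl })) (sum-single f u i∈ (eq ∘ there))) (+-identityˡ _)

module FreeModules {c ℓ} (K : CommutativeRing c ℓ) where

  private module K = CommutativeRing K
  open Linear K

  module LinearExtension {m ℓm} (M : LeftModule K.ring m ℓm) where
    open LeftModule M
    open FiniteSums +ᴹ-commutativeMonoid
    open import Relation.Binary.Reasoning.Setoid ≈ᴹ-setoid

    *ₗ-sum : ∀ {i} {I : Set i} k (is : List I) f → k *ₗ sum is f ≈ᴹ sum is (λ i → k *ₗ f i)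
    *ₗ-sum k []       f = *ₗ-zeroʳ k
    *ₗ-sum k (i ∷ is) f = ≈ᴹ-trans (*ₗ-distribˡ k _ _) (+ᴹ-congˡ (*ₗ-sum k is f))

    module _ {b} {B : Set b} where

      -- Values in an arbitrary module serve two purposes: in `K` itself they give coefficient
      -- functionals, in an algebra they give the evaluation of noncommutative polynomials.
      linear : (B → Carrierᴹ) → Lin K B → Carrierᴹ
      linear f x = sum x (λ (k , e) → k *ₗ f e)

      linear-+ : ∀ f x y → linear f (x +ˡ y) ≈ᴹ linear f x +ᴹ linear f y
      linear-+ f x y = sum-++ x y _

      linear-cong : ∀ {f g} → (∀ e → f e ≈ᴹ g e) → ∀ x → linear f x ≈ᴹ linear g x
      linear-cong eq x = sum-cong x (λ (k , e) → *ₗ-congˡ (eq e))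

      linear-· : ∀ f k x → linear f (k ·ˡ x) ≈ᴹ k *ₗ linear f x
      linear-· f k x = begin
        linear f (k ·ˡ x)                  ≡⟨ sum-map _ x _ ⟩
        sum x (λ (k′ , e) → (k K.* k′) *ₗ f e) ≈⟨ sum-cong x (λ (k′ , e) → *ₗ-assoc k k′ (f e)) ⟩
        sum x (λ (k′ , e) → k *ₗ (k′ *ₗ f e)) ≈⟨ *ₗ-sum k x _ ⟨
        k *ₗ linear f x                    ∎

      linear-basis : ∀ f e → linear f (basis e) ≈ᴹ f e
      linear-basis f e = ≈ᴹ-trans (+ᴹ-identityʳ _) (*ₗ-identityˡ _)

      linear-Σ : ∀ {i} {I : Set i} f (is : List I) g →
                 linear f (Σ[ is ] g) ≈ᴹ sum is (λ i → linear f (g i))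
      linear-Σ f is g = sum-concatMap g is _

      module _ (_≟_ : DecidableEquality B) where
        open Equality _≟_

        -- A list may repeat basis elements, and the sum is regrouped by basis element. The
        -- duplicate-free list `es` may exceed the support, so that two lists can be compared over a
        -- common one.
        linear-support : ∀ f x {es} → Uniqueˡ es → (∀ {t} → t ∈ x → proj₂ t ∈ es) →
                         linear f x ≈ᴹ sum es (λ e → coeff x e *ₗ f e)
        linear-support f [] {es} u x⊆ = ≈ᴹ-sym (sum-0 es (λ _ → *ₗ-zeroˡ _))
        linear-support f ((k , e) ∷ x) {es} u x⊆ = begin
          k *ₗ f e +ᴹ linear f x
            ≈⟨ +ᴹ-cong head≈ (linear-support f x u (x⊆ ∘ there)) ⟩
          sum es g +ᴹ sum es (λ e′ → coeff x e′ *ₗ f e′)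
            ≈⟨ sum-+ es _ _ ⟨
          sum es (λ e′ → g e′ +ᴹ coeff x e′ *ₗ f e′)
            ≈⟨ sum-cong es step ⟩
          sum es (λ e′ → coeff ((k , e) ∷ x) e′ *ₗ f e′) ∎
          where
          g : B → Carrierᴹ
          g e′ with e ≟ e′
          ... | yes _ = k *ₗ f e′
          ... | no _  = 0ᴹ
          g-e : g e ≈ᴹ k *ₗ f e
          g-e with e ≟ e
          ... | yes _ = ≈ᴹ-refl
          ... | no ne = contradiction ≡.refl ne
          g-≢ : ∀ {e′} → e′ ∈ es → e′ ≢ e → g e′ ≈ᴹ 0ᴹ
          g-≢ {e′} _ ne with e ≟ e′
          ... | yes eq = contradiction (≡.sym eq) ne
          ... | no _ = ≈ᴹ-refl
          head≈ : k *ₗ f e ≈ᴹ sum es g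
          head≈ = ≈ᴹ-sym (≈ᴹ-trans (sum-single g u (x⊆ (here ≡.refl)) g-≢) g-e)
          step : ∀ e′ → g e′ +ᴹ coeff x e′ *ₗ f e′ ≈ᴹ coeff ((k , e) ∷ x) e′ *ₗ f e′
          step e′ with e ≟ e′
          ... | yes _ = ≈ᴹ-sym (*ₗ-distribʳ (f e′) k (coeff x e′))
          ... | no _  = +ᴹ-identityˡ _

        private
          support : Lin K B → List B
          support x = deduplicate _≟_ (List.map proj₂ x)

          ∈-support : ∀ {x t} → t ∈ x → proj₂ t ∈ support x
          ∈-support t∈ = ∈-deduplicate⁺ _≟_ (∈-map⁺ proj₂ t∈)

        -- Over the support of `x ++ y` both sides depend on the coefficients only. This makes
        -- linear extensions well defined with respect to `_≈ˡ_`.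
        linear-≈ : ∀ f {x y} → x ≈ˡ y → linear f x ≈ᴹ linear f y
        linear-≈ f {x} {y} x≈y = begin
          linear f x                      ≈⟨ linear-support f x u (∈-support ∘ ∈-++⁺ˡ) ⟩
          sum es (λ e → coeff x e *ₗ f e) ≈⟨ sum-cong es (λ e → *ₗ-congʳ (x≈y e)) ⟩
          sum es (λ e → coeff y e *ₗ f e) ≈⟨ linear-support f y u (∈-support ∘ ∈-++⁺ʳ x) ⟨
          linear f y                      ∎
          where
          es = support (x ++ y)
          u : Uniqueˡ es
          u = deduplicate-! _≟_ (List.map proj₂ (x ++ y))

        -- A basis element that occurs in the list `x` may still have coefficient zero after
        -- collecting terms; `f` and `g` are free to differ there. The independence proof uses this
        -- for monomials already known to have coefficient zero.
        linear-cong-coeff : ∀ {f g} x → (∀ e → coeff x e *ₗ f e ≈ᴹ coeff x e *ₗ g e) → linear f x ≈ᴹ linear g x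
        linear-cong-coeff {f} {g} x eq = begin
          linear f x                              ≈⟨ linear-support f x u ∈-support ⟩
          sum (support x) (λ e → coeff x e *ₗ f e) ≈⟨ sum-cong (support x) eq ⟩
          sum (support x) (λ e → coeff x e *ₗ g e) ≈⟨ linear-support g x u ∈-support ⟨
          linear g x                              ∎
          where
          u : Uniqueˡ (support x)
          u = deduplicate-! _≟_ (List.map proj₂ x)

  opaque
    -- Truth values as scalars: a conjunction becomes a product (`δ-×`), and a condition can be
    -- moved through sums like any other factor.
    δ : Dec P → K.Carrier
    δ P? = if does P? then K.1# else K.0#

    δ-yes : (P? : Dec P) → P → δ P? ≡ K.1#
    δ-yes (yes _) p = ≡.refl
    δ-yes (no ¬p) p = contradiction p ¬p

    δ-no : (P? : Dec P) → ¬ P → δ P? ≡ K.0#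
    δ-no (yes p) ¬p = contradiction p ¬p
    δ-no (no _)  ¬p = ≡.refl

    δ-cong : (P? : Dec P) (Q? : Dec Q) → (P → Q) → (Q → P) → δ P? ≡ δ Q?
    δ-cong (yes p) Q? f g = ≡.sym (δ-yes Q? (f p))
    δ-cong (no ¬p) Q? f g = ≡.sym (δ-no Q? (¬p ∘ g))

    δ-× : (P? : Dec P) (Q? : Dec Q) → δ (P? ×-dec Q?) K.≈ δ P? K.* δ Q?
    δ-× (yes _) (yes _) = K.sym (K.*-identityˡ _)
    δ-× (yes _) (no _)  = K.sym (K.*-identityˡ _)
    δ-× (no _)  _       = K.sym (K.zeroˡ _)

    δ-0 : (P? : Dec P) {x : K.Carrier} → (P → x K.≈ K.0#) → δ P? K.* x K.≈ K.0#
    δ-0 (yes p) eq = K.trans (K.*-identityˡ _) (eq p)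
    δ-0 (no _)  eq = K.zeroˡ _

    if-δ : (P? : Dec P) {x : K.Carrier} → (if does P? then x else K.0#) K.≈ δ P? K.* x
    if-δ (yes _) = K.sym (K.*-identityˡ _)
    if-δ (no _)  = K.sym (K.zeroˡ _)

  open FiniteSums K.+-commutativeMonoid public renaming (sum-filter to sum-filter-if)
  open LinearExtension (TensorUnit.leftModule {R = K.ring}) public
    renaming (*ₗ-sum to *-sum)
  open import Relation.Binary.Reasoning.Setoid K.setoid

  sum-filter : ∀ {P : Pred I p} (P? : Decidable P) is f →
               sum (filter P? is) f K.≈ sum is (λ i → δ (P? i) K.* f i)
  sum-filter P? is f = K.trans (sum-filter-if P? is f) (sum-cong is (λ i → if-δ (P? i)))

  sum-* : ∀ (is : List I) f k → sum is f K.* k K.≈ sum is (λ i → f i K.* k)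
  sum-* is f k = K.trans (K.*-comm _ _) (K.trans (*-sum k is f) (sum-cong is (λ i → K.*-comm _ _)))

  sum-*-sum : ∀ (is : List I) (js : List J) f g →
              sum is f K.* sum js g K.≈ sum is (λ i → sum js (λ j → f i K.* g j))
  sum-*-sum is js f g = K.trans (sum-* is f _) (sum-cong is (λ i → *-sum (f i) js g))

  linear-sum : ∀ {b} {B : Set b} (is : List I) (f : I → B → K.Carrier) x →
               linear (λ e → sum is (λ i → f i e)) x K.≈ sum is (λ i → linear (f i) x)
  linear-sum is f x = K.trans (sum-cong x (λ (k , e) → *-sum k is _)) (sum-swap x is _)

  linear-*ˡ : ∀ {b} {B : Set b} k (f : B → K.Carrier) x → linear (λ e → k K.* f e) x K.≈ k K.* linear f x
  linear-*ˡ k f x = K.trans (sum-cong x (λ (k′ , e) → x∙yz≈y∙xz k′ k (f e))) (K.sym (*-sum k x _))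
    where open import Algebra.Properties.CommutativeSemigroup K.*-commutativeSemigroup using (x∙yz≈y∙xz)

  linear-*ʳ : ∀ {b} {B : Set b} k (f : B → K.Carrier) x → linear (λ e → f e K.* k) x K.≈ linear f x K.* k
  linear-*ʳ k f x = K.trans (linear-cong (λ e → K.*-comm (f e) k) x) (K.trans (linear-*ˡ k f x) (K.*-comm _ _))

  linear-* : ∀ {b b′} {B : Set b} {B′ : Set b′} x y (f : B → K.Carrier) (g : B′ → K.Carrier) →
             linear (λ e → linear (λ e′ → f e K.* g e′) y) x K.≈ linear f x K.* linear g y
  linear-* x y f g = K.trans (linear-cong (λ e → linear-*ˡ (f e) g y) x) (linear-*ʳ (linear g y) f x)

  linear-⊗ : ∀ {b b′} {B : Set b} {B′ : Set b′} (x : Lin K B) (y : Lin K B′) f →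
             linear f (x ⊗ y) K.≈ linear (λ e → linear (λ e′ → f (e , e′)) y) x
  linear-⊗ x y f = K.trans (linear-extend (λ e → extend (λ e′ → basis (e , e′)) y) x) (linear-cong (λ e →
    K.trans (linear-extend (λ e′ → basis (e , e′)) y) (linear-cong (λ e′ → linear-basis f (e , e′)) y)) x)
    where
    linear-extend : ∀ {b} {B : Set b} (g : B → Lin K _) x → linear f (extend g x) K.≈ linear (λ e → linear f (g e)) x
    linear-extend g x = K.trans (linear-Σ f x (λ (k , e) → k ·ˡ g e)) (sum-cong x (λ (k , e) → linear-· f k (g e)))

  module Coefficients {b} {B : Set b} (_≟_ : DecidableEquality B) where
    open Equality _≟_ public

    -- Coefficients become an instance of `linear`, from which their compatibility with sums,
    -- multiples and extensions is inherited.
    coeff-linear : ∀ x e → coeff x e K.≈ linear (λ e′ → δ (e′ ≟ e)) x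
    coeff-linear []             e = K.refl
    coeff-linear ((k , e′) ∷ x) e with e′ ≟ e
    ... | yes eq = K.+-cong (K.sym (K.trans (K.*-congˡ (K.reflexive (δ-yes (yes eq) eq))) (K.*-identityʳ k))) (coeff-linear x e)
    ... | no ne  = K.trans (coeff-linear x e) (K.sym (K.trans (K.+-congʳ (K.trans (K.*-congˡ (K.reflexive (δ-no
        (no ne) ne))) (K.zeroʳ k))) (K.+-identityˡ _)))

    coeff-basis : ∀ e′ e → coeff (basis e′) e K.≈ δ (e′ ≟ e)
    coeff-basis e′ e = K.trans (coeff-linear (basis e′) e) (linear-basis (λ e″ → δ (e″ ≟ e)) e′)

    coeff-+ : ∀ x y e → coeff (x +ˡ y) e K.≈ coeff x e K.+ coeff y e
    coeff-+ x y e = K.trans (coeff-linear (x +ˡ y) e)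
      (K.trans (linear-+ _ x y) (K.sym (K.+-cong (coeff-linear x e) (coeff-linear y e))))

    coeff-· : ∀ k x e → coeff (k ·ˡ x) e K.≈ k K.* coeff x e
    coeff-· k x e = K.trans (coeff-linear (k ·ˡ x) e)
      (K.trans (linear-· _ k x) (K.sym (K.*-congˡ (coeff-linear x e))))

    coeff-Σ : ∀ (is : List I) f e → coeff (Σ[ is ] f) e K.≈ sum is (λ i → coeff (f i) e)
    coeff-Σ is f e = K.trans (coeff-linear (Σ[ is ] f) e)
      (K.trans (linear-Σ _ is f) (sum-cong is (λ i → K.sym (coeff-linear (f i) e))))

    coeff-extend : ∀ {a} {A : Set a} (f : A → Lin K B) x e →
                   coeff (extend f x) e K.≈ linear (λ e′ → coeff (f e′) e) x
    coeff-extend f x e = K.trans (coeff-Σ x _ e) (sum-cong x (λ (k , e′) → coeff-· k (f e′) e))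

    extend-≈ : ∀ {a} {A : Set a} (_≟ᴬ_ : DecidableEquality A) (f : A → Lin K B) {x y} →
               Equality._≈ˡ_ _≟ᴬ_ x y → extend f x ≈ˡ extend f y
    extend-≈ _≟ᴬ_ f {x} {y} x≈y e = K.trans (coeff-extend f x e)
      (K.trans (linear-≈ _≟ᴬ_ _ {x} {y} x≈y) (K.sym (coeff-extend f y e)))

  module _ {b b′} {B : Set b} {B′ : Set b′} (_≟_ : DecidableEquality B) (_≟′_ : DecidableEquality B′) where
    open Coefficients _≟_
    open Coefficients _≟′_ using () renaming (coeff to coeff′; coeff-linear to coeff-linear′)
    open Coefficients (Product.≡-dec _≟_ _≟′_) using () renaming (coeff to coeff⊗; coeff-extend to coeff⊗-extend;
        coeff-basis to coeff⊗-basis)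

    coeff-⊗ : ∀ x y e e′ → coeff⊗ (x ⊗ y) (e , e′) K.≈ coeff x e K.* coeff′ y e′
    coeff-⊗ x y e e′ = begin
      coeff⊗ (x ⊗ y) (e , e′)
        ≈⟨ coeff⊗-extend _ x (e , e′) ⟩
      linear (λ d → coeff⊗ (extend (λ d′ → basis (d , d′)) y) (e , e′)) x
        ≈⟨ linear-cong (λ d → K.trans (coeff⊗-extend (λ d′ → basis (d , d′)) y (e , e′)) (linear-cong (λ d′ → basic d d′) y)) x ⟩
      linear (λ d → linear (λ d′ → δ (d ≟ e) K.* δ (d′ ≟′ e′)) y) x
        ≈⟨ linear-* x y _ _ ⟩
      linear (λ d → δ (d ≟ e)) x K.* linear (λ d′ → δ (d′ ≟′ e′)) y
        ≈⟨ K.*-cong (coeff-linear x e) (coeff-linear′ y e′) ⟨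
      coeff x e K.* coeff′ y e′ ∎
      where
      basic : ∀ d d′ → coeff⊗ (basis (d , d′)) (e , e′) K.≈ δ (d ≟ e) K.* δ (d′ ≟′ e′)
      basic d d′ = K.trans (coeff⊗-basis (d , d′) (e , e′)) (K.trans
        (K.reflexive (δ-cong (Product.≡-dec _≟_ _≟′_ (d , d′) (e , e′)) ((d ≟ e) ×-dec (d′ ≟′ e′))
          (λ { ≡.refl → ≡.refl , ≡.refl }) (λ { (≡.refl , ≡.refl) → ≡.refl })))
        (δ-× (d ≟ e) (d′ ≟′ e′)))

-- Counting in finite lists

filter-map : ∀ {P : Pred Y p} (P? : Decidable P) (f : X → Y) xs →
             filter P? (List.map f xs) ≡ List.map f (filter (P? ∘ f) xs)
filter-map P? f [] = ≡.refl
filter-map P? f (x ∷ xs) with P? (f x)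
... | yes _ = ≡.cong (f x ∷_) (filter-map P? f xs)
... | no _  = filter-map P? f xs

length-filter-map : ∀ {P : Pred Y p} (P? : Decidable P) (f : X → Y) xs →
                    length (filter P? (List.map f xs)) ≡ length (filter (P? ∘ f) xs)
length-filter-map P? f xs = ≡.trans (≡.cong length (filter-map P? f xs)) (List.length-map f (filter (P? ∘ f) xs))

-- Pigeonhole: each entry of `xs` uses up a place of its own in `ys`, and the bound on the lengths
-- leaves no place over.
unique-⊆⇒↭ : ∀ {xs ys : List X} → Uniqueˡ xs → (∀ {x} → x ∈ xs → x ∈ ys) → length ys ≤ length xs → xs ↭ ys
unique-⊆⇒↭ {xs = []}     {[]} _ _ _ = ↭-refl
unique-⊆⇒↭ {xs = x ∷ xs} {ys} (x∉ ∷ u) xs⊆ys len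
  with ys₁ , ys₂ , ≡.refl ← ∈-∃++ (xs⊆ys (here ≡.refl)) =
  ↭-trans (prep x (unique-⊆⇒↭ u ⊆′ len′)) (↭-sym (shift x ys₁ ys₂))
  where
  ⊆′ : ∀ {y} → y ∈ xs → y ∈ ys₁ ++ ys₂
  ⊆′ y∈ with ∈-resp-↭ (shift x ys₁ ys₂) (xs⊆ys (there y∈))
  ... | here ≡.refl = contradiction ≡.refl (All.lookup x∉ y∈)
  ... | there y∈′ = y∈′
  len′ : length (ys₁ ++ ys₂) ≤ length xs
  len′ = ℕ.s≤s⁻¹ (≡.subst (_≤ suc (length xs)) (↭-length (shift x ys₁ ys₂)) len)

length-allFin : ∀ n → length (allFin n) ≡ n
length-allFin n = List.length-tabulate {n = n} id

unique⇒↭-allFin : ∀ {xs : List (Fin n)} → Uniqueˡ xs → length xs ≡ n → xs ↭ allFin n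
unique⇒↭-allFin {n = n} u len = unique-⊆⇒↭ u (λ {x} _ → ∈-allFin x)
  (ℕ.≤-reflexive (≡.trans (length-allFin n) (≡.sym len)))

-- It serves twice: for the rank of a letter in a permutation, and for the number of letters that a
-- colored permutation has in an initial interval of values.
count-< : ∀ n i → i ≤ n → length (filter (λ (x : Fin n) → toℕ x ℕ.<? i) (allFin n)) ≡ i
count-< n zero _ = ≡.cong length (List.filter-none (λ x → toℕ x ℕ.<? 0) (All.universal (λ _ ()) (allFin n)))
count-< (suc n) (suc i) (s≤s i≤n) = ≡.cong suc (begin
  length (filter (λ x → toℕ x ℕ.<? suc i) (List.tabulate {n = n} suc))
    ≡⟨ ≡.cong (length ∘ filter (λ x → toℕ x ℕ.<? suc i)) (≡.sym (List.map-tabulate {n = n} id Fin.suc)) ⟩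
  length (filter (λ x → toℕ x ℕ.<? suc i) (List.map Fin.suc (allFin n)))
    ≡⟨ length-filter-map _ Fin.suc (allFin n) ⟩
  length (filter (λ x → suc (toℕ x) ℕ.<? suc i) (allFin n))
    ≡⟨ ≡.cong length (List.filter-≐ (λ x → suc (toℕ x) ℕ.<? suc i) (λ x → toℕ x ℕ.<? i) (ℕ.s≤s⁻¹ , s≤s) (allFin n)) ⟩
  length (filter (λ x → toℕ x ℕ.<? i) (allFin n))
    ≡⟨ count-< n i i≤n ⟩
  i ∎)
  where open ≡.≡-Reasoning

-- Standardization

rank-toℕ : (v : Vec (Fin k) m) → ∀ i → toℕ (lookup (word (std v)) i) ≡ rank v i
rank-toℕ v i = ≡.trans (≡.cong toℕ (Vec.lookup∘tabulate _ i)) (Fin.toℕ-fromℕ< (rank< v i))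

word-injective : {σ τ : Perm n} → word σ ≡ word τ → σ ≡ τ
word-injective ≡.refl = ≡.refl

std-cong : (v : Vec (Fin k) m) (v′ : Vec (Fin k′) m) →
           (∀ {i j} → Precedes v j i → Precedes v′ j i) →
           (∀ {i j} → Precedes v′ j i → Precedes v j i) → std v ≡ std v′
std-cong {m = m} v v′ to from = word-injective (Vec.tabulate-cong λ i →
  Fin.fromℕ<-cong _ _
    (≡.cong length (List.filter-≐ (λ j → precedes? v j i) (λ j → precedes? v′ j i) (to , from) (allFin m)))
    (rank< v i) (rank< v′ i))

-- Without repeated letters the tie clause of `Precedes` is void, so the rank counts the positions
-- carrying smaller letters. The letters of `v` are a rearrangement of `Fin n`, hence this number is
-- the letter itself.
rank-unique : (v : Vec (Fin n) n) → Unique v → ∀ i → rank v i ≡ toℕ (lookup v i)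
rank-unique {n} v u i = begin
  length (filter (λ j → precedes? v j i) (allFin n))
    ≡⟨ ≡.cong length (List.filter-≐ (λ j → precedes? v j i) (λ j → lookup v j Fin.<? lookup v i) (to , inj₁) (allFin n)) ⟩
  length (filter (λ j → lookup v j Fin.<? lookup v i) (allFin n))
    ≡⟨ length-filter-map (Fin._<? lookup v i) (lookup v) (allFin n) ⟨
  length (filter (Fin._<? lookup v i) (List.map (lookup v) (allFin n)))
    ≡⟨ ↭-length (filter-↭ (Fin._<? lookup v i) (unique⇒↭-allFin (Uniqueˡ.map⁺ (lookup-injective u _ _) (Uniqueˡ.allFin⁺ n))
         (≡.trans (List.length-map (lookup v) (allFin n)) (length-allFin n)))) ⟩
  length (filter (Fin._<? lookup v i) (allFin n))
    ≡⟨ count-< n (toℕ (lookup v i)) (ℕ.<⇒≤ (Fin.toℕ<n (lookup v i))) ⟩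
  toℕ (lookup v i) ∎
  where
  open ≡.≡-Reasoning
  to : ∀ {j} → Precedes v j i → lookup v j Fin.< lookup v i
  to (inj₁ lt) = lt
  to (inj₂ (eq , lt)) = contradiction (≡.cong toℕ (lookup-injective u _ _ eq)) (ℕ.<⇒≢ lt)

word-std : (v : Vec (Fin n) n) → Unique v → word (std v) ≡ v
word-std v u = ≡.trans (Vec.tabulate-cong λ i → Fin.toℕ-injective
    (≡.trans (Fin.toℕ-fromℕ< (rank< v i)) (rank-unique v u i)))
  (Vec.tabulate∘lookup v)

-- The field `unique` is irrelevant; since distinctness is decidable, a usable proof can be
-- recomputed.
word-unique : (σ : Perm n) → Unique (word σ)
word-unique (perm v u) = recompute (allPairs? (λ i j → ¬? (i Fin.≟ j)) v) u

std-word : (σ : Perm n) → std (word σ) ≡ σ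
std-word σ = word-injective (word-std (word σ) (word-unique σ))

-- Two words are order isomorphic when their letters compare in the same way;
-- such a pair is represented by the list of the pairs of corresponding letters.

SameOrder : Fin k × Fin k′ → Fin k × Fin k′ → Set
SameOrder (x , y) (x′ , y′) = (x Fin.≤ x′ → y Fin.≤ y′) × (y Fin.≤ y′ → x Fin.≤ x′)

-- Ties are broken from left to right, so for `i < j` the position `i` precedes `j` exactly when its
-- letter is at most that of `j`. The weak comparisons at increasing positions thus determine the
-- whole standardization; `std-order` is the same observation for a word and its own
-- standardization.
std-sameOrder : (v : Vec (Fin k) m) (v′ : Vec (Fin k′) m) →
  (∀ {i j} → i Fin.< j → SameOrder (lookup v i , lookup v′ i) (lookup v j , lookup v′ j)) →
  std v ≡ std v′
std-sameOrder v v′ same = std-cong v v′ (λ {i} {j} → transfer v v′ same {i} {j})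
  (λ {i} {j} → transfer v′ v (λ lt → proj₂ (same lt) , proj₁ (same lt)) {i} {j})
  where
  transfer : ∀ {k k′ m} (v : Vec (Fin k) m) (v′ : Vec (Fin k′) m) →
    (∀ {i j} → i Fin.< j → SameOrder (lookup v i , lookup v′ i) (lookup v j , lookup v′ j)) →
    ∀ {i j} → Precedes v j i → Precedes v′ j i
  transfer v v′ same {i} {j} (inj₂ (eq , j<i))
    with ℕ.m≤n⇒m<n∨m≡n (proj₁ (same j<i) (ℕ.≤-reflexive (≡.cong toℕ eq)))
  ... | inj₁ lt  = inj₁ lt
  ... | inj₂ eq′ = inj₂ (Fin.toℕ-injective eq′ , j<i)
  transfer v v′ same {i} {j} (inj₁ lt) with Fin.<-cmp j i
  ... | tri≈ _ ≡.refl _ = contradiction ≡.refl (ℕ.<⇒≢ lt)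
  ... | tri> _ _ i<j = inj₁ (ℕ.≰⇒> (λ le → ℕ.<⇒≱ lt (proj₂ (same i<j) le)))
  ... | tri< j<i _ _ with ℕ.m≤n⇒m<n∨m≡n (proj₁ (same j<i) (ℕ.<⇒≤ lt))
  ...   | inj₁ lt′ = inj₁ lt′
  ...   | inj₂ eq′ = inj₂ (Fin.toℕ-injective eq′ , j<i)

std-order : (v : Vec (Fin k) m) → ∀ {i j} → i Fin.< j →
            SameOrder (lookup (word (std v)) i , lookup v i) (lookup (word (std v)) j , lookup v j)
std-order v {i} {j} i<j = to , from
  where
  to : _ → _
  to le = ℕ.≮⇒≥ λ lt → ℕ.<⇒≱ (rank-mono v (inj₁ lt))
    (≡.subst₂ _≤_ (rank-toℕ v i) (rank-toℕ v j) le)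
  from : _ → _
  from le = ≡.subst₂ _≤_ (≡.sym (rank-toℕ v i)) (≡.sym (rank-toℕ v j)) (ℕ.<⇒≤ (rank-mono v i≺j))
    where
    i≺j : Precedes v i j
    i≺j with ℕ.m≤n⇒m<n∨m≡n le
    ... | inj₁ lt = inj₁ lt
    ... | inj₂ eq = inj₂ (Fin.toℕ-injective eq , i<j)

-- Colored words and their standardization

module ColoredWords (l : ℕ) where

  Letter : ℕ → Set
  Letter k = Fin k × Fin l

  ColoredPermutation : Set
  ColoredPermutation = Σ ℕ λ n → Perm n × Vec (Fin l) n

  stdᵛ : Vec (Letter k) m → ColoredPermutation
  stdᵛ {m = m} v = m , std (Vec.map proj₁ v) , Vec.map proj₂ v

  stdʷ : List (Letter k) → ColoredPermutation
  stdʷ w = stdᵛ (Vec.fromList w)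

  toWord : ((n , _) : ColoredPermutation) → List (Letter n)
  toWord (_ , σ , u) = Vec.toList (Vec.zip (word σ) u)

  length-toWord : ∀ e → length (toWord e) ≡ proj₁ e
  length-toWord (_ , σ , u) = Vec.length-toList (Vec.zip (word σ) u)

  -- The two lengths agree only propositionally, hence the equality of dependent pairs.
  fromList-toList : (v : Vec X m) → _≡_ {A = Σ ℕ (Vec X)} (_ , Vec.fromList (Vec.toList v)) (m , v)
  fromList-toList []      = ≡.refl
  fromList-toList (x ∷ v) = ≡.cong (λ (m , v) → suc m , x ∷ v) (fromList-toList v)

  stdʷ-toList : (v : Vec (Letter k) m) → stdʷ (Vec.toList v) ≡ stdᵛ v
  stdʷ-toList v = ≡.cong (λ (_ , v) → stdᵛ v) (fromList-toList v)

  -- This section of `stdʷ` is what allows an element to be tested on words instead of colored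
  -- permutations.
  stdʷ-toWord : ∀ e → stdʷ (toWord e) ≡ e
  stdʷ-toWord (_ , σ , u) = ≡.trans (stdʷ-toList (Vec.zip (word σ) u))
    (≡.cong₂ (λ v u → (_ , v , u))
      (≡.trans (≡.cong std (Vec.map-proj₁-zip (word σ) u)) (std-word σ))
      (Vec.map-proj₂-zip (word σ) u))

  toWord-stdᵛ : (v : Vec (Letter n) n) → Unique (Vec.map proj₁ v) → toWord (stdᵛ v) ≡ Vec.toList v
  toWord-stdᵛ v u = ≡.cong Vec.toList (≡.trans (≡.cong (λ w → Vec.zip w (Vec.map proj₂ v)) (word-std _ u))
    (≡.trans (≡.sym (Vec.map-<,>-zip proj₁ proj₂ v)) (Vec.map-id v)))

  -- As a property of a single list of pairs it passes to factors and to shuffles by the general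
  -- rules for `All` and `AllPairs`, and cutting or shuffling the pairs acts on both words at once.
  OrderIso : List (Letter k × Letter k′) → Set
  OrderIso z = AllPairs (SameOrder on (λ ((x , _) , (y , _)) → x , y)) z ×
               All (λ ((_ , c) , (_ , d)) → c ≡ d) z

  lookup-AllPairs : ∀ {r} {R : X → X → Set r} {z : List X} → AllPairs R z →
                    ∀ {i j} → i Fin.< j → R (lookup (Vec.fromList z) i) (lookup (Vec.fromList z) j)
  lookup-AllPairs (r ∷ rs) {zero}  {suc j} _         = All-lookup r j
    where
    All-lookup : ∀ {P : Pred X p} {z} → All P z → ∀ j → P (lookup (Vec.fromList z) j)
    All-lookup (p ∷ _)  zero    = p
    All-lookup (_ ∷ ps) (suc j) = All-lookup ps j
  lookup-AllPairs (r ∷ rs) {suc i} {suc j} (s≤s i<j) = lookup-AllPairs rs i<j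

  AllPairs-lookup : ∀ {r} {R : X → X → Set r} (v : Vec X m) →
                    (∀ {i j} → i Fin.< j → R (lookup v i) (lookup v j)) → AllPairs R (Vec.toList v)
  AllPairs-lookup {X = X} [] _ = []
  AllPairs-lookup {X = X} (x ∷ v) rs = lookup-All v (λ j → rs {zero} {suc j} (s≤s z≤n)) ∷ AllPairs-lookup v (λ lt → rs (s≤s lt))
    where
    lookup-All : ∀ {P : Pred X p} {m} (v : Vec X m) → (∀ j → P (lookup v j)) → All P (Vec.toList v)
    lookup-All []      ps = []
    lookup-All (x ∷ v) ps = ps zero ∷ lookup-All v (ps ∘ suc)

  map-toList : (f : X → Y) (z : List X) → List.map f z ≡ Vec.toList (Vec.map f (Vec.fromList z))
  map-toList f z = ≡.trans (≡.cong (List.map f) (≡.sym (Vec.toList∘fromList z))) (≡.sym (Vec.toList-map f (Vec.fromList z)))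

  stdʷ-OrderIso : (z : List (Letter k × Letter k′)) → OrderIso z →
                  stdʷ (List.map proj₁ z) ≡ stdʷ (List.map proj₂ z)
  stdʷ-OrderIso z (same , colors) = begin
    stdʷ (List.map proj₁ z)                 ≡⟨ ≡.cong stdʷ (map-toList proj₁ z) ⟩
    stdʷ (Vec.toList (Vec.map proj₁ V))     ≡⟨ stdʷ-toList (Vec.map proj₁ V) ⟩
    stdᵛ (Vec.map proj₁ V)                  ≡⟨ ≡.cong₂ (λ σ u → _ , σ , u) (std-sameOrder (Vec.map proj₁
        (Vec.map proj₁ V)) (Vec.map proj₁ (Vec.map proj₂ V)) same′) (colors′ colors) ⟩
    stdᵛ (Vec.map proj₂ V)                  ≡⟨ stdʷ-toList (Vec.map proj₂ V) ⟨
    stdʷ (Vec.toList (Vec.map proj₂ V))     ≡⟨ ≡.cong stdʷ (map-toList proj₂ z) ⟨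
    stdʷ (List.map proj₂ z)                 ∎
    where
    open ≡.≡-Reasoning
    V = Vec.fromList z
    l₁ : ∀ i → lookup (Vec.map proj₁ (Vec.map proj₁ V)) i ≡ proj₁ (proj₁ (lookup V i))
    l₁ i = ≡.trans (Vec.lookup-map i proj₁ (Vec.map proj₁ V)) (≡.cong proj₁ (Vec.lookup-map i proj₁ V))
    l₂ : ∀ i → lookup (Vec.map proj₁ (Vec.map proj₂ V)) i ≡ proj₁ (proj₂ (lookup V i))
    l₂ i = ≡.trans (Vec.lookup-map i proj₁ (Vec.map proj₂ V)) (≡.cong proj₁ (Vec.lookup-map i proj₂ V))
    same′ : ∀ {i j} → i Fin.< j → SameOrder _ _
    same′ {i} {j} i<j = ≡.subst₂ SameOrder (≡.cong₂ _,_ (≡.sym (l₁ i)) (≡.sym (l₂ i))) (≡.cong₂ _,_ (≡.sym (l₁ j)) (≡.sym (l₂ j)))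
      (lookup-AllPairs same i<j)
    colors′ : ∀ {z : List (Letter _ × Letter _)} → All (λ ((_ , c) , (_ , d)) → c ≡ d) z → Vec.map proj₂
        (Vec.map proj₁ (Vec.fromList z)) ≡ Vec.map proj₂ (Vec.map proj₂ (Vec.fromList z))
    colors′ []        = ≡.refl
    colors′ (eq ∷ cs) = ≡.cong₂ _∷_ eq (colors′ cs)

  -- The standardization of `w` paired letter by letter with `w`. The two projections compare a
  -- construction on `w` with the same construction on `toWord (stdʷ w)`.
  align : (w : List (Letter k)) → List (Letter (length w) × Letter k)
  align w = Vec.toList (Vec.zip (Vec.zip (word (std (Vec.map proj₁ (Vec.fromList w)))) (Vec.map proj₂
      (Vec.fromList w))) (Vec.fromList w))

  align₁ : (w : List (Letter k)) → List.map proj₁ (align w) ≡ toWord (stdʷ w)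
  align₁ w = ≡.trans (≡.sym (Vec.toList-map proj₁ _)) (≡.cong Vec.toList (Vec.map-proj₁-zip _ (Vec.fromList w)))

  align₂ : (w : List (Letter k)) → List.map proj₂ (align w) ≡ w
  align₂ w = ≡.trans (≡.sym (Vec.toList-map proj₂ _))
    (≡.trans (≡.cong Vec.toList (Vec.map-proj₂-zip (Vec.zip _ (Vec.map proj₂ (Vec.fromList w))) (Vec.fromList w)))
        (Vec.toList∘fromList w))

  align-OrderIso : (w : List (Letter k)) → OrderIso (align w)
  align-OrderIso w = AllPairs-lookup _ (λ {i} {j} i<j → ≡.subst₂ SameOrder (eq i) (eq j) (std-order (Vec.map proj₁ v) i<j))
                   , colors v σ
    where
    v = Vec.fromList w
    σ = word (std (Vec.map proj₁ v))
    V = Vec.zip (Vec.zip σ (Vec.map proj₂ v)) v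
    eq : ∀ i → (lookup σ i , lookup (Vec.map proj₁ v) i) ≡ (proj₁ (proj₁ (lookup V i)) , proj₁ (proj₂ (lookup V i)))
    eq i rewrite Vec.lookup-zip i (Vec.zip σ (Vec.map proj₂ v)) v | Vec.lookup-zip i σ (Vec.map proj₂ v)
               | Vec.lookup-map i proj₁ v = ≡.refl
    colors : ∀ {k m n} (v : Vec (Letter k) m) (σ : Vec (Fin n) m) → All (λ ((_ , c) , (_ , d)) → c ≡ d) (Vec.toList
        (Vec.zip (Vec.zip σ (Vec.map proj₂ v)) v))
    colors []      []      = []
    colors (x ∷ v) (y ∷ σ) = ≡.refl ∷ colors v σ

-- Deconcatenation and shuffles

splits : List X → List (List X × List X)
splits []      = ([] , []) ∷ []
splits (x ∷ w) = ([] , x ∷ w) ∷ List.map (λ (u , v) → x ∷ u , v) (splits w)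

∈-splits : ∀ (w : List X) {u v} → (u , v) ∈ splits w → u ++ v ≡ w
∈-splits []      (here ≡.refl) = ≡.refl
∈-splits (x ∷ w) (here ≡.refl) = ≡.refl
∈-splits (x ∷ w) (there uv∈) with _ , uv∈′ , ≡.refl ← ∈-map⁻ _ uv∈ = ≡.cong (x ∷_) (∈-splits w uv∈′)

splits-map : ∀ (f : X → Y) w → splits (List.map f w) ≡ List.map (λ (u , v) → List.map f u , List.map f v) (splits w)
splits-map f []      = ≡.refl
splits-map f (x ∷ w) = ≡.cong (([] , f x ∷ List.map f w) ∷_) (≡.trans (≡.cong (List.map (λ (u , v) → f x ∷ u , v))
    (splits-map f w))
  (≡.trans (≡.sym (List.map-∘ (splits w))) (List.map-∘ (splits w))))

shuffles : List X → List X → List (List X)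
shuffles []      v       = v ∷ []
shuffles (x ∷ u) []      = (x ∷ u) ∷ []
shuffles (x ∷ u) (y ∷ v) = List.map (x ∷_) (shuffles u (y ∷ v)) ++ List.map (y ∷_) (shuffles (x ∷ u) v)

shuffles-[] : ∀ (u : List X) → shuffles u [] ≡ u ∷ []
shuffles-[] []      = ≡.refl
shuffles-[] (x ∷ u) = ≡.refl

shuffles-map : ∀ (f : X → Y) u v → shuffles (List.map f u) (List.map f v) ≡ List.map (List.map f) (shuffles u v)
shuffles-map f []      v       = ≡.refl
shuffles-map f (x ∷ u) []      = ≡.refl
shuffles-map f (x ∷ u) (y ∷ v) = ≡.sym (≡.trans
  (List.map-++ (List.map f) (List.map (x ∷_) (shuffles u (y ∷ v))) _)
  (≡.cong₂ _++_ (step x (shuffles u (y ∷ v)) (shuffles-map f u (y ∷ v)))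
                (step y (shuffles (x ∷ u) v) (shuffles-map f (x ∷ u) v))))
  where
  step : ∀ x ws {ws′} → ws′ ≡ List.map (List.map f) ws →
         List.map (List.map f) (List.map (x ∷_) ws) ≡ List.map (f x ∷_) ws′
  step x ws ≡.refl = ≡.trans (≡.sym (List.map-∘ ws)) (List.map-∘ ws)

-- Induction on the way a shuffle is built. The premises mirror the clauses of `shuffles`, so the
-- last two speak of nonempty words on both sides only.
shuffles-elim : ∀ {P : List X → List X → List X → Set p} →
  (∀ v → P [] v v) → (∀ x u → P (x ∷ u) [] (x ∷ u)) →
  (∀ {x u y v w} → P u (y ∷ v) w → P (x ∷ u) (y ∷ v) (x ∷ w)) →
  (∀ {x u y v w} → P (x ∷ u) v w → P (x ∷ u) (y ∷ v) (y ∷ w)) →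
  ∀ u v {w} → w ∈ shuffles u v → P u v w
shuffles-elim {P = P} b₁ b₂ l r []      v  (here ≡.refl) = b₁ v
shuffles-elim {P = P} b₁ b₂ l r (x ∷ u) [] (here ≡.refl) = b₂ x u
shuffles-elim {P = P} b₁ b₂ l r (x ∷ u) (y ∷ v) w∈ with ∈-++⁻ (List.map (x ∷_) (shuffles u (y ∷ v))) w∈
... | inj₁ w∈ˡ with _ , w∈′ , ≡.refl ← ∈-map⁻ _ w∈ˡ = l (shuffles-elim {P = P} b₁ b₂ l r u (y ∷ v) w∈′)
... | inj₂ w∈ʳ with _ , w∈′ , ≡.refl ← ∈-map⁻ _ w∈ʳ = r (shuffles-elim {P = P} b₁ b₂ l r (x ∷ u) v w∈′)

shuffles-All : ∀ {P : Pred X p} u v {w} → w ∈ shuffles u v → All P u → All P v → All P w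
shuffles-All {P = P} = shuffles-elim {P = λ u v w → All P u → All P v → All P w}
  (λ _ _ pv → pv) (λ _ _ pu _ → pu)
  (λ { ih (px ∷ pu) pv → px ∷ ih pu pv }) (λ { ih pu (py ∷ pv) → py ∷ ih pu pv })

shuffles-length : ∀ (u v : List X) {w} → w ∈ shuffles u v → length w ≡ length u ℕ.+ length v
shuffles-length = shuffles-elim {P = λ u v w → length w ≡ length u ℕ.+ length v}
  (λ _ → ≡.refl) (λ x u → ≡.sym (ℕ.+-identityʳ _))
  (λ ih → ≡.cong suc ih) (λ {x} {u} {y} {v} ih → ≡.trans (≡.cong suc ih) (≡.sym (ℕ.+-suc (suc (length u)) (length v))))

-- In a shuffle a letter of `u` can stand on either side of a letter of `v`, so mixed pairs must be
-- related in both directions.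
shuffles-AllPairs : ∀ {R : X → X → Set r} u v {w} → w ∈ shuffles u v → AllPairs R u → AllPairs R v →
                    All (λ x → All (λ y → R x y × R y x) v) u → AllPairs R w
shuffles-AllPairs []      v       (here ≡.refl) _  rv _ = rv
shuffles-AllPairs (x ∷ u) []      (here ≡.refl) ru _  _ = ru
shuffles-AllPairs (x ∷ u) (y ∷ v) w∈ (rx ∷ ru) (ry ∷ rv) (rxy ∷ ruv)
  with ∈-++⁻ (List.map (x ∷_) (shuffles u (y ∷ v))) w∈
... | inj₁ w∈ˡ with _ , w∈′ , ≡.refl ← ∈-map⁻ _ w∈ˡ =
  shuffles-All u (y ∷ v) w∈′ rx (All.map proj₁ rxy) ∷ shuffles-AllPairs u (y ∷ v) w∈′ ru (ry ∷ rv) ruv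
... | inj₂ w∈ʳ with _ , w∈′ , ≡.refl ← ∈-map⁻ _ w∈ʳ =
  shuffles-All (x ∷ u) v w∈′ (All.map (proj₂ ∘ All.head) (rxy ∷ ruv)) ry
  ∷ shuffles-AllPairs (x ∷ u) v w∈′ (rx ∷ ru) rv (All.map All.tail (rxy ∷ ruv))

-- Sums over factorizations and shuffles

module SumsOverWords {m ℓm} (M : CommutativeMonoid m ℓm) where
  open CommutativeMonoid M renaming (_∙_ to _+_; ε to 0#; ∙-cong to +-cong; ∙-congˡ to +-congˡ; ∙-congʳ to +-congʳ; identityˡ to +-identityˡ;
    identityʳ to +-identityʳ; assoc to +-assoc; comm to +-comm)
  open FiniteSums M
  open import Relation.Binary.Reasoning.Setoid setoid
  open import Algebra.Properties.CommutativeSemigroup commutativeSemigroup using (interchange; x∙yz≈y∙xz)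

  sum-splits-∷ : ∀ x (w : List X) f →
                 sum (splits (x ∷ w)) f ≈ f ([] , x ∷ w) + sum (splits w) (λ (u , v) → f (x ∷ u , v))
  sum-splits-∷ x w f = +-congˡ (reflexive (sum-map _ (splits w) f))

  -- The length of the left factor determines the split, so a summand that vanishes for every other
  -- length leaves a single term.
  sum-splits-at : ∀ (u v : List X) f → (∀ {u′ v′} → (u′ , v′) ∈ splits (u ++ v) → length u′ ≢ length u → f (u′ , v′) ≈ 0#) →
                  sum (splits (u ++ v)) f ≈ f (u , v)
  sum-splits-at []      []      f f-0 = +-identityʳ _
  sum-splits-at []      (y ∷ v) f f-0 = trans (sum-splits-∷ y v f)
    (trans (+-congˡ (sum-0 (splits v) (λ uv∈ → f-0 (there (∈-map⁺ _ uv∈)) λ ()))) (+-identityʳ _))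
  sum-splits-at (x ∷ u) v f f-0 = trans (sum-splits-∷ x (u ++ v) f)
    (trans (+-cong (f-0 (here ≡.refl) λ ()) (sum-splits-at u v (λ (u , v) → f (x ∷ u , v))
      (λ uv∈ ne → f-0 (there (∈-map⁺ _ uv∈)) (ne ∘ ℕ.suc-injective))))
      (+-identityˡ _))

  -- Both sides run over the factorizations of `w` into three factors. This coassociativity of
  -- deconcatenation is the source of the associativity of `_*ˡ_`.
  sum-splits-assoc : ∀ (w : List X) (f : List X → List X → List X → Carrier) →
    sum (splits w) (λ (s , v) → sum (splits s) (λ (t , u) → f t u v)) ≈
    sum (splits w) (λ (t , s) → sum (splits s) (λ (u , v) → f t u v))
  sum-splits-assoc []      f = refl
  sum-splits-assoc (x ∷ w) f = begin
    sum (splits (x ∷ w)) (λ (s , v) → sum (splits s) (λ (t , u) → f t u v))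
      ≈⟨ sum-splits-∷ x w _ ⟩
    (f [] [] (x ∷ w) + 0#) + sum (splits w) (λ (s , v) → sum (splits (x ∷ s)) (λ (t , u) → f t u v))
      ≈⟨ +-cong (+-identityʳ _) (trans (sum-cong (splits w) (λ (s , v) → sum-splits-∷ x s _)) (sum-+ (splits w) _ _)) ⟩
    f [] [] (x ∷ w) + (sum (splits w) (λ (s , v) → f [] (x ∷ s) v) + sum (splits w) (λ (s , v) → sum (splits s) (λ
        (t , u) → f (x ∷ t) u v)))
      ≈⟨ +-congˡ (+-congˡ (sum-splits-assoc w (λ t u v → f (x ∷ t) u v))) ⟩
    f [] [] (x ∷ w) + (sum (splits w) (λ (s , v) → f [] (x ∷ s) v) + sum (splits w) (λ (t , s) → sum (splits s) (λ
        (u , v) → f (x ∷ t) u v)))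
      ≈⟨ +-assoc _ _ _ ⟨
    (f [] [] (x ∷ w) + sum (splits w) (λ (s , v) → f [] (x ∷ s) v)) + sum (splits w) (λ (t , s) → sum (splits s) (λ
        (u , v) → f (x ∷ t) u v))
      ≈⟨ +-congʳ (sum-splits-∷ x w (λ (u , v) → f [] u v)) ⟨
    sum (splits (x ∷ w)) (λ (u , v) → f [] u v) + sum (splits w) (λ (t , s) → sum (splits s) (λ (u , v) → f (x ∷ t) u v))
      ≈⟨ sum-splits-∷ x w _ ⟨
    sum (splits (x ∷ w)) (λ (t , s) → sum (splits s) (λ (u , v) → f t u v)) ∎

  sum-shuffles-∷ : ∀ x u y (v : List X) f →
    sum (shuffles (x ∷ u) (y ∷ v)) f ≈ sum (shuffles u (y ∷ v)) (f ∘ (x ∷_)) + sum (shuffles (x ∷ u) v) (f ∘ (y ∷_))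
  sum-shuffles-∷ x u y v f = trans (sum-++ (List.map (x ∷_) (shuffles u (y ∷ v))) _ f)
    (+-cong (reflexive (sum-map (x ∷_) (shuffles u (y ∷ v)) f)) (reflexive (sum-map (y ∷_) (shuffles (x ∷ u) v) f)))

  sum-shuffles-[] : ∀ (u : List X) f → sum (shuffles u []) f ≈ f u
  sum-shuffles-[] u f = trans (reflexive (≡.cong (λ ws → sum ws f) (shuffles-[] u))) (+-identityʳ _)

  -- The bialgebra axiom for deconcatenation and shuffles.
  sum-shuffles-splits : ∀ (u v : List X) (f : List X → List X → Carrier) →
    sum (shuffles u v) (λ w → sum (splits w) (λ (s , t) → f s t)) ≈
    sum (splits u) (λ (u₁ , u₂) → sum (splits v) (λ (v₁ , v₂) →
      sum (shuffles u₁ v₁) (λ s → sum (shuffles u₂ v₂) (λ t → f s t))))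
  sum-shuffles-splits [] v f = begin
    sum (splits v) (λ (s , t) → f s t) + 0#
      ≈⟨ +-congʳ (sum-cong (splits v) (λ (s , t) → sym (trans (+-identityʳ _) (+-identityʳ _)))) ⟩
    sum (splits v) (λ (v₁ , v₂) → sum (shuffles [] v₁) (λ s → sum (shuffles [] v₂) (λ t → f s t))) + 0# ∎
  sum-shuffles-splits (x ∷ u) [] f = begin
    sum (splits (x ∷ u)) (λ (s , t) → f s t) + 0#
      ≈⟨ +-identityʳ _ ⟩
    sum (splits (x ∷ u)) (λ (s , t) → f s t)
      ≈⟨ sum-cong (splits (x ∷ u)) (λ (s , t) → sym (trans (+-identityʳ _) (trans (sum-shuffles-[] s _) (sum-shuffles-[] t _)))) ⟩
    sum (splits (x ∷ u)) (λ (u₁ , u₂) → sum (shuffles u₁ []) (λ s → sum (shuffles u₂ []) (λ t → f s t)) + 0#) ∎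
  sum-shuffles-splits {X = X} (x ∷ u) (y ∷ v) f = begin
    sum (shuffles (x ∷ u) (y ∷ v)) (λ w → sum (splits w) (λ (s , t) → f s t))
      ≈⟨ sum-shuffles-∷ x u y v _ ⟩
    sum (shuffles u (y ∷ v)) (λ w → sum (splits (x ∷ w)) (λ (s , t) → f s t))
      + sum (shuffles (x ∷ u) v) (λ w → sum (splits (y ∷ w)) (λ (s , t) → f s t))
      ≈⟨ +-cong (trans (sum-cong (shuffles u (y ∷ v)) (λ w → sum-splits-∷ x w _)) (sum-+ (shuffles u (y ∷ v)) _ _))
                (trans (sum-cong (shuffles (x ∷ u) v) (λ w → sum-splits-∷ y w _)) (sum-+ (shuffles (x ∷ u) v) _ _)) ⟩
    (sum (shuffles u (y ∷ v)) (λ w → f [] (x ∷ w)) + sum (shuffles u (y ∷ v)) (λ w → sum (splits w) (λ (s , t) → f (x ∷ s) t)))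
      + (sum (shuffles (x ∷ u) v) (λ w → f [] (y ∷ w)) + sum (shuffles (x ∷ u) v) (λ w → sum (splits w) (λ
          (s , t) → f (y ∷ s) t)))
      ≈⟨ interchange _ _ _ _ ⟩
    (sum (shuffles u (y ∷ v)) (λ w → f [] (x ∷ w)) + sum (shuffles (x ∷ u) v) (λ w → f [] (y ∷ w)))
      + (sum (shuffles u (y ∷ v)) (λ w → sum (splits w) (λ (s , t) → f (x ∷ s) t)) + sum (shuffles (x ∷ u) v)
          (λ w → sum (splits w) (λ (s , t) → f (y ∷ s) t)))
      ≈⟨ +-cong (sym (sum-shuffles-∷ x u y v (f [])))
                (+-cong (sum-shuffles-splits u (y ∷ v) (λ s t → f (x ∷ s) t)) (sum-shuffles-splits (x ∷ u) v
                    (λ s t → f (y ∷ s) t))) ⟩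
    F[] [] (x ∷ u) [] (y ∷ v)
      + (sum (splits u) (λ (u₁ , u₂) → sum (splits (y ∷ v)) (λ (v₁ , v₂) → Fˣ u₁ u₂ v₁ v₂))
         + sum (splits (x ∷ u)) (λ (u₁ , u₂) → sum (splits v) (λ (v₁ , v₂) → Fʸ u₁ u₂ v₁ v₂)))
      ≈⟨ +-congˡ (+-cong
           (trans (sum-cong (splits u) (λ (u₁ , u₂) → sum-splits-∷ y v _)) (sum-+ (splits u) _ _))
           (sum-splits-∷ x u _)) ⟩
    F[] [] (x ∷ u) [] (y ∷ v)
      + ((sum (splits u) (λ (u₁ , u₂) → Fˣ u₁ u₂ [] (y ∷ v)) + sum (splits u) (λ (u₁ , u₂) → sum (splits v) (λ
          (v₁ , v₂) → Fˣ u₁ u₂ (y ∷ v₁) v₂)))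
         + (sum (splits v) (λ (v₁ , v₂) → Fʸ [] (x ∷ u) v₁ v₂) + sum (splits u) (λ (u₁ , u₂) → sum (splits v) (λ
             (v₁ , v₂) → Fʸ (x ∷ u₁) u₂ v₁ v₂))))
      ≈⟨ +-congˡ (trans (interchange _ _ _ _) (trans (+-congʳ (+-comm _ _)) (+-assoc _ _ _))) ⟩
    F[] [] (x ∷ u) [] (y ∷ v)
      + (sum (splits v) (λ (v₁ , v₂) → Fʸ [] (x ∷ u) v₁ v₂)
         + (sum (splits u) (λ (u₁ , u₂) → Fˣ u₁ u₂ [] (y ∷ v))
            + (sum (splits u) (λ (u₁ , u₂) → sum (splits v) (λ (v₁ , v₂) → Fˣ u₁ u₂ (y ∷ v₁) v₂)) + sum (splits u)
                (λ (u₁ , u₂) → sum (splits v) (λ (v₁ , v₂) → Fʸ (x ∷ u₁) u₂ v₁ v₂)))))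
      ≈⟨ +-assoc _ _ _ ⟨
    (F[] [] (x ∷ u) [] (y ∷ v) + sum (splits v) (λ (v₁ , v₂) → Fʸ [] (x ∷ u) v₁ v₂))
      + (sum (splits u) (λ (u₁ , u₂) → Fˣ u₁ u₂ [] (y ∷ v))
         + (sum (splits u) (λ (u₁ , u₂) → sum (splits v) (λ (v₁ , v₂) → Fˣ u₁ u₂ (y ∷ v₁) v₂)) + sum (splits u) (λ
             (u₁ , u₂) → sum (splits v) (λ (v₁ , v₂) → Fʸ (x ∷ u₁) u₂ v₁ v₂))))
      ≈⟨ +-cong (+-congʳ (sym (+-identityʳ _)))
           (trans (+-cong (sum-cong (splits u) (λ (u₁ , u₂) → Fˣ≈ u₁ u₂))
              (trans (sym (sum-+ (splits u) _ _)) (sum-cong (splits u) (λ (u₁ , u₂) →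
                trans (sym (sum-+ (splits v) _ _)) (sum-cong (splits v) (λ (v₁ , v₂) → sym (sum-shuffles-∷ x u₁ y v₁ _)))))))
            (sym (sum-+ (splits u) _ _))) ⟩
    (F [] (x ∷ u) [] (y ∷ v) + sum (splits v) (λ (v₁ , v₂) → F [] (x ∷ u) (y ∷ v₁) v₂))
      + sum (splits u) (λ (u₁ , u₂) → F (x ∷ u₁) u₂ [] (y ∷ v) + sum (splits v) (λ (v₁ , v₂) → F (x ∷ u₁) u₂ (y ∷ v₁) v₂))
      ≈⟨ +-cong (sym (sum-splits-∷ y v (λ (v₁ , v₂) → F [] (x ∷ u) v₁ v₂)))
                (sum-cong (splits u) (λ (u₁ , u₂) → sym (sum-splits-∷ y v (λ (v₁ , v₂) → F (x ∷ u₁) u₂ v₁ v₂)))) ⟩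
    sum (splits (y ∷ v)) (λ (v₁ , v₂) → F [] (x ∷ u) v₁ v₂)
      + sum (splits u) (λ (u₁ , u₂) → sum (splits (y ∷ v)) (λ (v₁ , v₂) → F (x ∷ u₁) u₂ v₁ v₂))
      ≈⟨ sum-splits-∷ x u _ ⟨
    sum (splits (x ∷ u)) (λ (u₁ , u₂) → sum (splits (y ∷ v)) (λ (v₁ , v₂) → F u₁ u₂ v₁ v₂)) ∎
    where
    -- `F[]` accounts for an empty left factor of the shuffle, `Fˣ` and `Fʸ` for a left factor
    -- starting with `x` and with `y`. The chain above distributes these three contributions over
    -- the cases in which `u₁` and `v₁` are empty or not.
    F F[] Fˣ Fʸ : List X → List X → List X → List X → Carrier
    F   u₁ u₂ v₁ v₂ = sum (shuffles u₁ v₁) (λ s → sum (shuffles u₂ v₂) (λ t → f s t))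
    F[] u₁ u₂ v₁ v₂ = sum (shuffles u₂ v₂) (λ t → f [] t)
    Fˣ  u₁ u₂ v₁ v₂ = sum (shuffles u₁ v₁) (λ s → sum (shuffles u₂ v₂) (λ t → f (x ∷ s) t))
    Fʸ  u₁ u₂ v₁ v₂ = sum (shuffles u₁ v₁) (λ s → sum (shuffles u₂ v₂) (λ t → f (y ∷ s) t))
    Fˣ≈ : ∀ u₁ u₂ → Fˣ u₁ u₂ [] (y ∷ v) ≈ F (x ∷ u₁) u₂ [] (y ∷ v)
    Fˣ≈ u₁ u₂ = trans (sum-shuffles-[] u₁ (λ s → sum (shuffles u₂ (y ∷ v)) (λ t → f (x ∷ s) t)))
      (sym (sum-shuffles-[] (x ∷ u₁) (λ s → sum (shuffles u₂ (y ∷ v)) (λ t → f s t))))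

-- Multiplicity of a word in a shuffle

module CountShuffles {c ℓ} (K : CommutativeRing c ℓ) where
  open FreeModules K
  private module K = CommutativeRing K
  open SumsOverWords K.+-commutativeMonoid
  open import Relation.Binary.Reasoning.Setoid K.setoid

  module _ {X : Set a} (_≟_ : DecidableEquality X) {P : Pred X p} (P? : Decidable P) where
    private
      _≟ʷ_ = List.≡-dec _≟_

    δ-∷ : ∀ x u y v → δ ((x ∷ u) ≟ʷ (y ∷ v)) K.≈ δ (x ≟ y) K.* δ (u ≟ʷ v)
    δ-∷ x u y v = K.trans (K.reflexive (δ-cong ((x ∷ u) ≟ʷ (y ∷ v)) (x ≟ y ×-dec (u ≟ʷ v)) List.∷-injective (λ
        (p , q) → ≡.cong₂ _∷_ p q)))
      (δ-× (x ≟ y) (u ≟ʷ v))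

    filter-[]⇒none : ∀ {Q : Pred X q} (Q? : Decidable Q) t → filter Q? t ≡ [] → All (¬_ ∘ Q) t
    filter-[]⇒none Q? []      _  = []
    filter-[]⇒none Q? (h ∷ t) eq with Q? h
    ... | no ¬q = ¬q ∷ filter-[]⇒none Q? t eq

    -- Since `P` separates the letters of `u` from those of `v`, the first letter of `t` decides
    -- which branch of the recursion can produce `t`. So `t` occurs at most once, and its two
    -- subwords tell whether it does. This turns restriction to intervals of values, as in the
    -- coproduct, into shuffles.
    count-shuffles : ∀ t u v → All P u → All (¬_ ∘ P) v →
      sum (shuffles u v) (λ w → δ (t ≟ʷ w)) K.≈ δ (filter P? t ≟ʷ u) K.* δ (filter (∁? P?) t ≟ʷ v)
    count-shuffles t [] v _ ¬pv = K.trans (K.+-identityʳ _) (K.trans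
      (K.reflexive (δ-cong (t ≟ʷ v) ((filter P? t ≟ʷ []) ×-dec (filter (∁? P?) t ≟ʷ v))
        (λ { ≡.refl → List.filter-none P? ¬pv , List.filter-all (∁? P?) ¬pv })
        (λ (eq , eq′) → ≡.trans (≡.sym (List.filter-all (∁? P?) (filter-[]⇒none P? t eq))) eq′)))
      (δ-× (filter P? t ≟ʷ []) (filter (∁? P?) t ≟ʷ v)))
    count-shuffles t (x ∷ u) [] pu _ = K.trans (K.+-identityʳ _) (K.trans
      (K.reflexive (δ-cong (t ≟ʷ (x ∷ u)) ((filter P? t ≟ʷ (x ∷ u)) ×-dec (filter (∁? P?) t ≟ʷ []))
        (λ { ≡.refl → List.filter-all P? pu , List.filter-none (∁? P?) (All.map (λ p ¬p → ¬p p) pu) })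
        (λ (eq , eq′) → ≡.trans (≡.sym (List.filter-all P? (All.map stable (filter-[]⇒none (∁? P?) t eq′)))) eq)))
      (δ-× (filter P? t ≟ʷ (x ∷ u)) (filter (∁? P?) t ≟ʷ [])))
      where
      stable : ∀ {x} → ¬ ¬ P x → P x
      stable {x} ¬¬p with P? x
      ... | yes p = p
      ... | no ¬p = contradiction ¬p ¬¬p
    count-shuffles [] (x ∷ u) (y ∷ v) (px ∷ pu) (¬py ∷ ¬pv) = K.trans (sum-shuffles-∷ x u y v _)
      (K.trans (K.+-cong (empty x (shuffles u (y ∷ v))) (empty y (shuffles (x ∷ u) v)))
        (K.trans (K.+-identityˡ _) (K.sym (δ-0 ([] ≟ʷ (x ∷ u)) λ ()))))
      where
      empty : ∀ z ws → sum ws (λ w → δ ([] ≟ʷ (z ∷ w))) K.≈ K.0#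
      empty z ws = sum-0 ws (λ {w} _ → K.reflexive (δ-no ([] ≟ʷ (z ∷ w)) λ ()))
    count-shuffles (h ∷ t) (x ∷ u) (y ∷ v) (px ∷ pu) (¬py ∷ ¬pv) = begin
      sum (shuffles (x ∷ u) (y ∷ v)) (λ w → δ ((h ∷ t) ≟ʷ w))
        ≈⟨ sum-shuffles-∷ x u y v _ ⟩
      sum (shuffles u (y ∷ v)) (λ w → δ ((h ∷ t) ≟ʷ (x ∷ w))) K.+ sum (shuffles (x ∷ u) v) (λ w → δ ((h ∷ t) ≟ʷ (y ∷ w)))
        ≈⟨ K.+-cong (head x (shuffles u (y ∷ v))) (head y (shuffles (x ∷ u) v)) ⟩
      δ (h ≟ x) K.* sum (shuffles u (y ∷ v)) (λ w → δ (t ≟ʷ w)) K.+ δ (h ≟ y) K.* sum (shuffles (x ∷ u) v) (λ w → δ (t ≟ʷ w))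
        ≈⟨ K.+-cong (K.*-congˡ (count-shuffles t u (y ∷ v) pu (¬py ∷ ¬pv))) (K.*-congˡ (count-shuffles t (x ∷ u) v
            (px ∷ pu) ¬pv)) ⟩
      δ (h ≟ x) K.* (δ (filter P? t ≟ʷ u) K.* δ (filter (∁? P?) t ≟ʷ (y ∷ v)))
        K.+ δ (h ≟ y) K.* (δ (filter P? t ≟ʷ (x ∷ u)) K.* δ (filter (∁? P?) t ≟ʷ v))
        ≈⟨ step ⟩
      δ (filter P? (h ∷ t) ≟ʷ (x ∷ u)) K.* δ (filter (∁? P?) (h ∷ t) ≟ʷ (y ∷ v)) ∎
      where
      head : ∀ z ws → sum ws (λ w → δ ((h ∷ t) ≟ʷ (z ∷ w))) K.≈ δ (h ≟ z) K.* sum ws (λ w → δ (t ≟ʷ w))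
      head z ws = K.trans (sum-cong ws (λ w → δ-∷ h t z w)) (K.sym (*-sum (δ (h ≟ z)) ws _))
      step : δ (h ≟ x) K.* (δ (filter P? t ≟ʷ u) K.* δ (filter (∁? P?) t ≟ʷ (y ∷ v)))
        K.+ δ (h ≟ y) K.* (δ (filter P? t ≟ʷ (x ∷ u)) K.* δ (filter (∁? P?) t ≟ʷ v)) K.≈
        δ (filter P? (h ∷ t) ≟ʷ (x ∷ u)) K.* δ (filter (∁? P?) (h ∷ t) ≟ʷ (y ∷ v))
      step with P? h
      ... | yes ph = K.trans (K.+-cong (K.sym (K.*-assoc _ _ _)) (δ-0 (h ≟ y) (λ { ≡.refl → contradiction ph ¬py })))
        (K.trans (K.+-identityʳ _) (K.*-congʳ (K.sym (δ-∷ h (filter P? t) x u))))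
      ... | no ¬ph = K.trans (K.+-cong (δ-0 (h ≟ x) (λ { ≡.refl → contradiction px ¬ph })) (x∙yz≈y∙xz _ _ _))
        (K.trans (K.+-identityˡ _) (K.*-congˡ (K.sym (δ-∷ h (filter (∁? P?) t) y v))))
        where open import Algebra.Properties.CommutativeSemigroup K.*-commutativeSemigroup using (x∙yz≈y∙xz)

-- Realization by series and the product formula

words-unique : ∀ {X : Set} {as : List X} → Uniqueˡ as → ∀ n → Uniqueˡ (words as n)
words-unique u zero    = [] ∷ []
words-unique u (suc n) = Uniqueˡ.cartesianProductWith⁺ _∷_ Vec.∷-injective u (words-unique u n)

∈-words : ∀ {X : Set} {as : List X} → (w : Vec X n) → (∀ i → lookup w i ∈ as) → w ∈ words as n
∈-words []      _  = here ≡.refl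
∈-words (x ∷ w) w⊆ = ∈-cartesianProductWith⁺ _∷_ (w⊆ zero) (∈-words w (w⊆ ∘ suc))

module Series {c ℓ} (K : CommutativeRing c ℓ) (l : ℕ) where
  open FQSym K l
  open ColoredWords l
  open FreeModules K hiding (module Coefficients)
  private
    module K = CommutativeRing K
  open FreeModules.Coefficients K _≟ᶜ_ hiding (coeff; _≈ˡ_)
  open SumsOverWords K.+-commutativeMonoid
  open import Relation.Binary.Reasoning.Setoid K.setoid

  -- The sum is pulled back to all words of length `n`, which are listed without repetition; words
  -- with a repeated letter contribute zero.
  sum-perms : ∀ (τ : Perm n) f → (∀ {σ} → σ ≢ τ → f σ K.≈ K.0#) → sum (perms n) f K.≈ f τ
  sum-perms {n} τ f f-0 = begin
    sum (perms n) f                                    ≈⟨ sum-mapMaybe toPerm (words (List.allFin n) n) f ⟩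
    sum (words (List.allFin n) n) (maybe′ f K.0# ∘ toPerm) ≈⟨ sum-single (maybe′ f K.0# ∘ toPerm) (words-unique
        (Uniqueˡ.allFin⁺ n) n)
                                                             (∈-words (word τ) (λ i → ∈-allFin (lookup (word τ) i)))
                                                                 (λ {w} _ → others w) ⟩
    maybe′ f K.0# (toPerm (word τ))                    ≈⟨ this ⟩
    f τ                                                ∎
    where
    toPerm : Vec (Fin n) n → Maybe.Maybe (Perm n)
    toPerm w = Maybe.map (λ u → perm w u) (dec⇒maybe (allPairs? (λ i j → ¬? (i Fin.≟ j)) w))
    this : maybe′ f K.0# (toPerm (word τ)) K.≈ f τ
    this with allPairs? (λ i j → ¬? (i Fin.≟ j)) (word τ)
    ... | yes _ = K.refl
    ... | no ¬u = contradiction (word-unique τ) ¬u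
    others : ∀ w → w ≢ word τ → maybe′ f K.0# (toPerm w) K.≈ K.0#
    others w w≢ with allPairs? (λ i j → ¬? (i Fin.≟ j)) w
    ... | yes _ = f-0 (w≢ ∘ ≡.cong word)
    ... | no _  = K.refl

  -- The realization of FQSym by noncommutative series: the coefficient of a word
  -- in the series of x is the coefficient in x of its standardization.
  ⟦_⟧ : FQ → List (Letter k) → K.Carrier
  ⟦ x ⟧ w = coeff x (stdʷ w)

  ⟦⟧-injective : ∀ x y → (∀ {k} (w : List (Letter k)) → ⟦ x ⟧ w K.≈ ⟦ y ⟧ w) → x ≈ˡ y
  ⟦⟧-injective x y eq e = ≡.subst (λ e → coeff x e K.≈ coeff y e) (stdʷ-toWord e) (eq (toWord e))

  OrderIso-splits : ∀ {k k′} {z : List (Letter k × Letter k′)} → OrderIso z → ∀ {u v} → (u , v) ∈ splits z →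
                    OrderIso u × OrderIso v
  OrderIso-splits {z = z} (same , colors) {u} {v} uv∈ with ≡.refl ← ∈-splits z uv∈ =
    (++⁻ˡ u same , All.++⁻ˡ u colors) , (++⁻ʳ u same , All.++⁻ʳ u colors)
    where
    ++⁻ˡ : ∀ {r} {X : Set a} {R : X → X → Set r} u {v} → AllPairs R (u ++ v) → AllPairs R u
    ++⁻ˡ []      _        = []
    ++⁻ˡ (x ∷ u) (r ∷ rs) = All.++⁻ˡ u r ∷ ++⁻ˡ u rs
    ++⁻ʳ : ∀ {r} {X : Set a} {R : X → X → Set r} u {v} → AllPairs R (u ++ v) → AllPairs R v
    ++⁻ʳ []      rs       = rs
    ++⁻ʳ (x ∷ u) (r ∷ rs) = ++⁻ʳ u rs

  -- Corresponding factors of `w` and of its standardization are order isomorphic and so standardize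
  -- alike. Both sums are images of one sum over `splits (align w)`.
  sum-splits-std : (w : List (Letter k)) (f : ColoredPerm → ColoredPerm → K.Carrier) →
    sum (splits w) (λ (u , v) → f (stdʷ u) (stdʷ v)) K.≈ sum (splits (toWord (stdʷ w))) (λ (u , v) → f (stdʷ u) (stdʷ v))
  sum-splits-std w f = ≡.subst₂ (λ w t → sum (splits w) (λ (u , v) → f (stdʷ u) (stdʷ v)) K.≈ sum (splits t) (λ
      (u , v) → f (stdʷ u) (stdʷ v)))
      (align₂ w) (align₁ w) (begin
    sum (splits (List.map proj₂ (align w))) (λ (u , v) → f (stdʷ u) (stdʷ v))
      ≡⟨ ≡.trans (≡.cong (λ s → sum s (λ (u , v) → f (stdʷ u) (stdʷ v))) (splits-map proj₂ (align w))) (sum-map _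
          (splits (align w)) _) ⟩
    sum (splits (align w)) (λ (u , v) → f (stdʷ (List.map proj₂ u)) (stdʷ (List.map proj₂ v)))
      ≈⟨ sum-cong-∈ (splits (align w)) (λ {(u , v)} uv∈ → let (isoᵘ , isoᵛ) = OrderIso-splits (align-OrderIso w) uv∈ in
           K.reflexive (≡.sym (≡.cong₂ f (stdʷ-OrderIso u isoᵘ) (stdʷ-OrderIso v isoᵛ)))) ⟩
    sum (splits (align w)) (λ (u , v) → f (stdʷ (List.map proj₁ u)) (stdʷ (List.map proj₁ v)))
      ≡⟨ ≡.trans (≡.cong (λ s → sum s (λ (u , v) → f (stdʷ u) (stdʷ v))) (splits-map proj₁ (align w))) (sum-map _
          (splits (align w)) _) ⟨
    sum (splits (List.map proj₁ (align w))) (λ (u , v) → f (stdʷ u) (stdʷ v)) ∎)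

  ≡ᶜ⁻ : ∀ {n} {σ τ : Perm n} {u v : Vec Color n} → _≡_ {A = ColoredPerm} (n , σ , u) (n , τ , v) → σ ≡ τ × u ≡ v
  ≡ᶜ⁻ ≡.refl = ≡.refl , ≡.refl

  -- The condition defining `σ′ ∗ σ″` concerns the prefix of length `m′` and what follows it, that
  -- is, one split of the word of `t`. The sum may run over all splits because `e ≟ᶜ stdʷ u`
  -- compares the sizes as well.
  coeff-*ᴳ : ∀ e e′ t → coeff (e *ᴳ e′) t K.≈ sum (splits (toWord t)) (λ (u , v) → δ (e ≟ᶜ stdʷ u) K.* δ (e′ ≟ᶜ stdʷ v))
  coeff-*ᴳ (m′ , σ′ , u′) (m″ , σ″ , u″) (n , τ , v) with n ℕ.≟ m′ ℕ.+ m″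
  ... | no n≢ = K.trans (coeff-Σ (σ′ ∗ σ″) (λ σ → G σ (u′ Vec.++ u″)) (n , τ , v)) (K.trans
      (sum-0 (σ′ ∗ σ″) (λ {σ} _ → K.trans (coeff-basis (_ , σ , u′ Vec.++ u″) (n , τ , v))
        (K.reflexive (δ-no ((_ , σ , u′ Vec.++ u″) ≟ᶜ (n , τ , v)) (λ eq → n≢ (≡.sym (≡.cong proj₁ eq)))))))
      (K.sym (sum-0 (splits (toWord (n , τ , v))) (λ {(s , t)} st∈ →
        δ-0 ((m′ , σ′ , u′) ≟ᶜ stdʷ s) (λ eq → K.reflexive (δ-no ((m″ , σ″ , u″) ≟ᶜ stdʷ t) (λ eq′ →
          n≢ (≡.trans (≡.sym (length-toWord (n , τ , v))) (≡.trans (≡.cong length (≡.sym (∈-splits (toWord (n , τ , v)) st∈)))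
            (≡.trans (List.length-++ s) (≡.sym (≡.cong₂ ℕ._+_ (≡.cong proj₁ eq) (≡.cong proj₁ eq′)))))))))))))
  ... | yes ≡.refl = begin
    coeff (Σ[ σ′ ∗ σ″ ] λ σ → G σ (u′ Vec.++ u″)) t
      ≈⟨ coeff-Σ (σ′ ∗ σ″) _ t ⟩
    sum (σ′ ∗ σ″) (λ σ → coeff (G σ (u′ Vec.++ u″)) t)
      ≈⟨ sum-filter cond? (perms (m′ ℕ.+ m″)) _ ⟩
    sum (perms (m′ ℕ.+ m″)) (λ σ → δ (cond? σ) K.* coeff (G σ (u′ Vec.++ u″)) t)
      ≈⟨ sum-perms τ _ others ⟩
    δ (cond? τ) K.* coeff (G τ (u′ Vec.++ u″)) t
      ≈⟨ match ⟩
    δ (((m′ , σ′ , u′) ≟ᶜ stdʷ (Vec.toList V₁)) ×-dec ((m″ , σ″ , u″) ≟ᶜ stdʷ (Vec.toList V₂)))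
      ≈⟨ δ-× ((m′ , σ′ , u′) ≟ᶜ stdʷ (Vec.toList V₁)) ((m″ , σ″ , u″) ≟ᶜ stdʷ (Vec.toList V₂)) ⟩
    g (Vec.toList V₁ , Vec.toList V₂)
      ≈⟨ sum-splits-at (Vec.toList V₁) (Vec.toList V₂) g (λ {s} {s′} _ ne →
           δ-0 ((m′ , σ′ , u′) ≟ᶜ stdʷ s) (λ eq → contradiction (≡.trans (≡.sym (≡.cong proj₁ eq)) (≡.sym
               (Vec.length-toList V₁))) ne)) ⟨
    sum (splits (Vec.toList V₁ ++ Vec.toList V₂)) g
      ≡⟨ ≡.cong (λ w → sum (splits w) g) (≡.trans (≡.sym (Vec.toList-++ V₁ V₂)) (≡.cong Vec.toList (Vec.take++drop≡id m′ V))) ⟩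
    sum (splits (toWord t)) g ∎
    where
    t : ColoredPerm
    t = m′ ℕ.+ m″ , τ , v
    g : List (Letter (m′ ℕ.+ m″)) × List (Letter (m′ ℕ.+ m″)) → K.Carrier
    g (s , s′) = δ ((m′ , σ′ , u′) ≟ᶜ stdʷ s) K.* δ ((m″ , σ″ , u″) ≟ᶜ stdʷ s′)
    V : Vec (Letter (m′ ℕ.+ m″)) (m′ ℕ.+ m″)
    V = Vec.zip (word τ) v
    V₁ : Vec (Letter (m′ ℕ.+ m″)) m′
    V₁ = Vec.take m′ V
    V₂ : Vec (Letter (m′ ℕ.+ m″)) m″
    V₂ = Vec.drop m′ V
    cond? : ∀ σ → Dec (std (Vec.take m′ (word σ)) ≡ σ′ × std (Vec.drop m′ (word σ)) ≡ σ″)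
    cond? σ = (std (Vec.take m′ (word σ)) ≟ᵖ σ′) ×-dec (std (Vec.drop m′ (word σ)) ≟ᵖ σ″)
    others : ∀ {σ} → σ ≢ τ → δ (cond? σ) K.* coeff (G σ (u′ Vec.++ u″)) t K.≈ K.0#
    others {σ} σ≢ = δ-0 (cond? σ) (λ _ → K.trans (coeff-basis (_ , σ , u′ Vec.++ u″) t)
      (K.reflexive (δ-no ((_ , σ , u′ Vec.++ u″) ≟ᶜ t) (λ eq → σ≢ (proj₁ (≡ᶜ⁻ eq))))))
    std₁ : stdʷ (Vec.toList V₁) ≡ (m′ , std (Vec.take m′ (word τ)) , Vec.take m′ v)
    std₁ = ≡.trans (stdʷ-toList V₁) (≡.cong₂ (λ w c → m′ , std w , c)
      (≡.trans (≡.sym (Vec.take-map proj₁ m′ V)) (≡.cong (Vec.take m′) (Vec.map-proj₁-zip (word τ) v)))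
      (≡.trans (≡.sym (Vec.take-map proj₂ m′ V)) (≡.cong (Vec.take m′) (Vec.map-proj₂-zip (word τ) v))))
    std₂ : stdʷ (Vec.toList V₂) ≡ (m″ , std (Vec.drop m′ (word τ)) , Vec.drop m′ v)
    std₂ = ≡.trans (stdʷ-toList V₂) (≡.cong₂ (λ w c → m″ , std w , c)
      (≡.trans (≡.sym (Vec.drop-map proj₁ m′ V)) (≡.cong (Vec.drop m′) (Vec.map-proj₁-zip (word τ) v)))
      (≡.trans (≡.sym (Vec.drop-map proj₂ m′ V)) (≡.cong (Vec.drop m′) (Vec.map-proj₂-zip (word τ) v))))
    match : δ (cond? τ) K.* coeff (G τ (u′ Vec.++ u″)) t K.≈
            δ (((m′ , σ′ , u′) ≟ᶜ stdʷ (Vec.toList V₁)) ×-dec ((m″ , σ″ , u″) ≟ᶜ stdʷ (Vec.toList V₂)))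
    match = K.trans (K.*-congˡ (coeff-basis (m′ ℕ.+ m″ , τ , u′ Vec.++ u″) t))
      (K.trans (K.sym (δ-× (cond? τ) ((m′ ℕ.+ m″ , τ , u′ Vec.++ u″) ≟ᶜ t))) (K.reflexive
        (δ-cong (cond? τ ×-dec ((m′ ℕ.+ m″ , τ , u′ Vec.++ u″) ≟ᶜ t))
                (((m′ , σ′ , u′) ≟ᶜ stdʷ (Vec.toList V₁)) ×-dec ((m″ , σ″ , u″) ≟ᶜ stdʷ (Vec.toList V₂)))
          (λ ((eq₁ , eq₂) , eq) →
            let eqᵘ = Vec.++-injective u′ (Vec.take m′ v) (≡.trans (proj₂ (≡ᶜ⁻ eq)) (≡.sym (Vec.take++drop≡id m′ v))) in
            ≡.trans (≡.cong₂ (λ σ u → m′ , σ , u) (≡.sym eq₁) (proj₁ eqᵘ)) (≡.sym std₁) ,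
            ≡.trans (≡.cong₂ (λ σ u → m″ , σ , u) (≡.sym eq₂) (proj₂ eqᵘ)) (≡.sym std₂))
          (λ (eq , eq′) → (≡.sym (proj₁ (≡ᶜ⁻ (≡.trans eq std₁))) , ≡.sym (proj₁ (≡ᶜ⁻ (≡.trans eq′ std₂)))) ,
            ≡.cong (λ u → m′ ℕ.+ m″ , τ , u) (≡.trans (≡.cong₂ Vec._++_ (proj₂ (≡ᶜ⁻ (≡.trans eq std₁))) (proj₂ (≡ᶜ⁻
                (≡.trans eq′ std₂))))
              (Vec.take++drop≡id m′ v))))))

  ⟦⟧-linear : ∀ x (w : List (Letter k)) → ⟦ x ⟧ w K.≈ linear (λ e → δ (e ≟ᶜ stdʷ w)) x
  ⟦⟧-linear x w = coeff-linear x (stdʷ w)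

  -- This is the bilinear extension of `coeff-*ᴳ`, carried from the standardization of `w` to `w`
  -- itself by `sum-splits-std`.
  ⟦⟧-* : ∀ x y (w : List (Letter k)) → ⟦ x *ˡ y ⟧ w K.≈ sum (splits w) (λ (u , v) → ⟦ x ⟧ u K.* ⟦ y ⟧ v)
  ⟦⟧-* x y w = begin
    ⟦ x *ˡ y ⟧ w
      ≈⟨ coeff-extend _ x (stdʷ w) ⟩
    linear (λ e → coeff (extend (λ e′ → e *ᴳ e′) y) (stdʷ w)) x
      ≈⟨ linear-cong (λ e → K.trans (coeff-extend _ y (stdʷ w)) (linear-cong (λ e′ → basic e e′) y)) x ⟩
    linear (λ e → linear (λ e′ → sum (splits w) (λ (u , v) → δ (e ≟ᶜ stdʷ u) K.* δ (e′ ≟ᶜ stdʷ v))) y) x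
      ≈⟨ linear-cong (λ e → linear-sum (splits w) (λ (u , v) e′ → δ (e ≟ᶜ stdʷ u) K.* δ (e′ ≟ᶜ stdʷ v)) y) x ⟩
    linear (λ e → sum (splits w) (λ (u , v) → linear (λ e′ → δ (e ≟ᶜ stdʷ u) K.* δ (e′ ≟ᶜ stdʷ v)) y)) x
      ≈⟨ linear-sum (splits w) (λ (u , v) e → linear (λ e′ → δ (e ≟ᶜ stdʷ u) K.* δ (e′ ≟ᶜ stdʷ v)) y) x ⟩
    sum (splits w) (λ (u , v) → linear (λ e → linear (λ e′ → δ (e ≟ᶜ stdʷ u) K.* δ (e′ ≟ᶜ stdʷ v)) y) x)
      ≈⟨ sum-cong (splits w) (λ (u , v) → linear-* x y (λ e → δ (e ≟ᶜ stdʷ u)) (λ e → δ (e ≟ᶜ stdʷ v))) ⟩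
    sum (splits w) (λ (u , v) → linear (λ e → δ (e ≟ᶜ stdʷ u)) x K.* linear (λ e → δ (e ≟ᶜ stdʷ v)) y)
      ≈⟨ sum-cong (splits w) (λ (u , v) → K.sym (K.*-cong (⟦⟧-linear x u) (⟦⟧-linear y v))) ⟩
    sum (splits w) (λ (u , v) → ⟦ x ⟧ u K.* ⟦ y ⟧ v) ∎
    where
    basic : ∀ e e′ → coeff (e *ᴳ e′) (stdʷ w) K.≈ sum (splits w) (λ (u , v) → δ (e ≟ᶜ stdʷ u) K.* δ (e′ ≟ᶜ stdʷ v))
    basic e e′ = K.trans (coeff-*ᴳ e e′ (stdʷ w)) (K.sym (sum-splits-std w (λ s t → δ (e ≟ᶜ s) K.* δ (e′ ≟ᶜ t))))

-- The coproduct of a series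

length-filter-∁ : ∀ {P : Pred X q} (P? : Decidable P) xs →
                  length (filter P? xs) ℕ.+ length (filter (∁? P?) xs) ≡ length xs
length-filter-∁ P? [] = ≡.refl
length-filter-∁ P? (x ∷ xs) with P? x
... | yes _ = ≡.cong suc (length-filter-∁ P? xs)
... | no _  = ≡.trans (ℕ.+-suc _ _) (≡.cong suc (length-filter-∁ P? xs))

module Words (l : ℕ) where
  open ColoredWords l

  DistinctLetters : List (Letter k) → Set
  DistinctLetters = AllPairs (_≢_ on proj₁)

  toVec : {w : List X} → length w ≡ n → ∃[ v ] Vec.toList {n = n} v ≡ w
  toVec {w = w} ≡.refl = Vec.fromList w , Vec.toList∘fromList w

  unique-letters : (v : Vec (Letter k) n) → DistinctLetters (Vec.toList v) → Unique (Vec.map proj₁ v)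
  unique-letters []      []       = []
  unique-letters (x ∷ v) (x≢ ∷ d) = fresh v x≢ ∷ unique-letters v d
    where
    fresh : ∀ {n} (v : Vec (Letter _) n) → All (λ y → proj₁ x ≢ proj₁ y) (Vec.toList v) → Vecᴬ.All (proj₁ x ≢_) (Vec.map proj₁ v)
    fresh []      []       = Vecᴬ.[]
    fresh (y ∷ v) (≢ ∷ ≢s) = ≢ Vecᴬ.∷ fresh v ≢s

  -- The hypothesis fixes the length of `w` to be the size of its alphabet. With distinct letters
  -- `w` is then the word of a permutation, which standardization leaves unchanged.
  stdʷ≡⇒toWord≡ : ∀ {e} {w : List (Letter (proj₁ e))} → DistinctLetters w → stdʷ w ≡ e → toWord e ≡ w
  stdʷ≡⇒toWord≡ {w = w} d eq with v , ≡.refl ← toVec {w = w} (≡.cong proj₁ eq) =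
    ≡.trans (≡toWord (≡.trans (≡.sym eq) (stdʷ-toList v))) (toWord-stdᵛ v (unique-letters v d))
    where
    ≡toWord : ∀ {n} {σ τ : Perm n × Vec (Fin l) n} → _≡_ {A = ColoredPermutation} (n , σ) (n , τ) → toWord
        (n , σ) ≡ toWord (n , τ)
    ≡toWord ≡.refl = ≡.refl

  toWord-distinct : ∀ e → DistinctLetters (toWord e)
  toWord-distinct (n , σ , u) = AllPairs-lookup (Vec.zip (word σ) u) (λ {i} {j} i<j eq →
    ℕ.<⇒≢ i<j (≡.cong toℕ (lookup-injective (word-unique σ) i j
      (≡.trans (≡.sym (letterAt i)) (≡.trans eq (letterAt j))))))
    where
    letterAt : ∀ i → proj₁ (lookup (Vec.zip (word σ) u) i) ≡ lookup (word σ) i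
    letterAt i = ≡.cong proj₁ (Vec.lookup-zip i (word σ) u)

  inˡ : ∀ q → Letter k → Letter (k ℕ.+ q)
  inˡ q = map₁ (_↑ˡ q)

  inʳ : ∀ p → Letter k → Letter (p ℕ.+ k)
  inʳ p = map₁ (p ↑ʳ_)

  Small : ℕ → Letter k → Set
  Small p x = toℕ (proj₁ x) < p

  small? : ∀ p → Decidable (Small {k} p)
  small? p x = toℕ (proj₁ x) ℕ.<? p

  inˡ-small : ∀ q (w : List (Letter k)) → All (Small k) (List.map (inˡ q) w)
  inˡ-small q w = All.map⁺ (All.universal (λ (x , _) → ≡.subst (_< _) (≡.sym (Fin.toℕ-↑ˡ x q)) (Fin.toℕ<n x)) w)

  inʳ-large : ∀ p (w : List (Letter k)) → All (¬_ ∘ Small p) (List.map (inʳ p) w)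
  inʳ-large p w = All.map⁺ (All.universal (λ (x , _) lt → ℕ.<⇒≱ lt (≡.subst (p ≤_) (≡.sym (Fin.toℕ-↑ʳ p x))
      (ℕ.m≤m+n p (toℕ x)))) w)

  small⇒inˡ : ∀ p q {w : List (Letter (p ℕ.+ q))} → All (Small p) w → ∃[ s ] List.map (inˡ q) s ≡ w
  small⇒inˡ p q [] = [] , ≡.refl
  small⇒inˡ p q {(x , c) ∷ w} (lt ∷ lts) with s , ≡.refl ← small⇒inˡ p q lts =
    (fromℕ< lt , c) ∷ s , ≡.cong (λ x → (x , c) ∷ List.map (inˡ q) s) (Fin.toℕ-injective (≡.trans (Fin.toℕ-↑ˡ _ q)
        (Fin.toℕ-fromℕ< lt)))

  large⇒inʳ : ∀ p q {w : List (Letter (p ℕ.+ q))} → All (¬_ ∘ Small p) w → ∃[ s ] List.map (inʳ p) s ≡ w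
  large⇒inʳ p q [] = [] , ≡.refl
  large⇒inʳ p q {(x , c) ∷ w} (ge ∷ ges) with s , ≡.refl ← large⇒inʳ p q ges with Fin.splitAt p x in eq
  ... | inj₂ y = (y , c) ∷ s , ≡.cong (λ x → (x , c) ∷ List.map (inʳ p) s) (Fin.splitAt⁻¹-↑ʳ eq)
  ... | inj₁ y = contradiction (≡.subst (_< p) (≡.trans (≡.sym (Fin.toℕ-↑ˡ y q)) (≡.cong toℕ (Fin.splitAt⁻¹-↑ˡ eq)))
      (Fin.toℕ<n y)) ge

  map₂-OrderIso : ∀ {k k′ p p′} (f : Fin k → Fin p) (g : Fin k′ → Fin p′) →
    (∀ {x y} → x Fin.≤ y → f x Fin.≤ f y) → (∀ {x y} → f x Fin.≤ f y → x Fin.≤ y) →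
    (∀ {x y} → x Fin.≤ y → g x Fin.≤ g y) → (∀ {x y} → g x Fin.≤ g y → x Fin.≤ y) →
    {z : List (Letter k × Letter k′)} → OrderIso z → OrderIso (List.map (λ (x , y) → map₁ f x , map₁ g y) z)
  map₂-OrderIso f g f↑ f↓ g↑ g↓ (same , colors) =
    AllPairs.map⁺ (AllPairs.map (λ (to , from) → (λ le → g↑ (to (f↓ le))) , (λ le → f↑ (from (g↓ le)))) same) , All.map⁺ colors

  diagonal-OrderIso : (w : List (Letter k)) → OrderIso (List.map (λ x → x , x) w)
  diagonal-OrderIso w = AllPairs.map⁺ (allPairs w) , All.map⁺ (All.universal (λ _ → ≡.refl) w)
    where
    allPairs : ∀ w → AllPairs _ w
    allPairs []      = []
    allPairs (x ∷ w) = All.universal (λ _ → id , id) w ∷ allPairs w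

  stdʷ-map : ∀ {p} (f : Fin k → Fin p) → (∀ {x y} → x Fin.≤ y → f x Fin.≤ f y) → (∀ {x y} → f x Fin.≤ f y → x Fin.≤ y) →
             ∀ w → stdʷ (List.map (map₁ f) w) ≡ stdʷ w
  stdʷ-map f f↑ f↓ w = ≡.subst₂ (λ u v → stdʷ u ≡ stdʷ v) (eq proj₁ (map₁ f) (λ _ → ≡.refl))
      (≡.trans (eq proj₂ id (λ _ → ≡.refl)) (List.map-id w))
      (stdʷ-OrderIso _ (map₂-OrderIso f id f↑ f↓ id id (diagonal-OrderIso w)))
    where
    eq : ∀ {Y : Set} (g : Letter _ × Letter _ → Y) (h : Letter _ → Y) → (∀ x → g (map₁ f x , map₁ id x) ≡ h x) →
         List.map g (List.map (λ (x , y) → map₁ f x , map₁ id y) (List.map (λ x → x , x) w)) ≡ List.map h w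
    eq g h eq = ≡.trans (≡.sym (List.map-∘ (List.map (λ x → x , x) w))) (≡.trans (≡.sym (List.map-∘ w)) (List.map-cong eq w))

  ↑ˡ-mono : ∀ q {x y : Fin k} → x Fin.≤ y → (x ↑ˡ q) Fin.≤ (y ↑ˡ q)
  ↑ˡ-mono q {x} {y} = ≡.subst₂ _≤_ (≡.sym (Fin.toℕ-↑ˡ x q)) (≡.sym (Fin.toℕ-↑ˡ y q))

  ↑ˡ-cancel : ∀ q {x y : Fin k} → (x ↑ˡ q) Fin.≤ (y ↑ˡ q) → x Fin.≤ y
  ↑ˡ-cancel q {x} {y} = ≡.subst₂ _≤_ (Fin.toℕ-↑ˡ x q) (Fin.toℕ-↑ˡ y q)

  ↑ʳ-mono : ∀ p {x y : Fin k} → x Fin.≤ y → (p ↑ʳ x) Fin.≤ (p ↑ʳ y)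
  ↑ʳ-mono p {x} {y} le = ≡.subst₂ _≤_ (≡.sym (Fin.toℕ-↑ʳ p x)) (≡.sym (Fin.toℕ-↑ʳ p y)) (ℕ.+-monoʳ-≤ p le)

  ↑ʳ-cancel : ∀ p {x y : Fin k} → (p ↑ʳ x) Fin.≤ (p ↑ʳ y) → x Fin.≤ y
  ↑ʳ-cancel p {x} {y} le = ℕ.+-cancelˡ-≤ p _ _ (≡.subst₂ _≤_ (Fin.toℕ-↑ʳ p x) (Fin.toℕ-↑ʳ p y) le)

  ↑ˡ<↑ʳ : ∀ {p q} (x : Fin p) (y : Fin q) → (x ↑ˡ q) Fin.< (p ↑ʳ y)
  ↑ˡ<↑ʳ {p} {q} x y = ≡.subst₂ _<_ (≡.sym (Fin.toℕ-↑ˡ x q)) (≡.sym (Fin.toℕ-↑ʳ p y))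
    (ℕ.<-≤-trans (Fin.toℕ<n x) (ℕ.m≤m+n p (toℕ y)))

  shifted : ∀ {p q} → List (Letter p) → List (Letter q) → List (List (Letter (p ℕ.+ q)))
  shifted {p} {q} u v = shuffles (List.map (inˡ q) u) (List.map (inʳ p) v)

  shifted-distinct : ∀ {p q} (u : List (Letter p)) (v : List (Letter q)) {w} → w ∈ shifted u v →
                     DistinctLetters u → DistinctLetters v → DistinctLetters w
  shifted-distinct {p} {q} u v w∈ du dv = shuffles-AllPairs (List.map (inˡ q) u) (List.map (inʳ p) v) w∈
    (AllPairs.map⁺ (AllPairs.map (λ ne → ne ∘ Fin.↑ˡ-injective q _ _) du))
    (AllPairs.map⁺ (AllPairs.map (λ ne → ne ∘ Fin.↑ʳ-injective p _ _) dv))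
    (All.map⁺ (All.universal (λ (x , _) → All.map⁺ (All.universal (λ (y , _) →
      (λ eq → ℕ.<⇒≢ (↑ˡ<↑ʳ x y) (≡.cong toℕ eq)) , (λ eq → ℕ.<⇒≢ (↑ˡ<↑ʳ x y) (≡.cong toℕ (≡.sym eq)))) v)) u))

  -- Mixed pairs compare alike on both sides, because every letter of the left alphabet lies below
  -- every letter of the right one.
  shifted-OrderIso : ∀ {p q p′ q′} (y : List (Letter p × Letter p′)) (z : List (Letter q × Letter q′)) →
    OrderIso y → OrderIso z → ∀ {w} →
    w ∈ shuffles (List.map (λ (a , b) → inˡ q a , inˡ q′ b) y) (List.map (λ (a , b) → inʳ p a , inʳ p′ b) z) → OrderIso w
  shifted-OrderIso {p} {q} {p′} {q′} y z isoʸ isoᶻ w∈ =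
    shuffles-AllPairs _ _ w∈ (proj₁ isoˡ) (proj₁ isoʳ)
      (All.map⁺ (All.universal (λ ((a , _) , (b , _)) → All.map⁺ (All.universal (λ ((a′ , _) , (b′ , _)) →
        ((λ _ → ℕ.<⇒≤ (↑ˡ<↑ʳ b b′)) , (λ _ → ℕ.<⇒≤ (↑ˡ<↑ʳ a a′))) ,
        ((λ le → contradiction le (ℕ.<⇒≱ (↑ˡ<↑ʳ a a′))) , (λ le → contradiction le (ℕ.<⇒≱ (↑ˡ<↑ʳ b b′))))) z)) y)) ,
    shuffles-All _ _ w∈ (proj₂ isoˡ) (proj₂ isoʳ)
    where
    isoˡ = map₂-OrderIso (_↑ˡ q) (_↑ˡ q′) (↑ˡ-mono q) (↑ˡ-cancel q) (↑ˡ-mono q′) (↑ˡ-cancel q′) isoʸ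
    isoʳ = map₂-OrderIso (p ↑ʳ_) (p′ ↑ʳ_) (↑ʳ-mono p) (↑ʳ-cancel p) (↑ʳ-mono p′) (↑ʳ-cancel p′) isoᶻ

module Coproduct {c ℓ} (K : CommutativeRing c ℓ) (l : ℕ) where
  open FQSym K l
  open ColoredWords l
  open Words l
  open FreeModules K hiding (module Coefficients)
  open Series K l
  private
    module K = CommutativeRing K
    _≟ᴸ_ : DecidableEquality (List (Letter k))
    _≟ᴸ_ = List.≡-dec (Product.≡-dec Fin._≟_ Fin._≟_)
    module ⊗ = FreeModules.Coefficients K (Product.≡-dec _≟ᶜ_ _≟ᶜ_)
  open FreeModules.Coefficients K _≟ᶜ_ hiding (coeff; _≈ˡ_)
  open SumsOverWords K.+-commutativeMonoid
  open CountShuffles K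
  open import Relation.Binary.Reasoning.Setoid K.setoid

  coeff⊗-⊗ : ∀ x y e e′ → coeff⊗ (x ⊗ y) (e , e′) K.≈ coeff x e K.* coeff y e′
  coeff⊗-⊗ = coeff-⊗ _≟ᶜ_ _≟ᶜ_

  -- As for `splits`, both sums are images of one sum, over the shuffles of the two alignments; the
  -- members of that sum are order isomorphisms by `shifted-OrderIso`.
  sum-shifted-std : ∀ {p q} (u : List (Letter p)) (v : List (Letter q)) (f : ColoredPerm → K.Carrier) →
    sum (shifted u v) (f ∘ stdʷ) K.≈ sum (shifted (toWord (stdʷ u)) (toWord (stdʷ v))) (f ∘ stdʷ)
  sum-shifted-std {p} {q} u v f = begin
    sum (shifted u v) (f ∘ stdʷ)
      ≡⟨ ≡.cong (λ s → sum s (f ∘ stdʷ)) (≡.trans (≡.cong₂ shuffles (eq proj₂ fˡ (inˡ q) (λ _ → ≡.refl) (align₂ u))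
          (eq proj₂ fʳ (inʳ p) (λ _ → ≡.refl) (align₂ v))) (shuffles-map proj₂ (List.map fˡ (align u)) (List.map fʳ (align v)))) ⟩
    sum (List.map (List.map proj₂) zs) (f ∘ stdʷ)
      ≡⟨ sum-map (List.map proj₂) zs (f ∘ stdʷ) ⟩
    sum zs (λ z → f (stdʷ (List.map proj₂ z)))
      ≈⟨ sum-cong-∈ zs (λ {z} z∈ → K.reflexive (≡.cong f (≡.sym (stdʷ-OrderIso z
           (shifted-OrderIso (align u) (align v) (align-OrderIso u) (align-OrderIso v) z∈))))) ⟩
    sum zs (λ z → f (stdʷ (List.map proj₁ z)))
      ≡⟨ sum-map (List.map proj₁) zs (f ∘ stdʷ) ⟨
    sum (List.map (List.map proj₁) zs) (f ∘ stdʷ)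
      ≡⟨ ≡.cong (λ s → sum s (f ∘ stdʷ)) (≡.trans (≡.cong₂ shuffles (eq proj₁ fˡ (inˡ (length v)) (λ _ → ≡.refl)
          (align₁ u)) (eq proj₁ fʳ (inʳ (length u)) (λ _ → ≡.refl) (align₁ v))) (shuffles-map proj₁ (List.map fˡ
          (align u)) (List.map fʳ (align v)))) ⟨
    sum (shifted (toWord (stdʷ u)) (toWord (stdʷ v))) (f ∘ stdʷ) ∎
    where
    fˡ : Letter (length u) × Letter p → Letter (length u ℕ.+ length v) × Letter (p ℕ.+ q)
    fˡ (a , b) = inˡ (length v) a , inˡ q b
    fʳ : Letter (length v) × Letter q → Letter (length u ℕ.+ length v) × Letter (p ℕ.+ q)
    fʳ (a , b) = inʳ (length u) a , inʳ p b
    zs = shuffles (List.map fˡ (align u)) (List.map fʳ (align v))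
    eq : ∀ {A B C D : Set} (g : C → D) (f : A → C) (h : B → D) {g′ : A → B} → (∀ x → h (g′ x) ≡ g (f x)) →
         ∀ {y : List A} {u} → List.map g′ y ≡ u → List.map h u ≡ List.map g (List.map f y)
    eq g f h eq {y} ≡.refl = ≡.trans (≡.sym (List.map-∘ y)) (≡.trans (List.map-cong eq y) (List.map-∘ y))

  -- Every letter is at least 1 and `x` encodes the letter `toℕ x + 1`, so the interval condition
  -- amounts to `toℕ x < i`. In `restrict-large` every letter is at most the size, which leaves the
  -- complementary filter.
  restrict-small : ∀ e i → restrict e 1 i ≡ stdʷ (filter (small? i) (toWord e))
  restrict-small e i = ≡.cong stdʷ (List.filter-≐ (λ (x , _) → (1 ℕ.≤? letter x) ×-dec (letter x ℕ.≤? i)) (small? i)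
    (proj₂ , (λ lt → s≤s z≤n , lt)) (toWord e))

  restrict-large : ∀ e i → restrict e (suc i) (proj₁ e) ≡ stdʷ (filter (∁? (small? i)) (toWord e))
  restrict-large e@(n , _) i = ≡.cong stdʷ (List.filter-≐ (λ (x , _) → (suc i ℕ.≤? letter x) ×-dec
      (letter x ℕ.≤? n)) (∁? (small? i))
    ((λ (ge , _) → ℕ.≤⇒≯ (ℕ.s≤s⁻¹ ge)) , (λ {(x , _)} ge → s≤s (ℕ.≮⇒≥ ge) , Fin.toℕ<n x)) (toWord e))

  length-small : ∀ e i → i ≤ proj₁ e → length (filter (small? i) (toWord e)) ≡ i
  length-small e@(n , _) i i≤n = ≡.trans (≡.sym (length-filter-map (λ x → toℕ x ℕ.<? i) proj₁ (toWord e)))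
    (≡.trans (↭-length (filter-↭ (λ x → toℕ x ℕ.<? i) (unique⇒↭-allFin (AllPairs.map⁺ (toWord-distinct e))
      (≡.trans (List.length-map proj₁ (toWord e)) (length-toWord e)))))
    (count-< n i i≤n))

  cut : ColoredPerm → ColoredPerm → ColoredPerm → ℕ → K.Carrier
  cut α β e i = δ (stdʷ (filter (small? i) (toWord e)) ≟ᶜ α) K.* δ (stdʷ (filter (∁? (small? i)) (toWord e)) ≟ᶜ β)

  coeff-Δᴳ-cut : ∀ e α β → coeff⊗ (Δᴳ e) (α , β) K.≈ sum (upTo (suc (proj₁ e))) (cut α β e)
  coeff-Δᴳ-cut e α β = K.trans (⊗.coeff-Σ (upTo (suc (proj₁ e))) (λ i → basis (restrict e 1 i) ⊗ basis (restrict e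
      (suc i) (proj₁ e))) (α , β))
    (sum-cong (upTo (suc (proj₁ e))) (λ i → K.trans (coeff⊗-⊗ (basis (restrict e 1 i)) (basis (restrict e (suc i) (proj₁ e))) α β)
      (K.*-cong (K.trans (coeff-basis (restrict e 1 i) α) (K.reflexive (≡.cong (λ e → δ (e ≟ᶜ α)) (restrict-small e i))))
                (K.trans (coeff-basis (restrict e (suc i) (proj₁ e)) β) (K.reflexive (≡.cong (λ e → δ (e ≟ᶜ β))
                    (restrict-large e i)))))))

  length-shifted : ∀ α β {w} → w ∈ shifted (toWord α) (toWord β) → length w ≡ proj₁ α ℕ.+ proj₁ β
  length-shifted α@(p , _) β@(q , _) w∈ = ≡.trans (shuffles-length (List.map (inˡ q) (toWord α)) (List.map (inʳ p)
      (toWord β)) w∈) (≡.cong₂ ℕ._+_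
    (≡.trans (List.length-map (inˡ q) (toWord α)) (length-toWord α)) (≡.trans (List.length-map (inʳ p) (toWord β))
        (length-toWord β)))

  cut-wrong-size : ∀ e α β → proj₁ e ≢ proj₁ α ℕ.+ proj₁ β →
    sum (upTo (suc (proj₁ e))) (cut α β e) K.≈ sum (shifted (toWord α) (toWord β)) (λ w → δ (e ≟ᶜ stdʷ w))
  cut-wrong-size e α β n≢ = K.trans
    (sum-0 (upTo (suc (proj₁ e))) (λ {i} _ →
      δ-0 (stdʷ (filter (small? i) (toWord e)) ≟ᶜ α) (λ eq →
        K.reflexive (δ-no (stdʷ (filter (∁? (small? i)) (toWord e)) ≟ᶜ β) (λ eq′ → n≢
          (≡.trans (≡.sym (length-toWord e)) (≡.trans (≡.sym (length-filter-∁ (small? i) (toWord e)))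
            (≡.cong₂ ℕ._+_ (≡.cong proj₁ eq) (≡.cong proj₁ eq′)))))))))
    (K.sym (sum-0 (shifted (toWord α) (toWord β)) (λ {w} w∈ → K.reflexive (δ-no (e ≟ᶜ stdʷ w) (λ eq →
      n≢ (≡.trans (≡.cong proj₁ eq) (length-shifted α β w∈)))))))

  -- The left part of the cut at `i` has exactly `i` letters, so `i` must be the size of `α`.
  cut-single : ∀ e α β → proj₁ e ≡ proj₁ α ℕ.+ proj₁ β → sum (upTo (suc (proj₁ e))) (cut α β e) K.≈ cut α β e (proj₁ α)
  cut-single e α β size = sum-single (cut α β e) (Uniqueˡ.upTo⁺ (suc (proj₁ e)))
    (∈-upTo⁺ (s≤s (≡.subst (proj₁ α ≤_) (≡.sym size) (ℕ.m≤m+n (proj₁ α) (proj₁ β))))) (λ {i} i∈ i≢p →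
       δ-0 (stdʷ (filter (small? i) (toWord e)) ≟ᶜ α) (λ eq → contradiction
         (≡.trans (≡.sym (length-small e i (ℕ.s≤s⁻¹ (∈-upTo⁻ i∈)))) (≡.cong proj₁ eq)) i≢p))

  -- The preimage of `w` under `f` consists of `p` distinct letters over `Fin p`, hence it is
  -- already standard.
  stdʷ-map≡ : ∀ {p r} {f : Fin p → Fin r} → (∀ {x y} → x Fin.≤ y → f x Fin.≤ f y) → (∀ {x y} → f x Fin.≤ f y → x Fin.≤ y) →
              ∀ (e : Perm p × Vec Color p) {w} → DistinctLetters w → ∃[ s ] List.map (map₁ f) s ≡ w →
              stdʷ w ≡ (p , e) → w ≡ List.map (map₁ f) (toWord (p , e))
  stdʷ-map≡ {p} {f = f} f↑ f↓ e d (s , ≡.refl) eq = ≡.cong (List.map (map₁ f)) (≡.sym (stdʷ≡⇒toWord≡ {e = p , e} {w = s}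
    (AllPairs.map (λ ne → ne ∘ ≡.cong f) (AllPairs.map⁻ d)) (≡.trans (≡.sym (stdʷ-map f f↑ f↓ s)) eq)))

  -- The two filtered parts of the word of `e` use only small and only large letters, so comparing
  -- their standardizations with `α` and `β` amounts to comparing the parts themselves with the
  -- relabelled words of `α` and `β`. The product of these two tests is what `count-shuffles`
  -- evaluates.
  cut-shuffles : ∀ {p q} (e : Perm (p ℕ.+ q) × Vec Color (p ℕ.+ q)) (α : Perm p × Vec Color p) (β : Perm q × Vec Color q) →
    cut (p , α) (q , β) (p ℕ.+ q , e) p K.≈ sum (shifted (toWord (p , α)) (toWord (q , β))) (λ w → δ ((p ℕ.+ q , e) ≟ᶜ stdʷ w))
  cut-shuffles {p} {q} e α β = begin
    δ (stdʷ tˡ ≟ᶜ (p , α)) K.* δ (stdʷ tʳ ≟ᶜ (q , β))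
      ≡⟨ ≡.cong₂ K._*_
           (δ-cong (stdʷ tˡ ≟ᶜ (p , α)) (tˡ ≟ᴸ tα)
             (stdʷ-map≡ (↑ˡ-mono q) (↑ˡ-cancel q) α (AllPairs.filter⁺ (small? p) (toWord-distinct (_ , e)))
                 (small⇒inˡ p q (All.all-filter (small? p) t)))
             (λ eq → ≡.trans (≡.cong stdʷ eq) (≡.trans (stdʷ-map (_↑ˡ q) (↑ˡ-mono q) (↑ˡ-cancel q) (toWord (p , α)))
                 (stdʷ-toWord (p , α)))))
           (δ-cong (stdʷ tʳ ≟ᶜ (q , β)) (tʳ ≟ᴸ tβ)
             (stdʷ-map≡ (↑ʳ-mono p) (↑ʳ-cancel p) β (AllPairs.filter⁺ (∁? (small? p)) (toWord-distinct (_ , e)))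
                 (large⇒inʳ p q (All.all-filter (∁? (small? p)) t)))
             (λ eq → ≡.trans (≡.cong stdʷ eq) (≡.trans (stdʷ-map (p ↑ʳ_) (↑ʳ-mono p) (↑ʳ-cancel p) (toWord (q , β)))
                 (stdʷ-toWord (q , β))))) ⟩
    δ (tˡ ≟ᴸ tα) K.* δ (tʳ ≟ᴸ tβ)
      ≈⟨ count-shuffles (Product.≡-dec Fin._≟_ Fin._≟_) (small? p) t tα tβ (inˡ-small q (toWord (p , α)))
          (inʳ-large p (toWord (q , β))) ⟨
    sum (shifted (toWord (p , α)) (toWord (q , β))) (λ w → δ (t ≟ᴸ w))
      ≈⟨ sum-cong-∈ (shifted (toWord (p , α)) (toWord (q , β))) (λ {w} w∈ → K.reflexive (δ-cong (t ≟ᴸ w) ((_ , e) ≟ᶜ stdʷ w)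
           (λ eq → ≡.trans (≡.sym (stdʷ-toWord (_ , e))) (≡.cong stdʷ eq))
           (λ eq → stdʷ≡⇒toWord≡ {e = _ , e} (shifted-distinct (toWord (p , α)) (toWord (q , β)) w∈ (toWord-distinct
               (p , α)) (toWord-distinct (q , β))) (≡.sym eq)))) ⟩
    sum (shifted (toWord (p , α)) (toWord (q , β))) (λ w → δ ((_ , e) ≟ᶜ stdʷ w)) ∎
    where
    t tˡ tʳ tα tβ : List (Letter (p ℕ.+ q))
    t = toWord (_ , e)
    tˡ = filter (small? p) t
    tʳ = filter (∁? (small? p)) t
    tα = List.map (inˡ q) (toWord (p , α))
    tβ = List.map (inʳ p) (toWord (q , β))

  coeff-Δᴳ : ∀ e α β → coeff⊗ (Δᴳ e) (α , β) K.≈ sum (shifted (toWord α) (toWord β)) (λ w → δ (e ≟ᶜ stdʷ w))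
  coeff-Δᴳ e α β = K.trans (coeff-Δᴳ-cut e α β) (by-size e (proj₁ e ℕ.≟ proj₁ α ℕ.+ proj₁ β))
    where
    by-size : ∀ e → Dec (proj₁ e ≡ proj₁ α ℕ.+ proj₁ β) →
      sum (upTo (suc (proj₁ e))) (cut α β e) K.≈ sum (shifted (toWord α) (toWord β)) (λ w → δ (e ≟ᶜ stdʷ w))
    by-size e       (no n≢)      = cut-wrong-size e α β n≢
    by-size (_ , e) (yes ≡.refl) = K.trans (cut-single (_ , e) α β ≡.refl) (cut-shuffles e (proj₂ α) (proj₂ β))

  -- By linearity from `coeff-Δᴳ`. From here on coproducts are computed as sums over shifted
  -- shuffles.
  coeff-Δ : ∀ {p q} x (u : List (Letter p)) (v : List (Letter q)) →
            coeff⊗ (Δ x) (stdʷ u , stdʷ v) K.≈ sum (shifted u v) ⟦ x ⟧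
  coeff-Δ x u v = begin
    coeff⊗ (Δ x) (stdʷ u , stdʷ v)
      ≈⟨ ⊗.coeff-extend Δᴳ x (stdʷ u , stdʷ v) ⟩
    linear (λ e → coeff⊗ (Δᴳ e) (stdʷ u , stdʷ v)) x
      ≈⟨ linear-cong (λ e → K.trans (coeff-Δᴳ e (stdʷ u) (stdʷ v)) (K.sym (sum-shifted-std u v (λ t → δ (e ≟ᶜ t))))) x ⟩
    linear (λ e → sum (shifted u v) (λ w → δ (e ≟ᶜ stdʷ w))) x
      ≈⟨ linear-sum (shifted u v) (λ w e → δ (e ≟ᶜ stdʷ w)) x ⟩
    sum (shifted u v) (λ w → linear (λ e → δ (e ≟ᶜ stdʷ w)) x)
      ≈⟨ sum-cong (shifted u v) (λ w → K.sym (⟦⟧-linear x w)) ⟩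
    sum (shifted u v) ⟦ x ⟧ ∎

-- The algebra structure and the multiplicativity of the coproduct

module HopfStructure {c ℓ} (K : CommutativeRing c ℓ) (l : ℕ) where
  open FQSym K l
  open ColoredWords l
  open Words l
  open FreeModules K hiding (module Coefficients)
  open Series K l
  open Coproduct K l
  private
    module K = CommutativeRing K
  open FreeModules.Coefficients K _≟ᶜ_ hiding (coeff; _≈ˡ_)
  open SumsOverWords K.+-commutativeMonoid
  open import Relation.Binary.Reasoning.Setoid K.setoid

  unit : List (Letter k) → K.Carrier
  unit []      = K.1#
  unit (_ ∷ _) = K.0#

  ⟦⟧-𝟙 : (w : List (Letter k)) → ⟦ 𝟙 ⟧ w K.≈ unit w
  ⟦⟧-𝟙 []      = K.trans (coeff-basis (0 , idPerm 0 , []) (stdʷ {0} [])) (K.reflexive (δ-yes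
      ((0 , idPerm 0 , []) ≟ᶜ stdʷ {0} []) ≡.refl))
  ⟦⟧-𝟙 (x ∷ w) = K.trans (coeff-basis (0 , idPerm 0 , []) (stdʷ (x ∷ w))) (K.reflexive (δ-no
      ((0 , idPerm 0 , []) ≟ᶜ stdʷ (x ∷ w)) λ ()))

  sum-splits-unitˡ : ∀ (w : List (Letter k)) (f : List (Letter k) → K.Carrier) → sum (splits w) (λ
      (u , v) → unit u K.* f v) K.≈ f w
  sum-splits-unitˡ w f = K.trans (sum-splits-at [] w _ (λ {u} _ → nonempty u)) (K.*-identityˡ (f w))
    where
    nonempty : ∀ u {v} → length u ≢ 0 → unit u K.* f v K.≈ K.0#
    nonempty []      ne = contradiction ≡.refl ne
    nonempty (_ ∷ _) _  = K.zeroˡ _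

  sum-splits-unitʳ : ∀ (w : List (Letter k)) (f : List (Letter k) → K.Carrier) → sum (splits w) (λ
      (u , v) → f u K.* unit v) K.≈ f w
  sum-splits-unitʳ []      f = K.trans (K.+-identityʳ _) (K.*-identityʳ _)
  sum-splits-unitʳ (x ∷ w) f = K.trans (sum-splits-∷ x w (λ (u , v) → f u K.* unit v))
    (K.trans (K.+-cong (K.zeroʳ _) (sum-splits-unitʳ w (f ∘ (x ∷_)))) (K.+-identityˡ _))

  *ˡ-cong : ∀ {x x′ y y′} → x ≈ˡ x′ → y ≈ˡ y′ → x *ˡ y ≈ˡ x′ *ˡ y′
  *ˡ-cong {x} {x′} {y} {y′} p q = ⟦⟧-injective (x *ˡ y) (x′ *ˡ y′) λ w → K.trans (⟦⟧-* x y w)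
    (K.trans (sum-cong (splits w) (λ (u , v) → K.*-cong (p (stdʷ u)) (q (stdʷ v)))) (K.sym (⟦⟧-* x′ y′ w)))

  *ˡ-assoc : ∀ x y z → (x *ˡ y) *ˡ z ≈ˡ x *ˡ (y *ˡ z)
  *ˡ-assoc x y z = ⟦⟧-injective ((x *ˡ y) *ˡ z) (x *ˡ (y *ˡ z)) λ w → begin
    ⟦ (x *ˡ y) *ˡ z ⟧ w
      ≈⟨ ⟦⟧-* (x *ˡ y) z w ⟩
    sum (splits w) (λ (s , v) → ⟦ x *ˡ y ⟧ s K.* ⟦ z ⟧ v)
      ≈⟨ sum-cong (splits w) (λ (s , v) → K.trans (K.*-congʳ (⟦⟧-* x y s)) (sum-* (splits s) _ _)) ⟩
    sum (splits w) (λ (s , v) → sum (splits s) (λ (t , u) → (⟦ x ⟧ t K.* ⟦ y ⟧ u) K.* ⟦ z ⟧ v))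
      ≈⟨ sum-splits-assoc w (λ t u v → (⟦ x ⟧ t K.* ⟦ y ⟧ u) K.* ⟦ z ⟧ v) ⟩
    sum (splits w) (λ (t , s) → sum (splits s) (λ (u , v) → (⟦ x ⟧ t K.* ⟦ y ⟧ u) K.* ⟦ z ⟧ v))
      ≈⟨ sum-cong (splits w) (λ (t , s) → K.trans (sum-cong (splits s) (λ _ → K.*-assoc _ _ _))
           (K.trans (K.sym (*-sum (⟦ x ⟧ t) (splits s) _)) (K.*-congˡ (K.sym (⟦⟧-* y z s))))) ⟩
    sum (splits w) (λ (t , s) → ⟦ x ⟧ t K.* ⟦ y *ˡ z ⟧ s)
      ≈⟨ ⟦⟧-* x (y *ˡ z) w ⟨
    ⟦ x *ˡ (y *ˡ z) ⟧ w ∎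

  *ˡ-identityˡ : ∀ x → 𝟙 *ˡ x ≈ˡ x
  *ˡ-identityˡ x = ⟦⟧-injective (𝟙 *ˡ x) (x) λ w → K.trans (⟦⟧-* 𝟙 x w)
    (K.trans (sum-cong (splits w) (λ (u , v) → K.*-congʳ (⟦⟧-𝟙 u))) (sum-splits-unitˡ w ⟦ x ⟧))

  *ˡ-identityʳ : ∀ x → x *ˡ 𝟙 ≈ˡ x
  *ˡ-identityʳ x = ⟦⟧-injective (x *ˡ 𝟙) (x) λ w → K.trans (⟦⟧-* x 𝟙 w)
    (K.trans (sum-cong (splits w) (λ (u , v) → K.*-congˡ (⟦⟧-𝟙 v))) (sum-splits-unitʳ w ⟦ x ⟧))

  *ˡ-distribˡ : ∀ x y z → x *ˡ (y +ˡ z) ≈ˡ x *ˡ y +ˡ x *ˡ z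
  *ˡ-distribˡ x y z = ⟦⟧-injective (x *ˡ (y +ˡ z)) (x *ˡ y +ˡ x *ˡ z) λ w → begin
    ⟦ x *ˡ (y +ˡ z) ⟧ w
      ≈⟨ ⟦⟧-* x (y +ˡ z) w ⟩
    sum (splits w) (λ (u , v) → ⟦ x ⟧ u K.* ⟦ y +ˡ z ⟧ v)
      ≈⟨ sum-cong (splits w) (λ (u , v) → K.trans (K.*-congˡ (coeff-+ y z (stdʷ v))) (K.distribˡ _ _ _)) ⟩
    sum (splits w) (λ (u , v) → ⟦ x ⟧ u K.* ⟦ y ⟧ v K.+ ⟦ x ⟧ u K.* ⟦ z ⟧ v)
      ≈⟨ sum-+ (splits w) _ _ ⟩
    sum (splits w) (λ (u , v) → ⟦ x ⟧ u K.* ⟦ y ⟧ v) K.+ sum (splits w) (λ (u , v) → ⟦ x ⟧ u K.* ⟦ z ⟧ v)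
      ≈⟨ K.+-cong (⟦⟧-* x y w) (⟦⟧-* x z w) ⟨
    ⟦ x *ˡ y ⟧ w K.+ ⟦ x *ˡ z ⟧ w
      ≈⟨ coeff-+ (x *ˡ y) (x *ˡ z) (stdʷ w) ⟨
    ⟦ x *ˡ y +ˡ x *ˡ z ⟧ w ∎

  *ˡ-distribʳ : ∀ x y z → (y +ˡ z) *ˡ x ≈ˡ y *ˡ x +ˡ z *ˡ x
  *ˡ-distribʳ x y z = ⟦⟧-injective ((y +ˡ z) *ˡ x) (y *ˡ x +ˡ z *ˡ x) λ w → begin
    ⟦ (y +ˡ z) *ˡ x ⟧ w
      ≈⟨ ⟦⟧-* (y +ˡ z) x w ⟩
    sum (splits w) (λ (u , v) → ⟦ y +ˡ z ⟧ u K.* ⟦ x ⟧ v)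
      ≈⟨ sum-cong (splits w) (λ (u , v) → K.trans (K.*-congʳ (coeff-+ y z (stdʷ u))) (K.distribʳ _ _ _)) ⟩
    sum (splits w) (λ (u , v) → ⟦ y ⟧ u K.* ⟦ x ⟧ v K.+ ⟦ z ⟧ u K.* ⟦ x ⟧ v)
      ≈⟨ sum-+ (splits w) _ _ ⟩
    sum (splits w) (λ (u , v) → ⟦ y ⟧ u K.* ⟦ x ⟧ v) K.+ sum (splits w) (λ (u , v) → ⟦ z ⟧ u K.* ⟦ x ⟧ v)
      ≈⟨ K.+-cong (⟦⟧-* y x w) (⟦⟧-* z x w) ⟨
    ⟦ y *ˡ x ⟧ w K.+ ⟦ z *ˡ x ⟧ w
      ≈⟨ coeff-+ (y *ˡ x) (z *ˡ x) (stdʷ w) ⟨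
    ⟦ y *ˡ x +ˡ z *ˡ x ⟧ w ∎

  ·-*ˡ-assocˡ : ∀ a x y → (a ·ˡ x) *ˡ y ≈ˡ a ·ˡ (x *ˡ y)
  ·-*ˡ-assocˡ a x y = ⟦⟧-injective ((a ·ˡ x) *ˡ y) (a ·ˡ (x *ˡ y)) λ w → begin
    ⟦ (a ·ˡ x) *ˡ y ⟧ w
      ≈⟨ ⟦⟧-* (a ·ˡ x) y w ⟩
    sum (splits w) (λ (u , v) → ⟦ a ·ˡ x ⟧ u K.* ⟦ y ⟧ v)
      ≈⟨ sum-cong (splits w) (λ (u , v) → K.trans (K.*-congʳ (coeff-· a x (stdʷ u))) (K.*-assoc _ _ _)) ⟩
    sum (splits w) (λ (u , v) → a K.* (⟦ x ⟧ u K.* ⟦ y ⟧ v))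
      ≈⟨ *-sum a (splits w) _ ⟨
    a K.* sum (splits w) (λ (u , v) → ⟦ x ⟧ u K.* ⟦ y ⟧ v)
      ≈⟨ K.*-congˡ (⟦⟧-* x y w) ⟨
    a K.* ⟦ x *ˡ y ⟧ w
      ≈⟨ coeff-· a (x *ˡ y) (stdʷ w) ⟨
    ⟦ a ·ˡ (x *ˡ y) ⟧ w ∎

  ·-*ˡ-assocʳ : ∀ a x y → x *ˡ (a ·ˡ y) ≈ˡ a ·ˡ (x *ˡ y)
  ·-*ˡ-assocʳ a x y = ⟦⟧-injective (x *ˡ (a ·ˡ y)) (a ·ˡ (x *ˡ y)) λ w → begin
    ⟦ x *ˡ (a ·ˡ y) ⟧ w
      ≈⟨ ⟦⟧-* x (a ·ˡ y) w ⟩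
    sum (splits w) (λ (u , v) → ⟦ x ⟧ u K.* ⟦ a ·ˡ y ⟧ v)
      ≈⟨ sum-cong (splits w) (λ (u , v) → K.trans (K.*-congˡ (coeff-· a y (stdʷ v))) (x∙yz≈y∙xz _ _ _)) ⟩
    sum (splits w) (λ (u , v) → a K.* (⟦ x ⟧ u K.* ⟦ y ⟧ v))
      ≈⟨ *-sum a (splits w) _ ⟨
    a K.* sum (splits w) (λ (u , v) → ⟦ x ⟧ u K.* ⟦ y ⟧ v)
      ≈⟨ K.*-congˡ (⟦⟧-* x y w) ⟨
    a K.* ⟦ x *ˡ y ⟧ w
      ≈⟨ coeff-· a (x *ˡ y) (stdʷ w) ⟨
    ⟦ a ·ˡ (x *ˡ y) ⟧ w ∎
    where open import Algebra.Properties.CommutativeSemigroup K.*-commutativeSemigroup using (x∙yz≈y∙xz)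

  +ˡ-cong : ∀ {x x′ y y′} → x ≈ˡ x′ → y ≈ˡ y′ → x +ˡ y ≈ˡ x′ +ˡ y′
  +ˡ-cong {x} {x′} {y} {y′} p q e = K.trans (coeff-+ x y e) (K.trans (K.+-cong (p e) (q e)) (K.sym (coeff-+ x′ y′ e)))

  ·ˡ-cong : ∀ {a b x y} → a K.≈ b → x ≈ˡ y → a ·ˡ x ≈ˡ b ·ˡ y
  ·ˡ-cong {a} {b} {x} {y} p q e = K.trans (coeff-· a x e) (K.trans (K.*-cong p (q e)) (K.sym (coeff-· b y e)))

  +ˡ-comm : ∀ x y → x +ˡ y ≈ˡ y +ˡ x
  +ˡ-comm x y e = K.trans (coeff-+ x y e) (K.trans (K.+-comm _ _) (K.sym (coeff-+ y x e)))

  +ˡ-inverseˡ : ∀ x → (K.- K.1#) ·ˡ x +ˡ x ≈ˡ []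
  +ˡ-inverseˡ x e = K.trans (coeff-+ ((K.- K.1#) ·ˡ x) x e)
    (K.trans (K.+-congʳ (K.trans (coeff-· (K.- K.1#) x e) (-1*x≈-x _))) (K.-‿inverseˡ _))
    where open import Algebra.Properties.Ring K.ring using (-1*x≈-x)

  +ˡ-isAbelianGroup : IsAbelianGroup _≈ˡ_ _+ˡ_ [] ((K.- K.1#) ·ˡ_)
  +ˡ-isAbelianGroup = record
    { isGroup = record
      { isMonoid = record
        { isSemigroup = record
          { isMagma = record
            { isEquivalence = record
              { refl = λ _ → K.refl ; sym = λ p e → K.sym (p e) ; trans = λ p q e → K.trans (p e) (q e) }
            ; ∙-cong = λ {x} {x′} {y} {y′} → +ˡ-cong {x} {x′} {y} {y′}
            }
          ; assoc = λ x y z e → K.reflexive (≡.cong (λ w → coeff w e) (List.++-assoc x y z))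
          }
        ; identity = (λ _ _ → K.refl) , (λ x e → K.reflexive (≡.cong (λ w → coeff w e) (List.++-identityʳ x)))
        }
      ; inverse = +ˡ-inverseˡ , (λ x e → K.trans (+ˡ-comm x ((K.- K.1#) ·ˡ x) e) (+ˡ-inverseˡ x e))
      ; ⁻¹-cong = λ {x} {y} → ·ˡ-cong {K.- K.1#} {K.- K.1#} {x} {y} K.refl
      }
    ; comm = +ˡ-comm
    }

  isAlgebra : IsAlgebra K rawAlgebra
  isAlgebra = record
    { isRing = record
      { +-isAbelianGroup = +ˡ-isAbelianGroup
      ; *-cong = λ {x} {x′} {y} {y′} → *ˡ-cong {x} {x′} {y} {y′}
      ; *-assoc = *ˡ-assoc
      ; *-identity = *ˡ-identityˡ , *ˡ-identityʳ
      ; distrib = *ˡ-distribˡ , *ˡ-distribʳ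
      }
    ; isModule = record
      { isLeftSemimodule = record
        { +ᴹ-isCommutativeMonoid = IsAbelianGroup.isCommutativeMonoid +ˡ-isAbelianGroup
        ; isPreleftSemimodule = record
          { *ₗ-cong = λ {a} {b} {x} {y} → ·ˡ-cong {a} {b} {x} {y}
          ; *ₗ-zeroˡ = λ x e → K.trans (coeff-· K.0# x e) (K.zeroˡ _)
          ; *ₗ-distribʳ = λ x a b e → K.trans (coeff-· (a K.+ b) x e) (K.trans (K.distribʳ _ _ _)
              (K.sym (K.trans (coeff-+ (a ·ˡ x) (b ·ˡ x) e) (K.+-cong (coeff-· a x e) (coeff-· b x e)))))
          ; *ₗ-identityˡ = λ x e → K.trans (coeff-· K.1# x e) (K.*-identityˡ _)
          ; *ₗ-assoc = λ a b x e → K.trans (coeff-· (a K.* b) x e) (K.trans (K.*-assoc _ _ _)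
              (K.sym (K.trans (coeff-· a (b ·ˡ x) e) (K.*-congˡ (coeff-· b x e)))))
          ; *ₗ-zeroʳ = λ a e → K.refl
          ; *ₗ-distribˡ = λ a x y e → K.reflexive (≡.cong (λ z → coeff z e) (List.map-++ _ x y))
          }
        }
      ; -ᴹ‿cong = λ {x} {y} → ·ˡ-cong {K.- K.1#} {K.- K.1#} {x} {y} K.refl
      ; -ᴹ‿inverse = IsAbelianGroup.inverse +ˡ-isAbelianGroup
      }
    ; ·-*-assocˡ = ·-*ˡ-assocˡ
    ; ·-*-assocʳ = ·-*ˡ-assocʳ
    }

  -- The coproduct splits the ordered alphabet into an initial and a final part.
  Δ⟦_⟧ : ∀ {p q} → FQ → List (Letter p) → List (Letter q) → K.Carrier
  Δ⟦ x ⟧ u v = sum (shifted u v) ⟦ x ⟧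

  -- The product formula `⟦⟧-*` puts a sum over splits inside the sum over shuffles, and
  -- `sum-shuffles-splits` exchanges the two. In Hopf terms, the coproduct is multiplicative.
  Δ⟦⟧-* : ∀ {p q} x y (u : List (Letter p)) (v : List (Letter q)) → Δ⟦ x *ˡ y ⟧ u v K.≈
          sum (splits u) (λ (u₁ , u₂) → sum (splits v) (λ (v₁ , v₂) → Δ⟦ x ⟧ u₁ v₁ K.* Δ⟦ y ⟧ u₂ v₂))
  Δ⟦⟧-* {p} {q} x y u v = begin
    sum (shifted u v) ⟦ x *ˡ y ⟧
      ≈⟨ sum-cong (shifted u v) (λ w → ⟦⟧-* x y w) ⟩
    sum (shifted u v) (λ w → sum (splits w) (λ (s , t) → ⟦ x ⟧ s K.* ⟦ y ⟧ t))
      ≈⟨ sum-shuffles-splits (List.map (inˡ q) u) (List.map (inʳ p) v) (λ s t → ⟦ x ⟧ s K.* ⟦ y ⟧ t) ⟩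
    sum (splits (List.map (inˡ q) u)) (λ (u₁ , u₂) → sum (splits (List.map (inʳ p) v)) (λ (v₁ , v₂) →
      sum (shuffles u₁ v₁) (λ s → sum (shuffles u₂ v₂) (λ t → ⟦ x ⟧ s K.* ⟦ y ⟧ t))))
      ≈⟨ K.trans (sum-splits-map (inˡ q) u _) (sum-cong (splits u) (λ (u₁ , u₂) → sum-splits-map (inʳ p) v _)) ⟩
    sum (splits u) (λ (u₁ , u₂) → sum (splits v) (λ (v₁ , v₂) →
      sum (shifted u₁ v₁) (λ s → sum (shifted u₂ v₂) (λ t → ⟦ x ⟧ s K.* ⟦ y ⟧ t))))
      ≈⟨ sum-cong (splits u) (λ (u₁ , u₂) → sum-cong (splits v) (λ (v₁ , v₂) →
           K.sym (sum-*-sum (shifted u₁ v₁) (shifted u₂ v₂) ⟦ x ⟧ ⟦ y ⟧))) ⟩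
    sum (splits u) (λ (u₁ , u₂) → sum (splits v) (λ (v₁ , v₂) → Δ⟦ x ⟧ u₁ v₁ K.* Δ⟦ y ⟧ u₂ v₂)) ∎
    where
    sum-splits-map : ∀ {p q} (f : Letter p → Letter q) u g →
      sum (splits (List.map f u)) g K.≈ sum (splits u) (λ (u₁ , u₂) → g (List.map f u₁ , List.map f u₂))
    sum-splits-map f u g = K.reflexive (≡.trans (≡.cong (λ s → sum s g) (splits-map f u)) (sum-map _ (splits u) g))

-- Complete homogeneous functions and their coproducts

module Generators {c ℓ} (K : CommutativeRing c ℓ) (l : ℕ) where
  open FQSym K l
  open ColoredWords l
  open Words l
  open FreeModules K hiding (module Coefficients)
  open Series K l
  open Coproduct K l
  open HopfStructure K l
  private
    module K = CommutativeRing K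
    module ⊗ = FreeModules.Coefficients K (Product.≡-dec _≟ᶜ_ _≟ᶜ_)
  open FreeModules.Coefficients K _≟ᶜ_ hiding (coeff; _≈ˡ_)
  open SumsOverWords K.+-commutativeMonoid
  open import Relation.Binary.Reasoning.Setoid K.setoid

  infixl 6 _+ʷ_
  _+ʷ_ : Weight → Weight → Weight
  _+ʷ_ = Vec.zipWith ℕ._+_

  0ʷ : Weight
  0ʷ = Vec.replicate l 0

  +ʷ-assoc : ∀ 𝐚 𝐛 𝐜 → (𝐚 +ʷ 𝐛) +ʷ 𝐜 ≡ 𝐚 +ʷ (𝐛 +ʷ 𝐜)
  +ʷ-assoc = Vec.zipWith-assoc ℕ.+-assoc

  +ʷ-comm : ∀ 𝐚 𝐛 → 𝐚 +ʷ 𝐛 ≡ 𝐛 +ʷ 𝐚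
  +ʷ-comm = Vec.zipWith-comm ℕ.+-comm

  +ʷ-identityˡ : ∀ 𝐚 → 0ʷ +ʷ 𝐚 ≡ 𝐚
  +ʷ-identityˡ = Vec.zipWith-identityˡ ℕ.+-identityˡ

  +ʷ-identityʳ : ∀ 𝐚 → 𝐚 +ʷ 0ʷ ≡ 𝐚
  +ʷ-identityʳ = Vec.zipWith-identityʳ ℕ.+-identityʳ

  ∣+ʷ∣ : ∀ 𝐚 𝐛 → ∣ 𝐚 +ʷ 𝐛 ∣ ≡ ∣ 𝐚 ∣ ℕ.+ ∣ 𝐛 ∣
  ∣+ʷ∣ = go
    where
    go : ∀ {m} (a b : Vec ℕ m) → Vec.sum (Vec.zipWith ℕ._+_ a b) ≡ Vec.sum a ℕ.+ Vec.sum b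
    go []      []      = ≡.refl
    go (x ∷ a) (y ∷ b) = ≡.trans (≡.cong (x ℕ.+ y ℕ.+_) (go a b)) (interchange x y (Vec.sum a) (Vec.sum b))
      where open import Algebra.Properties.CommutativeSemigroup ℕ.+-commutativeSemigroup using (interchange)

  ∣0ʷ∣ : ∣ 0ʷ ∣ ≡ 0
  ∣0ʷ∣ = go l
    where
    go : ∀ m → Vec.sum (Vec.replicate m 0) ≡ 0
    go zero    = ≡.refl
    go (suc m) = go m

  ∣∣≡0⇒≡0ʷ : ∀ 𝐚 → ∣ 𝐚 ∣ ≡ 0 → 𝐚 ≡ 0ʷ
  ∣∣≡0⇒≡0ʷ = go
    where
    go : ∀ {m} (a : Vec ℕ m) → Vec.sum a ≡ 0 → a ≡ Vec.replicate m 0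
    go []         _  = ≡.refl
    go (zero ∷ a) eq = ≡.cong (0 ∷_) (go a eq)

  single : Color → Weight
  single c = tabulate (λ i → if does (c Fin.≟ i) then 1 else 0)

  ∣single∣ : ∀ c → ∣ single c ∣ ≡ 1
  ∣single∣ = go
    where
    zeros : ∀ m → Vec.sum (tabulate {n = m} (λ _ → 0)) ≡ 0
    zeros zero    = ≡.refl
    zeros (suc m) = zeros m
    go : ∀ {m} (c : Fin m) → Vec.sum (tabulate (λ i → if does (c Fin.≟ i) then 1 else 0)) ≡ 1
    go {suc m} zero = ≡.cong suc (zeros m)
    go (suc c) = go c

  content-∷ : ∀ c (u : Vec Color n) → content (c ∷ u) ≡ single c +ʷ content u
  content-∷ c u = ≡.trans (Vec.tabulate-cong eq) (Vec.tabulate∘lookup (single c +ʷ content u))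
    where
    eq : ∀ i → Vec.count (Fin._≟ i) (c ∷ u) ≡ lookup (single c +ʷ content u) i
    eq i = ≡.trans (count-∷ i) (≡.sym (≡.trans (Vec.lookup-zipWith ℕ._+_ i (single c) (content u))
        (≡.cong₂ ℕ._+_ (Vec.lookup∘tabulate _ i) (Vec.lookup∘tabulate _ i))))
      where
      count-∷ : ∀ i → Vec.count (Fin._≟ i) (c ∷ u) ≡ (if does (c Fin.≟ i) then 1 else 0) ℕ.+ Vec.count (Fin._≟ i) u
      count-∷ i with does (c Fin.≟ i)
      ... | true  = ≡.refl
      ... | false = ≡.refl

  content-[] : content [] ≡ 0ʷ
  content-[] = go l
    where
    go : ∀ m → tabulate {n = m} (λ _ → 0) ≡ Vec.replicate m 0
    go zero    = ≡.refl
    go (suc m) = ≡.cong (0 ∷_) (go m)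

  -- The content in recursive form, which is visibly additive over concatenations and shuffles.
  weight : List (Letter k) → Weight
  weight []            = 0ʷ
  weight ((_ , c) ∷ w) = single c +ʷ weight w

  content-toWeight : (v : Vec (Letter k) n) → content (Vec.map proj₂ v) ≡ weight (Vec.toList v)
  content-toWeight []            = content-[]
  content-toWeight ((_ , c) ∷ v) = ≡.trans (content-∷ c (Vec.map proj₂ v)) (≡.cong (single c +ʷ_) (content-toWeight v))

  ∣weight∣ : (w : List (Letter k)) → ∣ weight w ∣ ≡ length w
  ∣weight∣ []            = ∣0ʷ∣
  ∣weight∣ ((_ , c) ∷ w) = ≡.trans (∣+ʷ∣ (single c) (weight w)) (≡.cong₂ ℕ._+_ (∣single∣ c) (∣weight∣ w))

  weight-map₁ : ∀ {p} (f : Fin k → Fin p) w → weight (List.map (map₁ f) w) ≡ weight w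
  weight-map₁ f []            = ≡.refl
  weight-map₁ f ((_ , c) ∷ w) = ≡.cong (single c +ʷ_) (weight-map₁ f w)

  weight-++ : ∀ (u v : List (Letter k)) → weight (u ++ v) ≡ weight u +ʷ weight v
  weight-++ []            v = ≡.sym (+ʷ-identityˡ (weight v))
  weight-++ ((_ , c) ∷ u) v = ≡.trans (≡.cong (single c +ʷ_) (weight-++ u v)) (≡.sym (+ʷ-assoc (single c) (weight u) (weight v)))

  weight-shuffles : ∀ (u v : List (Letter k)) {w} → w ∈ shuffles u v → weight w ≡ weight u +ʷ weight v
  weight-shuffles = shuffles-elim {P = λ u v w → weight w ≡ weight u +ʷ weight v}
    (λ v → ≡.sym (+ʷ-identityˡ (weight v))) (λ x u → ≡.sym (+ʷ-identityʳ (weight (x ∷ u))))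
    (λ {(_ , c)} {u} {y} {v} ih → ≡.trans (≡.cong (single c +ʷ_) ih) (≡.sym (+ʷ-assoc (single c) (weight u) (weight (y ∷ v)))))
    (λ {x} {u} {(_ , d)} {v} ih → ≡.trans (≡.cong (single d +ʷ_) ih) (≡.trans (≡.sym (+ʷ-assoc (single d) (weight
        (x ∷ u)) (weight v)))
      (≡.trans (≡.cong (_+ʷ weight v) (+ʷ-comm (single d) (weight (x ∷ u)))) (+ʷ-assoc (weight (x ∷ u)) (single d) (weight v)))))

  Sorted : List (Letter k) → Set
  Sorted = Linked (λ x y → proj₁ x Fin.≤ proj₁ y)

  sorted? : Decidable (Sorted {k})
  sorted? = linked? (λ x y → proj₁ x Fin.≤? proj₁ y)

  -- Equal letters are numbered from left to right, so repetitions do no harm; together with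
  -- `std≡id⇒sorted` this characterizes the words that contribute to a series `⟦ S 𝐧 ⟧`.
  sorted⇒std≡id : (v : Vec (Letter k) n) → Sorted (Vec.toList v) → std (Vec.map proj₁ v) ≡ idPerm n
  sorted⇒std≡id {n = n} v s = ≡.trans (std-sameOrder (Vec.map proj₁ v) (Vec.allFin n) (λ {i} {j} i<j →
      (λ _ → ≡.subst₂ Fin._≤_ (≡.sym (Vec.lookup-allFin i)) (≡.sym (Vec.lookup-allFin j)) (ℕ.<⇒≤ i<j)) ,
      (λ _ → ≡.subst₂ Fin._≤_ (≡.sym (Vec.lookup-map i proj₁ v)) (≡.sym (Vec.lookup-map j proj₁ v))
        (lookup-toList v (Linked.Linked⇒AllPairs Fin.≤-trans s) i<j)))) (std-word (idPerm n))
    where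
    lookup-toList : ∀ {m} (v : Vec (Letter _) m) → AllPairs (λ x y → proj₁ x Fin.≤ proj₁ y) (Vec.toList v) →
      ∀ {i j} → i Fin.< j → proj₁ (lookup v i) Fin.≤ proj₁ (lookup v j)
    lookup-toList (x ∷ v) (p ∷ ps) {zero}  {suc j} _         = go v p j
      where
      go : ∀ {m} (v : Vec (Letter _) m) → All (λ y → proj₁ x Fin.≤ proj₁ y)
          (Vec.toList v) → ∀ j → proj₁ x Fin.≤ proj₁ (lookup v j)
      go (y ∷ v) (p ∷ _)  zero    = p
      go (y ∷ v) (_ ∷ ps) (suc j) = go v ps j
    lookup-toList (x ∷ v) (p ∷ ps) {suc i} {suc j} (s≤s i<j) = lookup-toList v ps i<j

  std≡id⇒sorted : (v : Vec (Letter k) n) → std (Vec.map proj₁ v) ≡ idPerm n → Sorted (Vec.toList v)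
  std≡id⇒sorted {n = n} v eq = Linked.AllPairs⇒Linked (AllPairs-lookup v λ {i} {j} i<j →
    ≡.subst₂ Fin._≤_ (Vec.lookup-map i proj₁ v) (Vec.lookup-map j proj₁ v)
      (proj₁ (std-order (Vec.map proj₁ v) i<j) (≡.subst₂ Fin._≤_ (letterAt i) (letterAt j) (ℕ.<⇒≤ i<j))))
    where
    letterAt : ∀ i → i ≡ lookup (word (std (Vec.map proj₁ v))) i
    letterAt i = ≡.trans (≡.sym (Vec.lookup-allFin i)) (≡.cong (λ σ → lookup (word σ) i) (≡.sym eq))

  -- The variable `m` stands for `∣ 𝐧 ∣` so that it can be identified with the length of `v`. In the
  -- other case both sides vanish, since the content of `v` sums to its length.
  coeff-S : ∀ m 𝐧 (v : Vec (Letter k) n) → m ≡ ∣ 𝐧 ∣ → Dec (n ≡ m) →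
    coeff (Σ[ filter (λ u → content u ≟ʷ 𝐧) (words (List.allFin l) m) ] λ u → G (idPerm m) u) (stdᵛ v) K.≈
    δ (sorted? (Vec.toList v)) K.* δ (weight (Vec.toList v) ≟ʷ 𝐧)
  coeff-S {n = n} m 𝐧 v m≡ (no n≢m) = K.trans
    (K.trans (coeff-Σ us (λ u → G (idPerm m) u) (stdᵛ v)) (sum-0 us (λ {u} _ → K.trans (coeff-basis (m , idPerm m , u) (stdᵛ v))
      (K.reflexive (δ-no ((m , idPerm m , u) ≟ᶜ stdᵛ v) (λ eq → n≢m (≡.sym (≡.cong proj₁ eq))))))))
    (K.sym (K.trans (K.*-congˡ (K.reflexive (δ-no (weight (Vec.toList v) ≟ʷ 𝐧) (λ eq → n≢m
      (≡.trans (≡.sym (Vec.length-toList v)) (≡.trans (≡.sym (∣weight∣ (Vec.toList v))) (≡.trans (≡.cong ∣_∣ eq)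
          (≡.sym m≡)))))))) (K.zeroʳ _)))
    where us = filter (λ u → content u ≟ʷ 𝐧) (words (List.allFin l) m)
  coeff-S m 𝐧 v m≡ (yes ≡.refl) = begin
    coeff (Σ[ filter (λ u → content u ≟ʷ 𝐧) (words (List.allFin l) m) ] λ u → G (idPerm m) u) (stdᵛ v)
      ≈⟨ coeff-Σ (filter (λ u → content u ≟ʷ 𝐧) (words (List.allFin l) m)) (λ u → G (idPerm m) u) (stdᵛ v) ⟩
    sum (filter (λ u → content u ≟ʷ 𝐧) (words (List.allFin l) m)) (λ u → coeff (G (idPerm m) u) (stdᵛ v))
      ≈⟨ sum-filter (λ u → content u ≟ʷ 𝐧) (words (List.allFin l) m) _ ⟩
    sum (words (List.allFin l) m) (λ u → δ (content u ≟ʷ 𝐧) K.* coeff (G (idPerm m) u) (stdᵛ v))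
      ≈⟨ sum-single (λ u → δ (content u ≟ʷ 𝐧) K.* coeff (G (idPerm m) u) (stdᵛ v)) (words-unique (Uniqueˡ.allFin⁺ l) m)
           (∈-words colors (λ i → ∈-allFin (lookup colors i))) (λ {u} _ u≢ → δ-0 (content u ≟ʷ 𝐧) (λ _ →
             K.trans (coeff-basis (m , idPerm m , u) (stdᵛ v)) (K.reflexive (δ-no ((m , idPerm m , u) ≟ᶜ stdᵛ v)
                 (λ eq → u≢ (proj₂ (≡ᶜ⁻ eq))))))) ⟩
    δ (content colors ≟ʷ 𝐧) K.* coeff (G (idPerm m) colors) (stdᵛ v)
      ≈⟨ K.*-cong (K.reflexive (≡.cong (λ 𝐚 → δ (𝐚 ≟ʷ 𝐧)) (content-toWeight v))) (K.trans (coeff-basis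
          (m , idPerm m , colors) (stdᵛ v))
           (K.reflexive (δ-cong ((m , idPerm m , colors) ≟ᶜ stdᵛ v) (sorted? (Vec.toList v))
             (λ eq → std≡id⇒sorted v (≡.sym (proj₁ (≡ᶜ⁻ eq)))) (λ s → ≡.cong (λ σ → m , σ , colors) (≡.sym
                 (sorted⇒std≡id v s)))))) ⟩
    δ (weight (Vec.toList v) ≟ʷ 𝐧) K.* δ (sorted? (Vec.toList v))
      ≈⟨ K.*-comm _ _ ⟩
    δ (sorted? (Vec.toList v)) K.* δ (weight (Vec.toList v) ≟ʷ 𝐧) ∎
    where colors = Vec.map proj₂ v

  ⟦S⟧ : ∀ 𝐧 (w : List (Letter k)) → ⟦ S 𝐧 ⟧ w K.≈ δ (sorted? w) K.* δ (weight w ≟ʷ 𝐧)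
  ⟦S⟧ 𝐧 w = ≡.subst (λ u → ⟦ S 𝐧 ⟧ w K.≈ δ (sorted? u) K.* δ (weight u ≟ʷ 𝐧)) (Vec.toList∘fromList w)
    (coeff-S ∣ 𝐧 ∣ 𝐧 (Vec.fromList w) ≡.refl (length w ℕ.≟ ∣ 𝐧 ∣))

  -- The two are compared as series because `∣ 0ʷ ∣` does not reduce to `0` for a variable `l`.
  S-0ʷ : S 0ʷ ≈ˡ 𝟙
  S-0ʷ = ⟦⟧-injective (S 0ʷ) 𝟙 λ w → K.trans (⟦S⟧ 0ʷ w) (K.trans (eq w) (K.sym (⟦⟧-𝟙 w)))
    where
    eq : ∀ {k} (w : List (Letter k)) → δ (sorted? w) K.* δ (weight w ≟ʷ 0ʷ) K.≈ unit w
    eq []      = K.trans (K.*-cong (K.reflexive (δ-yes (sorted? []) [])) (K.reflexive (δ-yes (0ʷ ≟ʷ 0ʷ) ≡.refl)))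
        (K.*-identityˡ _)
    eq (x ∷ w) = δ-0 (sorted? (x ∷ w)) (λ _ → K.reflexive (δ-no (weight (x ∷ w) ≟ʷ 0ʷ) (λ eq →
      ℕ.1+n≢0 (≡.trans (≡.sym (∣weight∣ (x ∷ w))) (≡.trans (≡.cong ∣_∣ eq) ∣0ʷ∣)))))

  _≪_ : List (Letter k) → List (Letter k) → Set
  u ≪ v = All (λ x → All (λ y → proj₁ x Fin.< proj₁ y) v) u

  -- In each of these words the letter `x` stands somewhere after the larger letter `y`.
  sum-unsorted : ∀ x y (u v : List (Letter k)) → proj₁ x Fin.< proj₁ y →
    sum (shuffles (x ∷ u) v) (λ w → δ (sorted? (y ∷ w))) K.≈ K.0#
  sum-unsorted x y u v x<y = sum-0 (shuffles (x ∷ u) v) (λ {w} w∈ → K.reflexive (δ-no (sorted? (y ∷ w)) (λ s →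
    ℕ.<⇒≱ x<y (All.head (shuffles-All⁻ (x ∷ u) v w∈ (All.tail (Linked.Linked⇒All Fin.≤-trans {v = y} Fin.≤-refl s)))))))
    where
    shuffles-All⁻ : ∀ {P : Letter _ → Set} u v {w} → w ∈ shuffles u v → All P w → All P u
    shuffles-All⁻ {P} = shuffles-elim {P = λ u v w → All P w → All P u} (λ _ _ → []) (λ _ _ p → p)
      (λ { ih (p ∷ ps) → p ∷ ih ps }) (λ { ih (_ ∷ ps) → ih ps })

  δ-sorted-∷ : ∀ x y (w : List (Letter k)) → δ (sorted? (x ∷ y ∷ w)) K.≈ δ (proj₁ x Fin.≤? proj₁ y) K.* δ (sorted? (y ∷ w))
  δ-sorted-∷ x y w = K.trans (K.reflexive (δ-cong (sorted? (x ∷ y ∷ w)) ((proj₁ x Fin.≤? proj₁ y) ×-dec sorted? (y ∷ w))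
    (λ s → Linked.head s , Linked.tail s) (λ (le , s) → le ∷ s))) (δ-× (proj₁ x Fin.≤? proj₁ y) (sorted? (y ∷ w)))

  -- Sortedness compares neighbours, so the letter `x` read last is carried along. As long as a
  -- letter of `u` remains, the branch that takes one of `v` vanishes by `sum-unsorted`; once `u` is
  -- used up, passing from `x` to `v` is an ascent.
  sum-sorted-∷ : ∀ x (u v : List (Letter k)) → (x ∷ u) ≪ v →
    sum (shuffles u v) (λ w → δ (sorted? (x ∷ w))) K.≈ δ (sorted? (x ∷ u)) K.* δ (sorted? v)
  sum-sorted-∷ x [] v (x< ∷ _) = K.trans (K.+-identityʳ _) (K.trans (K.reflexive (δ-cong (sorted? (x ∷ v))
      (sorted? v) Linked.tail (cons v x<)))
    (K.sym (K.trans (K.*-congʳ (K.reflexive (δ-yes (sorted? (x ∷ [])) [-]))) (K.*-identityˡ _))))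
    where
    cons : ∀ v → All (λ y → proj₁ x Fin.< proj₁ y) v → Sorted v → Sorted (x ∷ v)
    cons []      _        _ = [-]
    cons (y ∷ v) (lt ∷ _) s = ℕ.<⇒≤ lt ∷ s
  sum-sorted-∷ x (x′ ∷ u) [] _ = K.trans (sum-shuffles-[] (x′ ∷ u) (λ w → δ (sorted? (x ∷ w))))
    (K.sym (K.trans (K.*-congˡ (K.reflexive (δ-yes (sorted? []) []))) (K.*-identityʳ _)))
  sum-sorted-∷ x (x′ ∷ u) (y ∷ v) (_ ∷ x′<@(x′<y ∷ _) ∷ u<) = begin
    sum (shuffles (x′ ∷ u) (y ∷ v)) (λ w → δ (sorted? (x ∷ w)))
      ≈⟨ sum-shuffles-∷ x′ u y v _ ⟩
    sum (shuffles u (y ∷ v)) (λ w → δ (sorted? (x ∷ x′ ∷ w))) K.+ sum (shuffles (x′ ∷ u) v) (λ w → δ (sorted? (x ∷ y ∷ w)))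
      ≈⟨ K.+-cong (K.trans (sum-cong (shuffles u (y ∷ v)) (λ w → δ-sorted-∷ x x′ w)) (K.sym (*-sum (δ
          (proj₁ x Fin.≤? proj₁ x′)) (shuffles u (y ∷ v)) _)))
                  (K.trans (sum-cong (shuffles (x′ ∷ u) v) (λ w → δ-sorted-∷ x y w)) (K.trans (K.sym (*-sum (δ
                      (proj₁ x Fin.≤? proj₁ y)) (shuffles (x′ ∷ u) v) _))
                    (K.trans (K.*-congˡ (sum-unsorted x′ y u v x′<y)) (K.zeroʳ _)))) ⟩
    δ (proj₁ x Fin.≤? proj₁ x′) K.* sum (shuffles u (y ∷ v)) (λ w → δ (sorted? (x′ ∷ w))) K.+ K.0#
      ≈⟨ K.+-identityʳ _ ⟩
    δ (proj₁ x Fin.≤? proj₁ x′) K.* sum (shuffles u (y ∷ v)) (λ w → δ (sorted? (x′ ∷ w)))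
      ≈⟨ K.*-congˡ (sum-sorted-∷ x′ u (y ∷ v) (x′< ∷ u<)) ⟩
    δ (proj₁ x Fin.≤? proj₁ x′) K.* (δ (sorted? (x′ ∷ u)) K.* δ (sorted? (y ∷ v)))
      ≈⟨ K.trans (K.sym (K.*-assoc _ _ _)) (K.*-congʳ (K.sym (δ-sorted-∷ x x′ u))) ⟩
    δ (sorted? (x ∷ x′ ∷ u)) K.* δ (sorted? (y ∷ v)) ∎

  sum-sorted : ∀ (u v : List (Letter k)) → u ≪ v → sum (shuffles u v) (δ ∘ sorted?) K.≈ δ (sorted? u) K.* δ (sorted? v)
  sum-sorted []      v  _ = K.trans (K.+-identityʳ _) (K.sym (K.trans (K.*-congʳ (K.reflexive (δ-yes
      (sorted? []) []))) (K.*-identityˡ _)))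
  sum-sorted (x ∷ u) [] _ = K.trans (K.+-identityʳ _) (K.sym (K.trans (K.*-congˡ (K.reflexive (δ-yes
      (sorted? []) []))) (K.*-identityʳ _)))
  sum-sorted (x ∷ u) (y ∷ v) x<@((x<y ∷ _) ∷ _) = K.trans (sum-shuffles-∷ x u y v (δ ∘ sorted?))
    (K.trans (K.+-cong (sum-sorted-∷ x u (y ∷ v) x<) (sum-unsorted x y u v x<y)) (K.+-identityʳ _))

  sorted-map⁺ : ∀ {p} (f : Fin k → Fin p) → (∀ {x y} → x Fin.≤ y → f x Fin.≤ f y) → (∀ {x y} → f x Fin.≤ f y → x Fin.≤ y) →
    ∀ w → δ (sorted? (List.map (map₁ f) w)) ≡ δ (sorted? w)
  sorted-map⁺ f f↑ f↓ w = δ-cong (sorted? (List.map (map₁ f) w)) (sorted? w)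
    (λ s → Linked.map f↓ (Linked.map⁻ s)) (λ s → Linked.map⁺ (Linked.map f↑ s))

  Δ⟦S⟧ : ∀ 𝐧 {p q} (u : List (Letter p)) (v : List (Letter q)) →
    Δ⟦ S 𝐧 ⟧ u v K.≈ δ (sorted? u) K.* δ (sorted? v) K.* δ ((weight u +ʷ weight v) ≟ʷ 𝐧)
  Δ⟦S⟧ 𝐧 {p} {q} u v = begin
    sum (shifted u v) ⟦ S 𝐧 ⟧
      ≈⟨ sum-cong-∈ (shifted u v) (λ {w} w∈ → K.trans (⟦S⟧ 𝐧 w) (K.*-congˡ (K.reflexive (≡.cong (λ 𝐚 → δ (𝐚 ≟ʷ 𝐧))
           (≡.trans (weight-shuffles u′ v′ w∈) (≡.cong₂ _+ʷ_ (weight-map₁ (_↑ˡ q) u) (weight-map₁ (p ↑ʳ_) v))))))) ⟩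
    sum (shifted u v) (λ w → δ (sorted? w) K.* d)
      ≈⟨ sum-* (shifted u v) (λ w → δ (sorted? w)) d ⟨
    sum (shifted u v) (δ ∘ sorted?) K.* d
      ≈⟨ K.*-congʳ (sum-sorted u′ v′ (All.map⁺ (All.universal (λ (x , _) → All.map⁺ (All.universal (λ
          (y , _) → ↑ˡ<↑ʳ x y) v)) u))) ⟩
    δ (sorted? u′) K.* δ (sorted? v′) K.* d
      ≡⟨ ≡.cong₂ (λ a b → a K.* b K.* d) (sorted-map⁺ (_↑ˡ q) (↑ˡ-mono q) (↑ˡ-cancel q) u) (sorted-map⁺ (p ↑ʳ_)
          (↑ʳ-mono p) (↑ʳ-cancel p) v) ⟩
    δ (sorted? u) K.* δ (sorted? v) K.* d ∎
    where
    u′ v′ : List (Letter (p ℕ.+ q))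
    u′ = List.map (inˡ q) u
    v′ = List.map (inʳ p) v
    d = δ ((weight u +ʷ weight v) ≟ʷ 𝐧)

  decompositions-unique : ∀ 𝐧 → Uniqueˡ (decompositions 𝐧)
  decompositions-unique 𝐧 = Uniqueˡ.filter⁺ (λ (𝐢 , 𝐣) → Vec.zipWith ℕ._+_ 𝐢 𝐣 ≟ʷ 𝐧) (Uniqueˡ.cartesianProduct⁺ u u)
    where u = words-unique (Uniqueˡ.upTo⁺ (suc ∣ 𝐧 ∣)) l

  ∈-decompositions⁻ : ∀ 𝐧 {𝐢 𝐣} → (𝐢 , 𝐣) ∈ decompositions 𝐧 → 𝐢 +ʷ 𝐣 ≡ 𝐧
  ∈-decompositions⁻ 𝐧 ij∈ = proj₂ (∈-filter⁻ (λ (𝐢 , 𝐣) → Vec.zipWith ℕ._+_ 𝐢 𝐣 ≟ʷ 𝐧) {xs = List.cartesianProduct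
      (words (upTo (suc ∣ 𝐧 ∣)) l) (words (upTo (suc ∣ 𝐧 ∣)) l)} ij∈)

  ∈-decompositions⁺ : ∀ 𝐢 𝐣 → (𝐢 , 𝐣) ∈ decompositions (𝐢 +ʷ 𝐣)
  ∈-decompositions⁺ 𝐢 𝐣 = ∈-filter⁺ (λ (𝐚 , 𝐛) → Vec.zipWith ℕ._+_ 𝐚 𝐛 ≟ʷ (𝐢 +ʷ 𝐣)) (∈-cartesianProduct⁺
      (box 𝐢 (≡.subst (∣ 𝐢 ∣ ≤_) (≡.sym (∣+ʷ∣ 𝐢 𝐣)) (ℕ.m≤m+n ∣ 𝐢 ∣ ∣ 𝐣 ∣)))
      (box 𝐣 (≡.subst (∣ 𝐣 ∣ ≤_) (≡.sym (∣+ʷ∣ 𝐢 𝐣)) (ℕ.m≤n+m ∣ 𝐣 ∣ ∣ 𝐢 ∣)))) ≡.refl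
    where
    lookup≤sum : ∀ {m} (a : Vec ℕ m) i → lookup a i ≤ Vec.sum a
    lookup≤sum (x ∷ a) zero    = ℕ.m≤m+n x (Vec.sum a)
    lookup≤sum (x ∷ a) (suc i) = ℕ.≤-trans (lookup≤sum a i) (ℕ.m≤n+m (Vec.sum a) x)
    box : ∀ 𝐚 → ∣ 𝐚 ∣ ≤ ∣ 𝐢 +ʷ 𝐣 ∣ → 𝐚 ∈ words (upTo (suc ∣ 𝐢 +ʷ 𝐣 ∣)) l
    box 𝐚 le = ∈-words 𝐚 (λ i → ∈-upTo⁺ (s≤s (ℕ.≤-trans (lookup≤sum 𝐚 i) le)))

  -- Only the pair `(weight u , weight v)` can give a nonzero term, and it is listed exactly when it
  -- adds up to `𝐧`.
  sum-decompositions : ∀ 𝐧 {p q} (u : List (Letter p)) (v : List (Letter q)) → Dec (weight u +ʷ weight v ≡ 𝐧) →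
    δ (sorted? u) K.* δ (sorted? v) K.* δ ((weight u +ʷ weight v) ≟ʷ 𝐧) K.≈
    sum (decompositions 𝐧) (λ (𝐢 , 𝐣) → δ (sorted? u) K.* δ (weight u ≟ʷ 𝐢) K.* (δ (sorted? v) K.* δ (weight v ≟ʷ 𝐣)))
  sum-decompositions 𝐧 u v (no ≢) = K.trans (K.trans (K.*-congˡ (K.reflexive (δ-no ((weight u +ʷ weight v) ≟ʷ 𝐧) ≢))) (K.zeroʳ _))
    (K.sym (sum-0 (decompositions 𝐧) (λ {(𝐢 , 𝐣)} ij∈ → K.trans (K.*-assoc _ _ _) (K.trans (K.*-congˡ (δ-0 (weight u ≟ʷ 𝐢) (λ eq →
      K.trans (K.*-congˡ (K.reflexive (δ-no (weight v ≟ʷ 𝐣) (λ eq′ → ≢ (≡.trans (≡.cong₂ _+ʷ_ eq eq′)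
          (∈-decompositions⁻ 𝐧 ij∈)))))) (K.zeroʳ _))))
      (K.zeroʳ _)))))
  sum-decompositions 𝐧 u v (yes ≡.refl) = K.sym (K.trans
    (sum-single (λ (𝐢 , 𝐣) → δ (sorted? u) K.* δ (weight u ≟ʷ 𝐢) K.* (δ (sorted? v) K.* δ (weight v ≟ʷ 𝐣)))
        (decompositions-unique 𝐧)
      (∈-decompositions⁺ (weight u) (weight v)) (λ {(𝐢 , 𝐣)} _ ≢ → K.trans (K.*-assoc _ _ _) (K.trans (K.*-congˡ
          (δ-0 (weight u ≟ʷ 𝐢) (λ eq →
      K.trans (K.*-congˡ (K.reflexive (δ-no (weight v ≟ʷ 𝐣) (λ eq′ → ≢ (≡.cong₂ _,_ (≡.sym eq) (≡.sym eq′))))))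
          (K.zeroʳ _)))) (K.zeroʳ _))))
    (K.trans (K.*-cong (K.trans (K.*-congˡ (K.reflexive (δ-yes (weight u ≟ʷ weight u) ≡.refl))) (K.*-identityʳ _))
                       (K.trans (K.*-congˡ (K.reflexive (δ-yes (weight v ≟ʷ weight v) ≡.refl))) (K.*-identityʳ _)))
      (K.sym (K.trans (K.*-congˡ (K.reflexive (δ-yes ((weight u +ʷ weight v) ≟ʷ (weight u +ʷ weight v)) ≡.refl)))
          (K.*-identityʳ _)))))

  coeff-ΔS : ∀ 𝐧 α β → coeff⊗ (Δ (S 𝐧)) (α , β) K.≈ sum (decompositions 𝐧) (λ (𝐢 , 𝐣) → coeff (S 𝐢) α K.* coeff (S 𝐣) β)
  coeff-ΔS 𝐧 α β = ≡.subst₂ (λ α β → coeff⊗ (Δ (S 𝐧)) (α , β) K.≈ sum (decompositions 𝐧) (λ (𝐢 , 𝐣) → coeff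
      (S 𝐢) α K.* coeff (S 𝐣) β))
    (stdʷ-toWord α) (stdʷ-toWord β) (K.trans (coeff-Δ (S 𝐧) u v) (K.trans (Δ⟦S⟧ 𝐧 u v) (K.trans
      (sum-decompositions 𝐧 u v ((weight u +ʷ weight v) ≟ʷ 𝐧))
      (sum-cong (decompositions 𝐧) (λ (𝐢 , 𝐣) → K.sym (K.*-cong (⟦S⟧ 𝐢 u) (⟦S⟧ 𝐣 v)))))))
    where
    u = toWord α
    v = toWord β

  Δ-S : ∀ 𝐧 → Δ (S 𝐧) ≈⊗ Σ[ decompositions 𝐧 ] λ (𝐢 , 𝐣) → S 𝐢 ⊗ S 𝐣
  Δ-S 𝐧 (α , β) = K.trans (coeff-ΔS 𝐧 α β) (K.sym (K.trans (⊗.coeff-Σ (decompositions 𝐧) (λ (𝐢 , 𝐣) → S 𝐢 ⊗ S 𝐣) (α , β))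
    (sum-cong (decompositions 𝐧) (λ (𝐢 , 𝐣) → coeff⊗-⊗ (S 𝐢) (S 𝐣) α β))))

-- Freeness

module Independence {c ℓ} (K : CommutativeRing c ℓ) (l : ℕ) where
  open FQSym K l
  open ColoredWords l
  open Words l
  open FreeModules K hiding (module Coefficients)
  open Series K l
  open HopfStructure K l
  open Generators K l
  private
    module K = CommutativeRing K
  open SumsOverWords K.+-commutativeMonoid
  open import Relation.Binary.Reasoning.Setoid K.setoid

  Sᴵ : List Weight → FQ
  Sᴵ []      = 𝟙
  Sᴵ (𝐧 ∷ 𝐈) = S 𝐧 *ˡ Sᴵ 𝐈

  _≟ᴵ_ : DecidableEquality (List Weight)
  _≟ᴵ_ = List.≡-dec _≟ʷ_

  colors : ∀ {m} → Vec ℕ m → List (Fin m)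
  colors []      = []
  colors (x ∷ a) = List.replicate x zero ++ List.map suc (colors a)

  block : Weight → List (Letter (suc m))
  block {m} 𝐧 = List.map (Fin.fromℕ m ,_) (colors 𝐧)

  -- The blocks are sorted by color, and their letters decrease from each block to the next.
  blocks : (𝐉 : List Weight) → List (Letter (length 𝐉))
  blocks []      = []
  blocks (𝐧 ∷ 𝐉) = block 𝐧 ++ List.map (map₁ Fin.inject₁) (blocks 𝐉)

  weight-block : ∀ {m} 𝐧 → weight (block {m} 𝐧) ≡ 𝐧
  weight-block {m} 𝐧 = ≡.trans (eq (colors 𝐧)) (countColors-colors 𝐧)
    where
    e : ∀ {m} → Fin m → Vec ℕ m
    e c = tabulate (λ i → if does (c Fin.≟ i) then 1 else 0)
    countColors : ∀ {m} → List (Fin m) → Vec ℕ m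
    countColors []      = Vec.replicate _ 0
    countColors (c ∷ u) = Vec.zipWith ℕ._+_ (e c) (countColors u)
    eq : ∀ u → weight (List.map (Fin.fromℕ m ,_) u) ≡ countColors u
    eq []      = ≡.refl
    eq (c ∷ u) = ≡.cong (single c +ʷ_) (eq u)
    countColors-suc : ∀ {m} (u : List (Fin m)) → countColors (List.map suc u) ≡ 0 ∷ countColors u
    countColors-suc []      = ≡.refl
    countColors-suc (c ∷ u) = ≡.cong (Vec.zipWith ℕ._+_ (0 ∷ e c)) (countColors-suc u)
    zeros+ : ∀ {m} (a : Vec ℕ m) → Vec.zipWith ℕ._+_ (tabulate (λ _ → 0)) a ≡ a
    zeros+ []      = ≡.refl
    zeros+ (x ∷ a) = ≡.cong (x ∷_) (zeros+ a)
    countColors-∷ : ∀ {m} x (u : List (Fin m)) → countColors (List.replicate x zero ++ List.map suc u) ≡ x ∷ countColors u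
    countColors-∷ zero    u = countColors-suc u
    countColors-∷ (suc x) u = ≡.trans (≡.cong (Vec.zipWith ℕ._+_ (e zero)) (countColors-∷ x u)) (≡.cong (suc x ∷_)
        (zeros+ (countColors u)))
    countColors-colors : ∀ {m} (a : Vec ℕ m) → countColors (colors a) ≡ a
    countColors-colors []      = ≡.refl
    countColors-colors (x ∷ a) = ≡.trans (countColors-∷ x (colors a)) (≡.cong (x ∷_) (countColors-colors a))

  TopLetters : List (Letter (suc m)) → Set
  TopLetters {m} = All (λ x → proj₁ x ≡ Fin.fromℕ m)

  -- Levi's lemma with the common cut excluded: the cut after `u` lies before the end of `b` or
  -- beyond it.
  ++-cases : ∀ {X : Set} (u b : List X) {v w} → u ++ v ≡ b ++ w → length u ≢ length b →
    (∃[ y ] ∃[ b′ ] v ≡ (y ∷ b′) ++ w × b ≡ u ++ y ∷ b′) ⊎ (∃[ x ] ∃[ u′ ] w ≡ (x ∷ u′) ++ v × u ≡ b ++ x ∷ u′)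
  ++-cases []      []      eq ne = contradiction ≡.refl ne
  ++-cases []      (y ∷ b) eq ne = inj₁ (y , b , eq , ≡.refl)
  ++-cases (x ∷ u) []      eq ne = inj₂ (x , u , ≡.sym eq , ≡.refl)
  ++-cases (x ∷ u) (y ∷ b) eq ne with ≡.refl ← List.∷-injectiveˡ eq with ++-cases u b (List.∷-injectiveʳ eq) (ne ∘ ≡.cong suc)
  ... | inj₁ (y′ , b′ , eq₁ , eq₂) = inj₁ (y′ , b′ , eq₁ , ≡.cong (x ∷_) eq₂)
  ... | inj₂ (x′ , u′ , eq₁ , eq₂) = inj₂ (x′ , u′ , eq₁ , ≡.cong (x ∷_) eq₂)

  top-sorted : ∀ {b : List (Letter (suc m))} → TopLetters b → Sorted b
  top-sorted []                       = []
  top-sorted (_ ∷ [])                 = [-]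
  top-sorted (eq ∷ eq′ ∷ eqs) = ℕ.≤-reflexive (≡.cong toℕ (≡.trans eq (≡.sym eq′))) ∷ top-sorted (eq′ ∷ eqs)

  -- The letter `y` comes from the smaller alphabet and hence lies below the top letter `x`,
  -- although it stands after it.
  below-top : ∀ {x} {b w u′ v} → TopLetters {m} (x ∷ b) → ∀ {y} → List.map (map₁ Fin.inject₁) w ≡
      (y ∷ u′) ++ v → ¬ Sorted ((x ∷ b) ++ y ∷ u′)
  below-top {x = x} {b = b} {w = z ∷ w} (eq ∷ eqs) eq′ s with ≡.refl ← List.∷-injectiveˡ eq′ = ℕ.<⇒≱ (≡.subst₂ _<_
      (≡.sym (Fin.toℕ-inject₁ (proj₁ z)))
      (≡.sym (≡.trans (≡.cong toℕ eq) (Fin.toℕ-fromℕ _))) (Fin.toℕ<n (proj₁ z)))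
    (All.head (All.++⁻ʳ (x ∷ b) (Linked.Linked⇒All Fin.≤-trans {v = x} Fin.≤-refl s)))

  Nonempty : ∀ {X : Set} → List X → Set
  Nonempty w = length w ≢ 0

  mutual

    -- The matrix of the functionals x ↦ ⟦ x ⟧ (blocks 𝐉) on the family Sᴵ is
    -- triangular with respect to the lengths.
    Sᴵ-blocks : ∀ 𝐈 𝐉 → All (λ 𝐧 → 0 < ∣ 𝐧 ∣) 𝐉 → length 𝐈 ≤ length 𝐉 → ⟦ Sᴵ 𝐈 ⟧ (blocks 𝐉) K.≈ δ (𝐈 ≟ᴵ 𝐉)
    Sᴵ-blocks []      []      _          _  = K.trans (⟦⟧-𝟙 {0} []) (K.reflexive (≡.sym (δ-yes ([] ≟ᴵ []) ≡.refl)))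
    Sᴵ-blocks 𝐈       (𝐧 ∷ 𝐉) (pos ∷ pos𝐉) le = K.trans
      (Sᴵ-top-blocks 𝐈 𝐉 (block 𝐧) pos𝐉 (All.map⁺ (All.universal (λ _ → ≡.refl) (colors 𝐧))) nonempty le)
      (K.reflexive (≡.cong (λ 𝐚 → δ (𝐈 ≟ᴵ (𝐚 ∷ 𝐉))) (weight-block 𝐧)))
      where
      nonempty : Nonempty (block 𝐧)
      nonempty eq = ℕ.<⇒≢ pos (≡.sym (≡.trans (≡.cong ∣_∣ (≡.sym (weight-block 𝐧))) (≡.trans (∣weight∣ (block 𝐧)) eq)))

    -- The first block is generalized to any nonempty word `b` on the top letter, because a factor
    -- of the product may stop inside the block and leave a nonempty remainder of the same kind.
    -- This is also why the bound on the length of `𝐈` is `suc (length 𝐉)`.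
    Sᴵ-top-blocks : ∀ 𝐈 𝐉 (b : List (Letter (suc (length 𝐉)))) → All
        (λ 𝐧 → 0 < ∣ 𝐧 ∣) 𝐉 → TopLetters b → Nonempty b → length 𝐈 ≤ suc (length 𝐉) →
      ⟦ Sᴵ 𝐈 ⟧ (b ++ List.map (map₁ Fin.inject₁) (blocks 𝐉)) K.≈ δ (𝐈 ≟ᴵ (weight b ∷ 𝐉))
    Sᴵ-top-blocks _       𝐉 []       _   _   ne _        = contradiction ≡.refl ne
    Sᴵ-top-blocks []      𝐉 b@(_ ∷ _) _  _   _  _        = K.trans (⟦⟧-𝟙 (b ++ List.map (map₁ Fin.inject₁)
        (blocks 𝐉))) (K.reflexive (≡.sym (δ-no ([] ≟ᴵ (weight b ∷ 𝐉)) λ ())))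
    Sᴵ-top-blocks (𝐧 ∷ 𝐈) 𝐉 b@(x ∷ b₁) pos top _ (s≤s le) = begin
      ⟦ S 𝐧 *ˡ Sᴵ 𝐈 ⟧ (b ++ rest)
        ≈⟨ ⟦⟧-* (S 𝐧) (Sᴵ 𝐈) (b ++ rest) ⟩
      sum (splits (b ++ rest)) (λ (u , v) → ⟦ S 𝐧 ⟧ u K.* ⟦ Sᴵ 𝐈 ⟧ v)
        ≈⟨ sum-splits-at b rest (λ (u , v) → ⟦ S 𝐧 ⟧ u K.* ⟦ Sᴵ 𝐈 ⟧ v) (λ {u} {v} uv∈ ne →
             others u v (++-cases u b (∈-splits (b ++ rest) uv∈) ne)) ⟩
      ⟦ S 𝐧 ⟧ b K.* ⟦ Sᴵ 𝐈 ⟧ rest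
        ≈⟨ K.*-cong (K.trans (⟦S⟧ 𝐧 b) (K.trans (K.*-congʳ (K.reflexive (δ-yes (sorted? b) (top-sorted top)))) (K.*-identityˡ _)))
             (K.trans (K.reflexive (≡.cong (coeff (Sᴵ 𝐈)) (stdʷ-map Fin.inject₁ inject₁-mono inject₁-cancel
                 (blocks 𝐉)))) (Sᴵ-blocks 𝐈 𝐉 pos le)) ⟩
      δ (weight b ≟ʷ 𝐧) K.* δ (𝐈 ≟ᴵ 𝐉)
        ≈⟨ δ-× (weight b ≟ʷ 𝐧) (𝐈 ≟ᴵ 𝐉) ⟨
      δ ((weight b ≟ʷ 𝐧) ×-dec (𝐈 ≟ᴵ 𝐉))
        ≡⟨ δ-cong ((weight b ≟ʷ 𝐧) ×-dec (𝐈 ≟ᴵ 𝐉)) ((𝐧 ∷ 𝐈) ≟ᴵ (weight b ∷ 𝐉))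
             (λ (eq , eq′) → ≡.cong₂ _∷_ (≡.sym eq) eq′) (λ eq → ≡.sym (List.∷-injectiveˡ eq) , List.∷-injectiveʳ eq) ⟩
      δ ((𝐧 ∷ 𝐈) ≟ᴵ (weight b ∷ 𝐉)) ∎
      where
      rest = List.map (map₁ Fin.inject₁) (blocks 𝐉)
      inject₁-mono : ∀ {n} {x y : Fin n} → x Fin.≤ y → Fin.inject₁ x Fin.≤ Fin.inject₁ y
      inject₁-mono {x = x} {y} = ≡.subst₂ _≤_ (≡.sym (Fin.toℕ-inject₁ x)) (≡.sym (Fin.toℕ-inject₁ y))
      inject₁-cancel : ∀ {n} {x y : Fin n} → Fin.inject₁ x Fin.≤ Fin.inject₁ y → x Fin.≤ y
      inject₁-cancel {x = x} {y} = ≡.subst₂ _≤_ (Fin.toℕ-inject₁ x) (Fin.toℕ-inject₁ y)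
      others : ∀ u v → (∃[ y ] ∃[ b′ ] v ≡ (y ∷ b′) ++ rest × b ≡ u ++ y ∷ b′) ⊎ (∃[ z ] ∃[ u′ ] rest ≡
          (z ∷ u′) ++ v × u ≡ b ++ z ∷ u′) →
        ⟦ S 𝐧 ⟧ u K.* ⟦ Sᴵ 𝐈 ⟧ v K.≈ K.0#
      -- The factor `u`, possibly empty, stops before the end of `b`. By the induction hypothesis
      -- the remainder would require `𝐈` to have `suc (length 𝐉)` entries, and it has at most
      -- `length 𝐉`.
      others u v (inj₁ (y , b′ , ≡.refl , eq)) = K.trans (K.*-congˡ (K.trans
        (Sᴵ-top-blocks 𝐈 𝐉 (y ∷ b′) pos (All.++⁻ʳ u (≡.subst TopLetters eq top)) (λ ()) (ℕ.m≤n⇒m≤1+n le))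
        (K.reflexive (δ-no (𝐈 ≟ᴵ (weight (y ∷ b′) ∷ 𝐉)) (λ { ≡.refl → ℕ.1+n≰n le }))))) (K.zeroʳ _)
      others u v (inj₂ (z , u′ , eq , ≡.refl)) = K.trans (K.*-congʳ (K.trans (⟦S⟧ 𝐧 u) (δ-0 (sorted? u) (λ s →
        contradiction s (below-top {b = b₁} {w = blocks 𝐉} {u′ = u′} {v = v} top eq))))) (K.zeroˡ _)

-- Noncommutative polynomials and their evaluation

module _ {c ℓ} (K : CommutativeRing c ℓ) where
  private module K = CommutativeRing K
  open Linear K

  infixl 7 _*ᵖ_
  -- `Lin K (List X)` with this product models the free algebra on `X`, the words being its
  -- monomials.
  _*ᵖ_ : ∀ {x} {X : Set x} → Lin K (List X) → Lin K (List X) → Lin K (List X)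
  _*ᵖ_ = List.cartesianProductWith (λ (a , u) (b , v) → a K.* b , u ++ v)

  module AlgebraProperties {b ℓb} (B : RawAlgebra K b ℓb) (isAlgebra : IsAlgebra K B) where
    open RawAlgebra B
    open IsAlgebra isAlgebra public

    leftModule : LeftModule K.ring b ℓb
    leftModule = record { isLeftModule = isModule }

    ring : Ring b ℓb
    ring = record { isRing = isRing }

    open LeftModule leftModule public using (*ₗ-cong; *ₗ-assoc; *ₗ-distribʳ; *ₗ-identityˡ; *ₗ-zeroˡ; uniqueˡ‿-ᴹ;
        +ᴹ-commutativeMonoid)
    open Ring ring public using (setoid; -‿cong; refl; sym; trans; *-cong; *-congˡ; *-congʳ; +-cong; *-assoc;
        *-identityˡ; *-identityʳ; distribˡ; distribʳ; zeroˡ; zeroʳ)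
    open FiniteSums +ᴹ-commutativeMonoid

    -1·x≈-x : ∀ x → ((K.- K.1#) · x) ≈ (- x)
    -1·x≈-x x = uniqueˡ‿-ᴹ ((K.- K.1#) · x) x (trans (+-cong refl (sym (*ₗ-identityˡ x)))
      (trans (sym (*ₗ-distribʳ x (K.- K.1#) K.1#)) (trans (*ₗ-cong (K.-‿inverseˡ K.1#) refl) (*ₗ-zeroˡ x))))

    sum-*ʳ : ∀ {i} {I : Set i} (is : List I) f y → (sum is f * y) ≈ sum is (λ i → f i * y)
    sum-*ʳ []       f y = zeroˡ y
    sum-*ʳ (i ∷ is) f y = trans (distribʳ y (f i) (sum is f)) (+-cong refl (sum-*ʳ is f y))

    sum-*ˡ : ∀ {i} {I : Set i} y (is : List I) f → (y * sum is f) ≈ sum is (λ i → y * f i)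
    sum-*ˡ y []       f = zeroʳ y
    sum-*ˡ y (i ∷ is) f = trans (distribˡ y (f i) (sum is f)) (+-cong refl (sum-*ˡ y is f))

  module Evaluation {b ℓb} (B : RawAlgebra K b ℓb) (isAlgebra : IsAlgebra K B)
                    {x} {X : Set x} (g : X → RawAlgebra.Carrier B) where
    open RawAlgebra B
    open AlgebraProperties B isAlgebra
    open FiniteSums +ᴹ-commutativeMonoid
    open FreeModules.LinearExtension K leftModule
    open import Relation.Binary.Reasoning.Setoid setoid

    monomial : List X → Carrier
    monomial []      = 1#
    monomial (i ∷ u) = g i * monomial u

    monomial-++ : ∀ u v → monomial (u ++ v) ≈ (monomial u * monomial v)
    monomial-++ []      v = sym (*-identityˡ _)
    monomial-++ (i ∷ u) v = trans (*-congˡ (monomial-++ u v)) (sym (*-assoc _ _ _))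

    evaluate : Lin K (List X) → Carrier
    evaluate = linear monomial

    evaluate-+ : ∀ p q → evaluate (p +ˡ q) ≈ (evaluate p + evaluate q)
    evaluate-+ = linear-+ monomial

    evaluate-· : ∀ a p → evaluate (a ·ˡ p) ≈ (a · evaluate p)
    evaluate-· = linear-· monomial

    evaluate-1 : evaluate (basis []) ≈ 1#
    evaluate-1 = linear-basis monomial []

    evaluate-generator : ∀ i → evaluate (basis (i ∷ [])) ≈ g i
    evaluate-generator i = trans (linear-basis monomial (i ∷ [])) (*-identityʳ (g i))

    evaluate-neg : ∀ p → evaluate ((K.- K.1#) ·ˡ p) ≈ (- evaluate p)
    evaluate-neg p = trans (evaluate-· (K.- K.1#) p) (-1·x≈-x (evaluate p))

    evaluate-* : ∀ p q → evaluate (p *ᵖ q) ≈ (evaluate p * evaluate q)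
    evaluate-* p q = begin
      evaluate (p *ᵖ q)
        ≈⟨ sum-cartesianProductWith (λ (a , u) (b , v) → a K.* b , u ++ v) p q (λ (a , u) → a · monomial u) ⟩
      sum p (λ (a , u) → sum q (λ (b , v) → (a K.* b) · monomial (u ++ v)))
        ≈⟨ sum-cong p (λ (a , u) → trans (sum-cong q (λ (b , v) → term a u b v)) (sym (sum-*ˡ (a · monomial u) q _))) ⟩
      sum p (λ (a , u) → (a · monomial u) * evaluate q)
        ≈⟨ sum-*ʳ p _ (evaluate q) ⟨
      evaluate p * evaluate q ∎
      where
      term : ∀ a u b v → ((a K.* b) · monomial (u ++ v)) ≈ ((a · monomial u) * (b · monomial v))
      term a u b v = begin
        (a K.* b) · monomial (u ++ v)         ≈⟨ *ₗ-cong K.refl (monomial-++ u v) ⟩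
        (a K.* b) · (monomial u * monomial v) ≈⟨ *ₗ-assoc a b _ ⟩
        a · (b · (monomial u * monomial v))   ≈⟨ *ₗ-cong K.refl (·-*-assocʳ b _ _) ⟨
        a · (monomial u * (b · monomial v))   ≈⟨ ·-*-assocˡ a _ _ ⟨
        (a · monomial u) * (b · monomial v)   ∎

  generatedSubalgebra-isAlgebra : ∀ {a ℓa x} (A : RawAlgebra K a ℓa) → IsAlgebra K A →
    {X : Set x} (g : X → RawAlgebra.Carrier A) → IsAlgebra K (generatedSubalgebra K A g)
  generatedSubalgebra-isAlgebra A isAlgebra g = record
    { isRing = record
      { +-isAbelianGroup = record
        { isGroup = record
          { isMonoid = +ˢ-isMonoid
          ; inverse = (λ u → -‿inverseˡ (proj₁ u)) , (λ u → -‿inverseʳ (proj₁ u))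
          ; ⁻¹-cong = λ p → -‿cong p
          }
        ; comm = λ u v → +-comm (proj₁ u) (proj₁ v)
        }
      ; *-cong = λ p q → *-cong p q
      ; *-assoc = λ u v w → *-assoc (proj₁ u) (proj₁ v) (proj₁ w)
      ; *-identity = (λ u → *-identityˡ (proj₁ u)) , (λ u → *-identityʳ (proj₁ u))
      ; distrib = (λ u v w → distribˡ (proj₁ u) (proj₁ v) (proj₁ w)) , (λ u v w → distribʳ (proj₁ u) (proj₁ v) (proj₁ w))
      }
    ; isModule = record
      { isLeftSemimodule = record
        { +ᴹ-isCommutativeMonoid = record { isMonoid = +ˢ-isMonoid ; comm = λ u v → +-comm (proj₁ u) (proj₁ v) }
        ; isPreleftSemimodule = record
          { *ₗ-cong = λ p q → M.*ₗ-cong p q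
          ; *ₗ-zeroˡ = λ u → M.*ₗ-zeroˡ (proj₁ u)
          ; *ₗ-distribʳ = λ u a b → M.*ₗ-distribʳ (proj₁ u) a b
          ; *ₗ-identityˡ = λ u → M.*ₗ-identityˡ (proj₁ u)
          ; *ₗ-assoc = λ a b u → M.*ₗ-assoc a b (proj₁ u)
          ; *ₗ-zeroʳ = M.*ₗ-zeroʳ
          ; *ₗ-distribˡ = λ a u v → M.*ₗ-distribˡ a (proj₁ u) (proj₁ v)
          }
        }
      ; -ᴹ‿cong = λ p → M.-ᴹ‿cong p
      ; -ᴹ‿inverse = (λ u → M.-ᴹ‿inverseˡ (proj₁ u)) , (λ u → M.-ᴹ‿inverseʳ (proj₁ u))
      }
    ; ·-*-assocˡ = λ a u v → ·-*-assocˡ a (proj₁ u) (proj₁ v)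
    ; ·-*-assocʳ = λ a u v → ·-*-assocʳ a (proj₁ u) (proj₁ v)
    }
    where
    open RawAlgebra (generatedSubalgebra K A g) using () renaming (_≈_ to _≈ˢ_; _+_ to _+ˢ_; 0# to 0ˢ)
    open import Algebra.Structures _≈ˢ_ using (IsMonoid)
    open IsAlgebra isAlgebra
    open IsRing isRing
    module M = IsLeftModule isModule
    +ˢ-isMonoid : IsMonoid _+ˢ_ 0ˢ
    +ˢ-isMonoid = record
      { isSemigroup = record
        { isMagma = record
          { isEquivalence = record { refl = refl ; sym = λ p → sym p ; trans = λ p q → trans p q }
          ; ∙-cong = λ p q → +-cong p q
          }
        ; assoc = λ u v w → +-assoc (proj₁ u) (proj₁ v) (proj₁ w)
        }
      ; identity = (λ u → +-identityˡ (proj₁ u)) , (λ u → +-identityʳ (proj₁ u))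
      }

-- Independence of the products and the universal property

module Freeness {c ℓ} (K : CommutativeRing c ℓ) (l : ℕ) where
  open FQSym K l
  open ColoredWords l
  open FreeModules K hiding (module Coefficients)
  open Series K l
  open HopfStructure K l
  open Generators K l
  open Independence K l
  private
    module K = CommutativeRing K
  open FreeModules.Coefficients K _≟ᶜ_ using (coeff-+; coeff-·)

  Index : Set
  Index = Σ Weight λ 𝐧 → 0 < ∣ 𝐧 ∣

  _≟ⁱ_ : DecidableEquality (List Index)
  _≟ⁱ_ = List.≡-dec (Product.≡-dec _≟ʷ_ (λ p q → yes (ℕ.<-irrelevant p q)))

  module P = FreeModules.Coefficients K _≟ⁱ_

  open Evaluation K rawAlgebra isAlgebra {X = Index} (S ∘ proj₁)

  -- `S 0ʷ` is the unit and not one of the free generators, so it is represented by the empty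
  -- monomial.
  polynomialS : ∀ 𝐧 → Dec (0 < ∣ 𝐧 ∣) → Lin K (List Index)
  polynomialS 𝐧 (yes p) = basis ((𝐧 , p) ∷ [])
  polynomialS 𝐧 (no _)  = basis []

  -- The polynomial is read off the derivation of membership and a priori depends on it.
  -- Independence of the monomials removes this dependence up to `_≈ˡ_`.
  polynomial : ∀ {x} → IsSym x → Lin K (List Index)
  polynomial (generator 𝐧) = polynomialS 𝐧 (0 ℕ.<? ∣ 𝐧 ∣)
  polynomial (resp _ d)    = polynomial d
  polynomial zero          = []
  polynomial one           = basis []
  polynomial (add d d′)    = polynomial d +ˡ polynomial d′
  polynomial (neg d)       = (K.- K.1#) ·ˡ polynomial d
  polynomial (mul d d′)    = _*ᵖ_ K (polynomial d) (polynomial d′)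
  polynomial (scale a d)   = a ·ˡ polynomial d

  S-nonpositive : ∀ 𝐧 → ¬ 0 < ∣ 𝐧 ∣ → S 𝐧 ≈ˡ 𝟙
  S-nonpositive 𝐧 ¬p = ≡.subst (λ 𝐚 → S 𝐚 ≈ˡ 𝟙) (≡.sym (∣∣≡0⇒≡0ʷ 𝐧 (ℕ.n≤0⇒n≡0 (ℕ.≮⇒≥ ¬p)))) S-0ʷ

  evaluate-polynomialS : ∀ 𝐧 d → evaluate (polynomialS 𝐧 d) ≈ˡ S 𝐧
  evaluate-polynomialS 𝐧 (yes p) = evaluate-generator (𝐧 , p)
  evaluate-polynomialS 𝐧 (no ¬p) e = K.trans (evaluate-1 e) (K.sym (S-nonpositive 𝐧 ¬p e))

  evaluate-polynomial : ∀ {x} (d : IsSym x) → evaluate (polynomial d) ≈ˡ x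
  evaluate-polynomial (generator 𝐧)   = evaluate-polynomialS 𝐧 (0 ℕ.<? ∣ 𝐧 ∣)
  evaluate-polynomial (resp eq d)   e = K.trans (evaluate-polynomial d e) (eq e)
  evaluate-polynomial zero          e = K.refl
  evaluate-polynomial one             = evaluate-1
  evaluate-polynomial (add {x} {y} d d′) e = K.trans (evaluate-+ (polynomial d) (polynomial d′) e)
    (+ˡ-cong {evaluate (polynomial d)} {x} {evaluate (polynomial d′)} {y} (evaluate-polynomial d) (evaluate-polynomial d′) e)
  evaluate-polynomial (neg {x} d)       e = K.trans (evaluate-· (K.- K.1#) (polynomial d) e)
    (·ˡ-cong {x = evaluate (polynomial d)} {x} K.refl (evaluate-polynomial d) e)
  evaluate-polynomial (mul {x} {y} d d′) e = K.trans (evaluate-* (polynomial d) (polynomial d′) e)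
    (*ˡ-cong {evaluate (polynomial d)} {x} {evaluate (polynomial d′)} {y} (evaluate-polynomial d) (evaluate-polynomial d′) e)
  evaluate-polynomial (scale a {x} d)   e = K.trans (evaluate-· a (polynomial d) e)
    (·ˡ-cong {x = evaluate (polynomial d)} {x} K.refl (evaluate-polynomial d) e)

  coeff-evaluate : ∀ p e → coeff (evaluate p) e K.≈ linear (λ u → coeff (monomial u) e) p
  coeff-evaluate []            e = K.refl
  coeff-evaluate ((a , u) ∷ p) e = K.trans (coeff-+ (a ·ˡ monomial u) (evaluate p) e)
    (K.+-cong (coeff-· a (monomial u) e) (coeff-evaluate p e))

  monomial≡Sᴵ : ∀ u → monomial u ≡ Sᴵ (List.map proj₁ u)
  monomial≡Sᴵ []            = ≡.refl
  monomial≡Sᴵ ((𝐧 , _) ∷ u) = ≡.cong (S 𝐧 *ˡ_) (monomial≡Sᴵ u)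

  monomial-blocks : ∀ u v → length u ≤ length v → ⟦ monomial u ⟧ (blocks (List.map proj₁ v)) K.≈ δ (u ≟ⁱ v)
  monomial-blocks u v le = K.trans (K.reflexive (≡.cong (λ x → ⟦ x ⟧ (blocks (List.map proj₁ v))) (monomial≡Sᴵ u)))
    (K.trans (Sᴵ-blocks (List.map proj₁ u) (List.map proj₁ v) (All.map⁺ (All.universal proj₂ v))
        (≡.subst₂ _≤_ (≡.sym (List.length-map proj₁ u)) (≡.sym (List.length-map proj₁ v)) le))
      (K.reflexive (δ-cong (List.map proj₁ u ≟ᴵ List.map proj₁ v) (u ≟ⁱ v) (List.map-injective index-injective)
          (≡.cong (List.map proj₁)))))
    where
    index-injective : ∀ {i j : Index} → proj₁ i ≡ proj₁ j → i ≡ j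
    index-injective {_ , p} {_ , q} ≡.refl = ≡.cong (_ ,_) (ℕ.<-irrelevant p q)

  -- Descending induction on the length of `v`. Once the coefficients of all longer monomials are
  -- known to vanish, the coefficient of `evaluate p` at the word `blocks` of `v` isolates that of
  -- `v`, because `monomial-blocks` covers all monomials that are left.
  monomials-independent : ∀ p → evaluate p ≈ˡ [] → ∀ v → P.coeff p v K.≈ K.0#
  monomials-independent p eq v with bound p
    where
    bound : ∀ p → ∃[ N ] (∀ {t : K.Carrier × List Index} → t ∈ p → length (proj₂ t) ≤ N)
    bound []            = 0 , λ ()
    bound ((a , u) ∷ p) with N , ≤N ← bound p = length u ℕ.⊔ N ,
      λ { (here ≡.refl) → ℕ.m≤m⊔n (length u) N ; (there t∈) → ℕ.≤-trans (≤N t∈) (ℕ.m≤n⊔m (length u) N) }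
  ... | N , ≤N = vanish (suc N) v (ℕ.m≤n+m (suc N) (length v))
    where
    -- The number `d` bounds the distance of `length v` from the range above `N`; for `d = 0` the
    -- word `v` is longer than every monomial listed in `p`.
    vanish : ∀ d v → N < length v ℕ.+ d → P.coeff p v K.≈ K.0#
    vanish zero v lt = K.trans (P.coeff-linear p v) (sum-0 p (λ {(a , u)} t∈ → K.trans (K.*-congˡ (K.reflexive (δ-no (u ≟ⁱ v)
      (λ { ≡.refl → ℕ.<⇒≱ (≡.subst (N <_) (ℕ.+-identityʳ _) lt) (≤N t∈) })))) (K.zeroʳ a)))
    vanish (suc d) v lt = K.trans (P.coeff-linear p v) (K.trans
      (linear-cong-coeff _≟ⁱ_ p (λ u → term u (length u ℕ.≤? length v)))
      (K.trans (K.sym (coeff-evaluate p (stdʷ (blocks (List.map proj₁ v))))) (eq (stdʷ (blocks (List.map proj₁ v))))))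
      where
      term : ∀ u → Dec (length u ≤ length v) →
        P.coeff p u K.* δ (u ≟ⁱ v) K.≈ P.coeff p u K.* coeff (monomial u) (stdʷ (blocks (List.map proj₁ v)))
      term u (yes le) = K.*-congˡ (K.sym (monomial-blocks u v le))
      term u (no nle) = K.trans (K.*-congʳ coeff≈0) (K.trans (K.zeroˡ _) (K.sym (K.trans (K.*-congʳ coeff≈0) (K.zeroˡ _))))
        where
        coeff≈0 : P.coeff p u K.≈ K.0#
        coeff≈0 = vanish d u (ℕ.<-≤-trans lt (≡.subst (_≤ length u ℕ.+ d) (≡.sym (ℕ.+-suc (length v) d))
            (ℕ.+-monoˡ-≤ d (ℕ.≰⇒> nle))))

  evaluate-injective : ∀ p q → evaluate p ≈ˡ evaluate q → p P.≈ˡ q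
  evaluate-injective p q eq v = x+-1*y≈0⇒x≈y (K.trans (K.sym (K.trans (P.coeff-+ p ((K.- K.1#) ·ˡ q) v) (K.+-congˡ
      (P.coeff-· (K.- K.1#) q v))))
      (monomials-independent (p +ˡ (K.- K.1#) ·ˡ q) difference v))
    where
    open import Algebra.Properties.Ring K.ring using (-1*x≈-x; x∙y⁻¹≈ε⇒x≈y)
    x+-1*y≈0⇒x≈y : ∀ {x y} → x K.+ (K.- K.1#) K.* y K.≈ K.0# → x K.≈ y
    x+-1*y≈0⇒x≈y {x} {y} eq = x∙y⁻¹≈ε⇒x≈y x y (K.trans (K.+-congˡ (K.sym (-1*x≈-x y))) eq)
    difference : evaluate (p +ˡ (K.- K.1#) ·ˡ q) ≈ˡ []
    difference e = K.trans (evaluate-+ p ((K.- K.1#) ·ˡ q) e) (K.trans (coeff-+ (evaluate p) (evaluate ((K.- K.1#) ·ˡ q)) e)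
      (K.trans (K.+-cong (eq e) (K.trans (evaluate-· (K.- K.1#) q e) (K.trans (coeff-· (K.- K.1#) (evaluate q) e) (-1*x≈-x _))))
        (K.-‿inverseʳ _)))

  module Extension {b ℓb} (B : RawAlgebra K b ℓb) (isAlgebraᴮ : IsAlgebra K B) (f : Index → RawAlgebra.Carrier B) where
    private
      open RawAlgebra B using () renaming (_≈_ to _≈ᴮ_; Carrier to Carrierᴮ)
      module Bᴾ = AlgebraProperties K B isAlgebraᴮ
      module Eᴮ = Evaluation K B isAlgebraᴮ f

    extension : ∃ IsSym → Carrierᴮ
    extension (_ , d) = Eᴮ.evaluate (polynomial d)

    extension-isHomomorphism : IsAlgebraHomomorphism K Sym B extension
    extension-isHomomorphism = record
      { isRingHomomorphism = record
        { isSemiringHomomorphism = record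
          { isNearSemiringHomomorphism = record
            { +-isMonoidHomomorphism = record
              { isMagmaHomomorphism = record
                { isRelHomomorphism = record { cong = λ {u} {v} → extension-cong u v }
                ; homo = λ u v → Eᴮ.evaluate-+ (polynomial (proj₂ u)) (polynomial (proj₂ v))
                }
              ; ε-homo = Bᴾ.refl
              }
            ; *-homo = λ u v → Eᴮ.evaluate-* (polynomial (proj₂ u)) (polynomial (proj₂ v))
            }
          ; 1#-homo = Eᴮ.evaluate-1
          }
        ; -‿homo = λ u → Eᴮ.evaluate-neg (polynomial (proj₂ u))
        }
      ; ·-homo = λ a u → Eᴮ.evaluate-· a (polynomial (proj₂ u))
      }
      where
      -- Independence enters the universal property here: equal elements may carry different
      -- derivations, but their polynomials have equal evaluations in `FQSym`, so they agree
      -- coefficientwise and have equal values in `B`.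
      extension-cong : ∀ u v → proj₁ u ≈ˡ proj₁ v → extension u ≈ᴮ extension v
      extension-cong (x , d) (y , d′) eq = FreeModules.LinearExtension.linear-≈ K Bᴾ.leftModule _≟ⁱ_ Eᴮ.monomial {polynomial d} {polynomial d′}
        (evaluate-injective (polynomial d) (polynomial d′)
          (λ e → K.trans (evaluate-polynomial d e) (K.trans (eq e) (K.sym (evaluate-polynomial d′ e)))))

    extension-generator : ∀ i → extension (S⁺ i) ≈ᴮ f i
    extension-generator (𝐧 , p) = at (0 ℕ.<? ∣ 𝐧 ∣)
      where
      at : ∀ d → Eᴮ.evaluate (polynomialS 𝐧 d) ≈ᴮ f (𝐧 , p)
      at (yes p′) = ≡.subst (λ q → Eᴮ.evaluate (polynomialS 𝐧 (yes p′)) ≈ᴮ f (𝐧 , q)) (ℕ.<-irrelevant p′ p)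
          (Eᴮ.evaluate-generator (𝐧 , p′))
      at (no ¬p)  = contradiction p ¬p

  module Uniqueness {b ℓb} (B : RawAlgebra K b ℓb) (isAlgebraᴮ : IsAlgebra K B) (h h′ : ∃ IsSym → RawAlgebra.Carrier B)
                    (isHom : IsAlgebraHomomorphism K Sym B h) (isHom′ : IsAlgebraHomomorphism K Sym B h′) where
    private
      open RawAlgebra B using () renaming (_≈_ to _≈ᴮ_)
      module Bᴾ = AlgebraProperties K B isAlgebraᴮ
      module Hom  = IsAlgebraHomomorphism isHom
      module Hom′ = IsAlgebraHomomorphism isHom′
      open IsRingHomomorphism Hom.isRingHomomorphism using (⟦⟧-cong; +-homo; *-homo; 0#-homo; 1#-homo; -‿homo)
      open IsRingHomomorphism Hom′.isRingHomomorphism using ()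
        renaming (⟦⟧-cong to ⟦⟧-cong′; +-homo to +-homo′; *-homo to *-homo′; 0#-homo to 0#-homo′; 1#-homo to 1#-homo′; -‿homo to -‿homo′)
    open Bᴾ using (trans; sym)

    module _ (agree : ∀ i → h (S⁺ i) ≈ᴮ h′ (S⁺ i)) where

      agree-one : h (𝟙 , one) ≈ᴮ h′ (𝟙 , one)
      agree-one = trans 1#-homo (sym 1#-homo′)

      -- The assumption on `h` and `h′` covers positive weights; in weight zero `S 𝐧` is the unit,
      -- which both maps preserve.
      agree-S : ∀ 𝐧 → Dec (0 < ∣ 𝐧 ∣) → h (S 𝐧 , generator 𝐧) ≈ᴮ h′ (S 𝐧 , generator 𝐧)
      agree-S 𝐧 (yes p) = agree (𝐧 , p)
      agree-S 𝐧 (no ¬p) = trans (⟦⟧-cong {_ , generator 𝐧} {_ , one} (S-nonpositive 𝐧 ¬p))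
        (trans agree-one (sym (⟦⟧-cong′ {_ , generator 𝐧} {_ , one} (S-nonpositive 𝐧 ¬p))))

      agree-everywhere : ∀ {x} (d : IsSym x) → h (x , d) ≈ᴮ h′ (x , d)
      agree-everywhere (generator 𝐧) = agree-S 𝐧 (0 ℕ.<? ∣ 𝐧 ∣)
      agree-everywhere (resp eq d)   = trans (sym (⟦⟧-cong {_ , d} {_ , resp eq d} eq))
        (trans (agree-everywhere d) (⟦⟧-cong′ {_ , d} {_ , resp eq d} eq))
      agree-everywhere zero          = trans 0#-homo (sym 0#-homo′)
      agree-everywhere one           = agree-one
      agree-everywhere (add d d′)    = trans (+-homo (_ , d) (_ , d′)) (trans (Bᴾ.+-cong (agree-everywhere d)
          (agree-everywhere d′)) (sym (+-homo′ (_ , d) (_ , d′))))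
      agree-everywhere (neg d)       = trans (-‿homo (_ , d)) (trans (Bᴾ.-‿cong (agree-everywhere d)) (sym (-‿homo′ (_ , d))))
      agree-everywhere (mul d d′)    = trans (*-homo (_ , d) (_ , d′)) (trans (Bᴾ.*-cong (agree-everywhere d)
          (agree-everywhere d′)) (sym (*-homo′ (_ , d) (_ , d′))))
      agree-everywhere (scale a d)   = trans (Hom.·-homo a (_ , d)) (trans (Bᴾ.*ₗ-cong K.refl (agree-everywhere d))
          (sym (Hom′.·-homo a (_ , d))))

  Sym-isFree : ∀ b ℓb → IsFree K b ℓb Sym S⁺
  Sym-isFree b ℓb = record
    { isAlgebra = generatedSubalgebra-isAlgebra K rawAlgebra isAlgebra S
    ; existence = λ B isAlgebraᴮ f → let open Extension B isAlgebraᴮ f in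
        extension , extension-isHomomorphism , extension-generator
    ; uniqueness = λ B isAlgebraᴮ h h′ isHom isHom′ agree
        (_ , d) → Uniqueness.agree-everywhere B isAlgebraᴮ h h′ isHom isHom′ agree d
    }

-- The Hopf subalgebra

module HopfSubalgebra {c ℓ} (K : CommutativeRing c ℓ) (l : ℕ) where
  open FQSym K l
  open ColoredWords l
  open Words l
  open FreeModules K hiding (module Coefficients)
  open Series K l
  open Coproduct K l
  open HopfStructure K l
  open Generators K l
  open Independence K l
  open Freeness K l
  open Evaluation K rawAlgebra isAlgebra {X = Index} (S ∘ proj₁)
  private
    module K = CommutativeRing K
    module ⊗ = FreeModules.Coefficients K (Product.≡-dec _≟ᶜ_ _≟ᶜ_)
  open FreeModules.Coefficients K _≟ᶜ_ hiding (coeff; _≈ˡ_)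
  open SumsOverWords K.+-commutativeMonoid
  open import Relation.Binary.Reasoning.Setoid K.setoid

  Δ⟦⟧-cong : ∀ {p q} x y → x ≈ˡ y → (u : List (Letter p)) (v : List (Letter q)) → Δ⟦ x ⟧ u v K.≈ Δ⟦ y ⟧ u v
  Δ⟦⟧-cong x y eq u v = sum-cong (shifted u v) (λ w → eq (stdʷ w))

  Δ⟦⟧-+ : ∀ {p q} x y (u : List (Letter p)) (v : List (Letter q)) → Δ⟦ x +ˡ y ⟧ u v K.≈ Δ⟦ x ⟧ u v K.+ Δ⟦ y ⟧ u v
  Δ⟦⟧-+ x y u v = K.trans (sum-cong (shifted u v) (λ w → coeff-+ x y (stdʷ w))) (sum-+ (shifted u v) ⟦ x ⟧ ⟦ y ⟧)

  Δ⟦⟧-· : ∀ {p q} a x (u : List (Letter p)) (v : List (Letter q)) → Δ⟦ a ·ˡ x ⟧ u v K.≈ a K.* Δ⟦ x ⟧ u v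
  Δ⟦⟧-· a x u v = K.trans (sum-cong (shifted u v) (λ w → coeff-· a x (stdʷ w))) (K.sym (*-sum a (shifted u v) ⟦ x ⟧))

  Δ⟦⟧-[] : ∀ {p q} (u : List (Letter p)) (v : List (Letter q)) → Δ⟦ [] ⟧ u v K.≈ K.0#
  Δ⟦⟧-[] u v = sum-0 (shifted u v) (λ _ → K.refl)

  -- In the product formula `Δ⟦⟧-*` the two words play the same part, so for a product it suffices
  -- to exchange the two sums over splits. On generators the symmetry is that of the addition of
  -- weights.
  Δ⟦⟧-sym : ∀ {x} → IsSym x → ∀ {p q} (u : List (Letter p)) (v : List (Letter q)) → Δ⟦ x ⟧ u v K.≈ Δ⟦ x ⟧ v u
  Δ⟦⟧-sym (generator 𝐧) u v = K.trans (Δ⟦S⟧ 𝐧 u v) (K.trans (K.*-cong (K.*-comm _ _)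
    (K.reflexive (≡.cong (λ 𝐚 → δ (𝐚 ≟ʷ 𝐧)) (+ʷ-comm (weight u) (weight v))))) (K.sym (Δ⟦S⟧ 𝐧 v u)))
  Δ⟦⟧-sym (resp {x} {y} eq d) u v = K.trans (K.sym (Δ⟦⟧-cong x y eq u v)) (K.trans (Δ⟦⟧-sym d u v) (Δ⟦⟧-cong x y eq v u))
  Δ⟦⟧-sym zero u v = K.trans (Δ⟦⟧-[] u v) (K.sym (Δ⟦⟧-[] v u))
  -- The unit is handled as the generator `S 0ʷ`.
  Δ⟦⟧-sym one u v = K.trans (K.sym (Δ⟦⟧-cong (S 0ʷ) 𝟙 S-0ʷ u v)) (K.trans (Δ⟦⟧-sym (generator 0ʷ) u v) (Δ⟦⟧-cong
      (S 0ʷ) 𝟙 S-0ʷ v u))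
  Δ⟦⟧-sym (add {x} {y} d d′) u v = K.trans (Δ⟦⟧-+ x y u v) (K.trans (K.+-cong (Δ⟦⟧-sym d u v) (Δ⟦⟧-sym d′ u v))
      (K.sym (Δ⟦⟧-+ x y v u)))
  Δ⟦⟧-sym (neg {x} d) u v = K.trans (Δ⟦⟧-· (K.- K.1#) x u v) (K.trans (K.*-congˡ (Δ⟦⟧-sym d u v)) (K.sym (Δ⟦⟧-·
      (K.- K.1#) x v u)))
  Δ⟦⟧-sym (mul {x} {y} d d′) u v = begin
    Δ⟦ x *ˡ y ⟧ u v
      ≈⟨ Δ⟦⟧-* x y u v ⟩
    sum (splits u) (λ (u₁ , u₂) → sum (splits v) (λ (v₁ , v₂) → Δ⟦ x ⟧ u₁ v₁ K.* Δ⟦ y ⟧ u₂ v₂))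
      ≈⟨ sum-swap (splits u) (splits v) _ ⟩
    sum (splits v) (λ (v₁ , v₂) → sum (splits u) (λ (u₁ , u₂) → Δ⟦ x ⟧ u₁ v₁ K.* Δ⟦ y ⟧ u₂ v₂))
      ≈⟨ sum-cong (splits v) (λ (v₁ , v₂) → sum-cong (splits u) (λ (u₁ , u₂) → K.*-cong (Δ⟦⟧-sym d u₁ v₁) (Δ⟦⟧-sym d′ u₂ v₂))) ⟩
    sum (splits v) (λ (v₁ , v₂) → sum (splits u) (λ (u₁ , u₂) → Δ⟦ x ⟧ v₁ u₁ K.* Δ⟦ y ⟧ v₂ u₂))
      ≈⟨ Δ⟦⟧-* x y v u ⟨
    Δ⟦ x *ˡ y ⟧ v u ∎
  Δ⟦⟧-sym (scale a {x} d) u v = K.trans (Δ⟦⟧-· a x u v) (K.trans (K.*-congˡ (Δ⟦⟧-sym d u v)) (K.sym (Δ⟦⟧-· a x v u)))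

  coeff-Δ-toWord : ∀ x α β → coeff⊗ (Δ x) (α , β) K.≈ Δ⟦ x ⟧ (toWord α) (toWord β)
  coeff-Δ-toWord x α β = ≡.subst₂ (λ a b → coeff⊗ (Δ x) (a , b) K.≈ Δ⟦ x ⟧ (toWord α) (toWord β)) (stdʷ-toWord α) (stdʷ-toWord β)
    (coeff-Δ x (toWord α) (toWord β))

  coeff⊗-swap : ∀ z α β → coeff⊗ (List.map (map₂ swap) z) (α , β) K.≈ coeff⊗ z (β , α)
  coeff⊗-swap z α β = begin
    coeff⊗ (List.map (map₂ swap) z) (α , β)
      ≈⟨ ⊗.coeff-linear (List.map (map₂ swap) z) (α , β) ⟩
    linear (λ e → δ (Product.≡-dec _≟ᶜ_ _≟ᶜ_ e (α , β))) (List.map (map₂ swap) z)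
      ≡⟨ sum-map (map₂ swap) z _ ⟩
    linear (λ e → δ (Product.≡-dec _≟ᶜ_ _≟ᶜ_ (swap e) (α , β))) z
      ≈⟨ linear-cong (λ e → K.reflexive (δ-cong (Product.≡-dec _≟ᶜ_ _≟ᶜ_ (swap e) (α , β)) (Product.≡-dec _≟ᶜ_ _≟ᶜ_ e (β , α))
           (≡.cong swap) (≡.cong swap))) z ⟩
    linear (λ e → δ (Product.≡-dec _≟ᶜ_ _≟ᶜ_ e (β , α))) z
      ≈⟨ ⊗.coeff-linear z (β , α) ⟨
    coeff⊗ z (β , α) ∎

  Sym-isCocommutative : IsCocommutative IsSym
  Sym-isCocommutative {x} d (α , β) = K.trans (coeff⊗-swap (Δ x) α β) (K.trans (coeff-Δ-toWord x β α)
    (K.trans (Δ⟦⟧-sym d (toWord β) (toWord α)) (K.sym (coeff-Δ-toWord x α β))))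

  -- Coproducts expanded into pure tensors

  Tensors : Set c
  Tensors = List (FQ × FQ)

  -- Quantifying over all pairs of words, and not only over those of colored permutations, allows
  -- the factors that appear in `Δ⟦⟧-*` to be expanded in turn.
  record _Δ≈_ (x : FQ) (ts : Tensors) : Set ℓ where
    constructor expansion
    field
      expand : ∀ {p q} (u : List (Letter p)) (v : List (Letter q)) → Δ⟦ x ⟧ u v K.≈ sum ts (λ (t , t′) → ⟦ t ⟧ u K.* ⟦ t′ ⟧ v)

  open _Δ≈_

  Δ≈⇒≈⊗ : ∀ {x ts} → x Δ≈ ts → Δ x ≈⊗ Σ[ ts ] λ (t , t′) → t ⊗ t′
  Δ≈⇒≈⊗ {x} {ts} Δx (α , β) = begin
    coeff⊗ (Δ x) (α , β)
      ≈⟨ coeff-Δ-toWord x α β ⟩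
    Δ⟦ x ⟧ (toWord α) (toWord β)
      ≈⟨ expand Δx (toWord α) (toWord β) ⟩
    sum ts (λ (t , t′) → ⟦ t ⟧ (toWord α) K.* ⟦ t′ ⟧ (toWord β))
      ≈⟨ sum-cong ts (λ (t , t′) → K.sym (K.trans (coeff⊗-⊗ t t′ α β)
           (K.reflexive (≡.cong₂ (λ α β → coeff t α K.* coeff t′ β) (≡.sym (stdʷ-toWord α)) (≡.sym (stdʷ-toWord β)))))) ⟩
    sum ts (λ (t , t′) → coeff⊗ (t ⊗ t′) (α , β))
      ≈⟨ ⊗.coeff-Σ ts (λ (t , t′) → t ⊗ t′) (α , β) ⟨
    coeff⊗ (Σ[ ts ] λ (t , t′) → t ⊗ t′) (α , β) ∎

  infixl 7 _*⊗_
  _*⊗_ : FQ × FQ → FQ × FQ → FQ × FQ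
  (t , t′) *⊗ (r , r′) = t *ˡ r , t′ *ˡ r′

  -- Once the sums over splits are moved inside the sums over tensors, each pair of tensors
  -- contributes a product of two sums over splits, which are the product formulas `⟦⟧-*` of its
  -- left and right components.
  Δ≈-* : ∀ {x y ts rs} → x Δ≈ ts → y Δ≈ rs → (x *ˡ y) Δ≈ List.cartesianProductWith _*⊗_ ts rs
  Δ≈-* {x} {y} {ts} {rs} Δx Δy = expansion λ u v → begin
    Δ⟦ x *ˡ y ⟧ u v
      ≈⟨ Δ⟦⟧-* x y u v ⟩
    sum (splits u) (λ (u₁ , u₂) → sum (splits v) (λ (v₁ , v₂) → Δ⟦ x ⟧ u₁ v₁ K.* Δ⟦ y ⟧ u₂ v₂))
      ≈⟨ sum-cong (splits u) (λ (u₁ , u₂) → sum-cong (splits v) (λ (v₁ , v₂) →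
           K.trans (K.*-cong (expand Δx u₁ v₁) (expand Δy u₂ v₂)) (sum-*-sum ts rs _ _))) ⟩
    sum (splits u) (λ (u₁ , u₂) → sum (splits v) (λ (v₁ , v₂) → sum ts (λ (t , t′) → sum rs (λ (r , r′) →
      (⟦ t ⟧ u₁ K.* ⟦ t′ ⟧ v₁) K.* (⟦ r ⟧ u₂ K.* ⟦ r′ ⟧ v₂)))))
      ≈⟨ sum-cong (splits u) (λ _ → sum-swap (splits v) ts _) ⟩
    sum (splits u) (λ (u₁ , u₂) → sum ts (λ (t , t′) → sum (splits v) (λ (v₁ , v₂) → sum rs (λ (r , r′) →
      (⟦ t ⟧ u₁ K.* ⟦ t′ ⟧ v₁) K.* (⟦ r ⟧ u₂ K.* ⟦ r′ ⟧ v₂)))))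
      ≈⟨ sum-swap (splits u) ts _ ⟩
    sum ts (λ (t , t′) → sum (splits u) (λ (u₁ , u₂) → sum (splits v) (λ (v₁ , v₂) → sum rs (λ (r , r′) →
      (⟦ t ⟧ u₁ K.* ⟦ t′ ⟧ v₁) K.* (⟦ r ⟧ u₂ K.* ⟦ r′ ⟧ v₂)))))
      ≈⟨ sum-cong ts (λ _ → K.trans (sum-cong (splits u) (λ _ → sum-swap (splits v) rs _)) (sum-swap (splits u) rs _)) ⟩
    sum ts (λ (t , t′) → sum rs (λ (r , r′) → sum (splits u) (λ (u₁ , u₂) → sum (splits v) (λ (v₁ , v₂) →
      (⟦ t ⟧ u₁ K.* ⟦ t′ ⟧ v₁) K.* (⟦ r ⟧ u₂ K.* ⟦ r′ ⟧ v₂)))))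
      ≈⟨ sum-cong ts (λ (t , t′) → sum-cong rs (λ (r , r′) → begin
           sum (splits u) (λ (u₁ , u₂) → sum (splits v) (λ (v₁ , v₂) → (⟦ t ⟧ u₁ K.* ⟦ t′ ⟧ v₁) K.* (⟦ r ⟧ u₂ K.* ⟦ r′ ⟧ v₂)))
             ≈⟨ sum-cong (splits u) (λ _ → sum-cong (splits v) (λ _ → interchange _ _ _ _)) ⟩
           sum (splits u) (λ (u₁ , u₂) → sum (splits v) (λ (v₁ , v₂) → (⟦ t ⟧ u₁ K.* ⟦ r ⟧ u₂) K.* (⟦ t′ ⟧ v₁ K.* ⟦ r′ ⟧ v₂)))
             ≈⟨ sum-*-sum (splits u) (splits v) (λ (u₁ , u₂) → ⟦ t ⟧ u₁ K.* ⟦ r ⟧ u₂) (λ (v₁ , v₂) → ⟦ t′ ⟧ v₁ K.* ⟦ r′ ⟧ v₂) ⟨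
           sum (splits u) (λ (u₁ , u₂) → ⟦ t ⟧ u₁ K.* ⟦ r ⟧ u₂) K.* sum (splits v) (λ (v₁ , v₂) → ⟦ t′ ⟧ v₁ K.* ⟦ r′ ⟧ v₂)
             ≈⟨ K.*-cong (⟦⟧-* t r u) (⟦⟧-* t′ r′ v) ⟨
           ⟦ t *ˡ r ⟧ u K.* ⟦ t′ *ˡ r′ ⟧ v ∎)) ⟩
    sum ts (λ (t , t′) → sum rs (λ (r , r′) → ⟦ t *ˡ r ⟧ u K.* ⟦ t′ *ˡ r′ ⟧ v))
      ≈⟨ sum-cartesianProductWith _*⊗_ ts rs _ ⟨
    sum (List.cartesianProductWith _*⊗_ ts rs) (λ (t , t′) → ⟦ t ⟧ u K.* ⟦ t′ ⟧ v) ∎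
    where open import Algebra.Properties.CommutativeSemigroup K.*-commutativeSemigroup using (interchange)

  generators : List (Weight × Weight) → Tensors
  generators = List.map (λ (𝐢 , 𝐣) → S 𝐢 , S 𝐣)

  Δ≈-S : ∀ 𝐧 → S 𝐧 Δ≈ generators (decompositions 𝐧)
  Δ≈-S 𝐧 = expansion λ u v → K.trans (Δ⟦S⟧ 𝐧 u v) (K.trans (sum-decompositions 𝐧 u v ((weight u +ʷ weight v) ≟ʷ 𝐧))
    (K.trans (sum-cong (decompositions 𝐧) (λ (𝐢 , 𝐣) → K.sym (K.*-cong (⟦S⟧ 𝐢 u) (⟦S⟧ 𝐣 v))))
      (K.reflexive (≡.sym (sum-map (λ (𝐢 , 𝐣) → S 𝐢 , S 𝐣) (decompositions 𝐧) _)))))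

  Δ⟦⟧-𝟙 : ∀ {p q} (u : List (Letter p)) (v : List (Letter q)) → Δ⟦ 𝟙 ⟧ u v K.≈ unit u K.* unit v
  Δ⟦⟧-𝟙 u v = K.trans (sum-cong (shifted u v) ⟦⟧-𝟙) (eq u v)
    where
    eq : ∀ {p q} (u : List (Letter p)) (v : List (Letter q)) → sum (shifted u v) unit K.≈ unit u K.* unit v
    eq []      []      = K.trans (K.+-identityʳ _) (K.sym (K.*-identityˡ _))
    eq []      (_ ∷ _) = K.trans (K.+-identityʳ _) (K.sym (K.*-identityˡ _))
    eq (_ ∷ _) []      = K.trans (K.+-identityʳ _) (K.sym (K.*-identityʳ _))
    eq {p} {q} (x ∷ u) (y ∷ v) = K.trans (sum-shuffles-∷ (inˡ q x) (List.map (inˡ q) u) (inʳ p y) (List.map (inʳ p) v) unit)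
      (K.trans (K.+-cong (sum-0 (shuffles (List.map (inˡ q) u) (inʳ p y ∷ List.map (inʳ p) v)) (λ _ → K.refl))
                         (sum-0 (shuffles (inˡ q x ∷ List.map (inˡ q) u) (List.map (inʳ p) v)) (λ _ → K.refl)))
        (K.trans (K.+-identityʳ _) (K.sym (K.zeroˡ _))))

  Δ≈-𝟙 : 𝟙 Δ≈ ((𝟙 , 𝟙) ∷ [])
  Δ≈-𝟙 = expansion λ u v → K.trans (Δ⟦⟧-𝟙 u v) (K.trans (K.sym (K.*-cong (⟦⟧-𝟙 u) (⟦⟧-𝟙 v))) (K.sym (K.+-identityʳ _)))

  InSym : FQ × FQ → Set (c ⊔ ℓ)
  InSym (t , t′) = IsSym t × IsSym t′

  Δ≈-+ : ∀ {x y ts rs} → x Δ≈ ts → y Δ≈ rs → (x +ˡ y) Δ≈ (ts ++ rs)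
  Δ≈-+ {x} {y} {ts} {rs} Δx Δy = expansion λ u v → K.trans (Δ⟦⟧-+ x y u v) (K.trans (K.+-cong (expand Δx u v)
      (expand Δy u v)) (K.sym (sum-++ ts rs _)))

  Δ≈-· : ∀ a {x ts} → x Δ≈ ts → (a ·ˡ x) Δ≈ List.map (map₁ (a ·ˡ_)) ts
  Δ≈-· a {x} {ts} Δx = expansion λ u v → K.trans (Δ⟦⟧-· a x u v) (K.trans (K.*-congˡ (expand Δx u v)) (K.trans (*-sum a ts _)
    (K.trans (sum-cong ts (λ (t , t′) → K.trans (K.sym (K.*-assoc _ _ _)) (K.*-congʳ (K.sym (coeff-· a t (stdʷ u))))))
      (K.reflexive (≡.sym (sum-map (map₁ (a ·ˡ_)) ts _))))))

  record SymCoproduct (x : FQ) : Set (c ⊔ ℓ) where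
    constructor symCoproduct
    field
      {tensors} : Tensors
      expands   : x Δ≈ tensors
      inSym     : All InSym tensors

  multiple : ∀ a {x} → SymCoproduct x → SymCoproduct (a ·ˡ x)
  multiple a (symCoproduct Δx sym) = symCoproduct (Δ≈-· a Δx) (All.map⁺ (All.map (map₁ (scale a)) sym))

  Sym-coproduct : ∀ {x} → IsSym x → SymCoproduct x
  Sym-coproduct (generator 𝐧) = symCoproduct (Δ≈-S 𝐧)
    (All.map⁺ (All.universal (λ (𝐢 , 𝐣) → generator 𝐢 , generator 𝐣) (decompositions 𝐧)))
  Sym-coproduct (resp {x} {y} eq d) = cong (Sym-coproduct d)
    where
    cong : SymCoproduct x → SymCoproduct y
    cong (symCoproduct Δx sym) = symCoproduct (expansion λ u v → K.trans (K.sym (Δ⟦⟧-cong x y eq u v)) (expand Δx u v)) sym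
  Sym-coproduct zero = symCoproduct (expansion Δ⟦⟧-[]) []
  Sym-coproduct one = symCoproduct Δ≈-𝟙 ((one , one) ∷ [])
  Sym-coproduct (add {x} {y} d d′) = sum-of (Sym-coproduct d) (Sym-coproduct d′)
    where
    sum-of : SymCoproduct x → SymCoproduct y → SymCoproduct (x +ˡ y)
    sum-of (symCoproduct Δx sym) (symCoproduct Δy sym′) = symCoproduct (Δ≈-+ Δx Δy) (All.++⁺ sym sym′)
  Sym-coproduct (neg d) = multiple (K.- K.1#) (Sym-coproduct d)
  Sym-coproduct (mul {x} {y} d d′) = product-of (Sym-coproduct d) (Sym-coproduct d′)
    where
    product-of : SymCoproduct x → SymCoproduct y → SymCoproduct (x *ˡ y)
    product-of (symCoproduct {ts} Δx sym) (symCoproduct {rs} Δy sym′) = symCoproduct (Δ≈-* Δx Δy)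
      (All.cartesianProductWith⁺ (≡.setoid _) (≡.setoid _) _*⊗_ ts rs
        (λ t∈ r∈ → let (p , p′) = All.lookup sym t∈ ; (q , q′) = All.lookup sym′ r∈ in mul p q , mul p′ q′))
  Sym-coproduct (scale a d) = multiple a (Sym-coproduct d)

  Sym-Δ-closed : ∀ {x} → IsSym x → Δ x ∈ IsSym ⊗²
  Sym-Δ-closed {x} d = closed (Sym-coproduct d)
    where
    attach : ∀ {ts} → All InSym ts → List (∃ IsSym × ∃ IsSym)
    attach []             = []
    attach ((p , q) ∷ ps) = ((_ , p) , (_ , q)) ∷ attach ps
    attached : ∀ {ts} (ps : All InSym ts) → (Σ[ attach ps ] λ (t , t′) → proj₁ t ⊗ proj₁ t′) ≡ (Σ[ ts ] λ (t , t′) → t ⊗ t′)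
    attached []                      = ≡.refl
    attached {(t , t′) ∷ _} (_ ∷ ps) = ≡.cong ((t ⊗ t′) ++_) (attached ps)
    closed : SymCoproduct x → Δ x ∈ IsSym ⊗²
    closed (symCoproduct Δx sym) = attach sym , λ e → K.trans (Δ≈⇒≈⊗ Δx e)
      (K.reflexive (≡.cong (λ z → coeff⊗ z e) (≡.sym (attached sym))))

  -- The shape Sᴵ 𝐈 ⊗ 1 + (terms of smaller degree on the left) lets the antipode of
  -- Sᴵ 𝐈 be computed by induction on the degree.

  degree : List Weight → ℕ
  degree = List.foldr (λ 𝐧 → ∣ 𝐧 ∣ ℕ.+_) 0

  Term : Set (c ⊔ ℓ)
  Term = List Weight × ∃ IsSym

  term : Term → FQ × FQ
  term (𝐈 , t) = Sᴵ 𝐈 , proj₁ t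

  -- The left factors are kept as sequences of weights so that the induction can be applied to them.
  -- The unit is kept only up to `_≈ˡ_`, because multiplying expansions produces `𝟙 *ˡ 𝟙` and the
  -- like.
  record ReducedCoproduct (x : FQ) (𝐈 : List Weight) : Set (c ⊔ ℓ) where
    field
      {unitTerm} : ∃ IsSym
      unitTerm≈𝟙 : proj₁ unitTerm ≈ˡ 𝟙
      {others}   : List Term
      smaller    : All (λ t → degree (proj₁ t) < degree 𝐈) others
      coproduct  : x Δ≈ List.map term ((𝐈 , unitTerm) ∷ others)

  positive? : (ij : Weight × Weight) → Dec (proj₂ ij ≢ 0ʷ)
  positive? (_ , 𝐣) = ¬? (𝐣 ≟ʷ 0ʷ)

  -- The only decomposition of `𝐧` with second part zero is `(𝐧 , 0ʷ)`, and its right factor `S 0ʷ`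
  -- is the unit.
  Δ≈-S-reduced : ∀ 𝐧 → S 𝐧 Δ≈ ((S 𝐧 , 𝟙) ∷ generators (filter positive? (decompositions 𝐧)))
  Δ≈-S-reduced 𝐧 = expansion λ u v → let f = terms u v in begin
    Δ⟦ S 𝐧 ⟧ u v
      ≈⟨ K.trans (expand (Δ≈-S 𝐧) u v) (K.reflexive (sum-map (λ (𝐢 , 𝐣) → S 𝐢 , S 𝐣) (decompositions 𝐧) _)) ⟩
    sum (decompositions 𝐧) f
      ≈⟨ sum-cong (decompositions 𝐧) (λ ij → split (proj₂ ij ≟ʷ 0ʷ) ij) ⟩
    sum (decompositions 𝐧) (λ ij → δ (proj₂ ij ≟ʷ 0ʷ) K.* f ij K.+ δ (positive? ij) K.* f ij)
      ≈⟨ sum-+ (decompositions 𝐧) _ _ ⟩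
    sum (decompositions 𝐧) (λ ij → δ (proj₂ ij ≟ʷ 0ʷ) K.* f ij) K.+ sum (decompositions 𝐧) (λ ij → δ (positive? ij) K.* f ij)
      ≈⟨ K.+-cong (single-term u v) (K.trans (K.sym (sum-filter positive? (decompositions 𝐧) f))
           (K.reflexive (≡.sym (sum-map (λ (𝐢 , 𝐣) → S 𝐢 , S 𝐣) (filter positive? (decompositions 𝐧)) _)))) ⟩
    ⟦ S 𝐧 ⟧ u K.* ⟦ 𝟙 ⟧ v K.+ sum (generators (filter positive? (decompositions 𝐧))) (λ (t , t′) → ⟦ t ⟧ u K.* ⟦ t′ ⟧ v) ∎
    where
    terms : ∀ {p q} → List (Letter p) → List (Letter q) → Weight × Weight → K.Carrier
    terms u v (𝐢 , 𝐣) = ⟦ S 𝐢 ⟧ u K.* ⟦ S 𝐣 ⟧ v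
    split : ∀ {A : Set} (A? : Dec A) (ij : Weight × Weight) {x} → x K.≈ δ A? K.* x K.+ δ (¬? A?) K.* x
    split (yes p) ij = K.sym (K.trans (K.+-cong (K.trans (K.*-congʳ (K.reflexive (δ-yes (yes p) p))) (K.*-identityˡ _))
      (δ-0 (¬? (yes p)) (λ ¬p → contradiction p ¬p))) (K.+-identityʳ _))
    split (no ¬p) ij = K.sym (K.trans (K.+-cong (δ-0 (no ¬p) (λ p → contradiction p ¬p))
      (K.trans (K.*-congʳ (K.reflexive (δ-yes (¬? (no ¬p)) ¬p))) (K.*-identityˡ _))) (K.+-identityˡ _))
    single-term : ∀ {p q} (u : List (Letter p)) (v : List (Letter q)) →
      sum (decompositions 𝐧) (λ ij → δ (proj₂ ij ≟ʷ 0ʷ) K.* terms u v ij) K.≈ ⟦ S 𝐧 ⟧ u K.* ⟦ 𝟙 ⟧ v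
    single-term u v = K.trans (sum-single (λ ij → δ (proj₂ ij ≟ʷ 0ʷ) K.* terms u v ij) (decompositions-unique 𝐧)
        (≡.subst (λ 𝐚 → (𝐧 , 0ʷ) ∈ decompositions 𝐚) (+ʷ-identityʳ 𝐧) (∈-decompositions⁺ 𝐧 0ʷ))
        (λ {(𝐢 , 𝐣)} ij∈ ne → δ-0 (𝐣 ≟ʷ 0ʷ) (λ { ≡.refl → contradiction
          (≡.cong (_, 0ʷ) (≡.trans (≡.sym (+ʷ-identityʳ 𝐢)) (∈-decompositions⁻ 𝐧 ij∈))) ne })))
      (K.trans (K.*-congʳ (K.reflexive (δ-yes (0ʷ ≟ʷ 0ʷ) ≡.refl))) (K.trans (K.*-identityˡ _) (K.*-congˡ (S-0ʷ (stdʷ v)))))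

  reduced-coproduct : ∀ 𝐈 → ReducedCoproduct (Sᴵ 𝐈) 𝐈
  reduced-coproduct [] = record { unitTerm = 𝟙 , one ; unitTerm≈𝟙 = λ _ → K.refl ; smaller = [] ; coproduct = Δ≈-𝟙 }
  reduced-coproduct (𝐧 ∷ 𝐈) = record
    { unitTerm   = 𝟙 *ˡ proj₁ unitTerm , mul one (proj₂ unitTerm)
    ; unitTerm≈𝟙 = λ e → K.trans (*ˡ-identityˡ (proj₁ unitTerm) e) (unitTerm≈𝟙 e)
    -- Either the first factor is `S 𝐧` and the tail has smaller degree than `𝐈`, or the first
    -- factor is smaller and the tail has at most the degree of `𝐈`; the leading term of `Sᴵ 𝐈`
    -- attains equality.
    ; smaller    = All.++⁺ (All.map⁺ (All.map (ℕ.+-monoʳ-< ∣ 𝐧 ∣) smaller))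
        (All.cartesianProductWith⁺ (≡.setoid _) (≡.setoid _) _∷ᵗ_ ds ((𝐈 , unitTerm) ∷ others)
          (λ ij∈ t∈ → ℕ.+-mono-<-≤ (All.lookup ds-smaller ij∈) (All.lookup (ℕ.≤-refl ∷ All.map ℕ.<⇒≤ smaller) t∈)))
    ; coproduct  = ≡.subst (Sᴵ (𝐧 ∷ 𝐈) Δ≈_) (≡.sym (map-cartesianProductWith ((𝐧 , 𝟙 , one) ∷ ds) ((𝐈 , unitTerm) ∷ others)))
        (Δ≈-* Δ≈-S-reduced′ coproduct)
    }
    where
    open ReducedCoproduct (reduced-coproduct 𝐈)
    _∷ᵗ_ : Weight × ∃ IsSym → Term → Term
    (𝐢 , s) ∷ᵗ (𝐉 , t) = 𝐢 ∷ 𝐉 , proj₁ s *ˡ proj₁ t , mul (proj₂ s) (proj₂ t)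
    leading : Weight × ∃ IsSym → FQ × FQ
    leading (𝐢 , s) = S 𝐢 , proj₁ s
    ds : List (Weight × ∃ IsSym)
    ds = List.map (λ (𝐢 , 𝐣) → 𝐢 , S 𝐣 , generator 𝐣) (filter positive? (decompositions 𝐧))
    ds-smaller : All (λ d → ∣ proj₁ d ∣ < ∣ 𝐧 ∣) ds
    ds-smaller = All.map⁺ (All.tabulate (λ {(𝐢 , 𝐣)} ij∈ → let (ij∈′ , 𝐣≢0) = ∈-filter⁻ positive? {xs = decompositions 𝐧} ij∈ in
      ≡.subst (λ 𝐚 → ∣ 𝐢 ∣ < ∣ 𝐚 ∣) (∈-decompositions⁻ 𝐧 ij∈′) (≡.subst (∣ 𝐢 ∣ <_) (≡.sym (∣+ʷ∣ 𝐢 𝐣))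
        (ℕ.m<m+n ∣ 𝐢 ∣ (ℕ.n≢0⇒n>0 (λ eq → 𝐣≢0 (∣∣≡0⇒≡0ʷ 𝐣 eq)))))))
    Δ≈-S-reduced′ : S 𝐧 Δ≈ List.map leading ((𝐧 , 𝟙 , one) ∷ ds)
    Δ≈-S-reduced′ = ≡.subst (λ ts → S 𝐧 Δ≈ ((S 𝐧 , 𝟙) ∷ ts)) (List.map-∘ (filter positive? (decompositions 𝐧))) (Δ≈-S-reduced 𝐧)
    map-cartesianProductWith : ∀ as bs → List.map term (List.cartesianProductWith _∷ᵗ_ as bs) ≡
      List.cartesianProductWith _*⊗_ (List.map leading as) (List.map term bs)
    map-cartesianProductWith []       bs = ≡.refl
    map-cartesianProductWith (a ∷ as) bs = ≡.trans (List.map-++ term (List.map (a ∷ᵗ_) bs) _)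
      (≡.cong₂ _++_ (≡.trans (≡.sym (List.map-∘ bs)) (List.map-∘ bs)) (map-cartesianProductWith as bs))

  -- The antipode

  module Antipode {s : FQ → FQ} (isAntipode : IsAntipode s) where
    open IsAntipode isAntipode

    -- An antipode is given abstractly as an additive and homogeneous map; this expresses it through
    -- its values on the basis, which are what `s-inverseˡ` involves.
    s-linear : ∀ x e → coeff (s x) e K.≈ linear (λ d → coeff (s (basis d)) e) x
    -- Since `0 ·ˡ []` is `[]`, homogeneity forces `s []` to vanish.
    s-linear []            e = K.trans (s-·-homo K.0# [] e) (K.trans (coeff-· K.0# (s []) e) (K.zeroˡ _))
    s-linear ((a , d) ∷ x) e = begin
      coeff (s ((a , d) ∷ x)) e
        ≈⟨ s-cong {(a , d) ∷ x} {a ·ˡ basis d +ˡ x} split e ⟩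
      coeff (s (a ·ˡ basis d +ˡ x)) e
        ≈⟨ K.trans (s-+-homo (a ·ˡ basis d) x e) (coeff-+ (s (a ·ˡ basis d)) (s x) e) ⟩
      coeff (s (a ·ˡ basis d)) e K.+ coeff (s x) e
        ≈⟨ K.+-cong (K.trans (s-·-homo a (basis d) e) (coeff-· a (s (basis d)) e)) (s-linear x e) ⟩
      a K.* coeff (s (basis d)) e K.+ linear (λ d → coeff (s (basis d)) e) x ∎
      where
      split : (a , d) ∷ x ≈ˡ a ·ˡ basis d +ˡ x
      split e = K.trans (coeff-linear ((a , d) ∷ x) e) (K.trans (K.+-congʳ (K.*-congʳ (K.sym (K.*-identityʳ a))))
        (K.sym (coeff-linear ((a K.* K.1# , d) ∷ x) e)))

    convolve : FQ⊗FQ → FQ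
    convolve = extend (λ (e , e′) → s (basis e) *ˡ basis e′)

    -- The antipode axiom is phrased through pairs of basis elements; bilinearity carries it over to
    -- tensors of arbitrary elements.
    convolve-⊗ : ∀ x y → convolve (x ⊗ y) ≈ˡ s x *ˡ y
    convolve-⊗ x y = ⟦⟧-injective (convolve (x ⊗ y)) (s x *ˡ y) λ w → begin
      ⟦ convolve (x ⊗ y) ⟧ w
        ≈⟨ coeff-extend (λ (e , e′) → s (basis e) *ˡ basis e′) (x ⊗ y) (stdʷ w) ⟩
      linear (λ (e , e′) → ⟦ s (basis e) *ˡ basis e′ ⟧ w) (x ⊗ y)
        ≈⟨ linear-⊗ x y (λ (e , e′) → ⟦ s (basis e) *ˡ basis e′ ⟧ w) ⟩
      linear (λ e → linear (λ e′ → ⟦ s (basis e) *ˡ basis e′ ⟧ w) y) x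
        ≈⟨ linear-cong (λ e → linear-cong (λ e′ → ⟦⟧-* (s (basis e)) (basis e′) w) y) x ⟩
      linear (λ e → linear (λ e′ → sum (splits w) (λ (u , v) → ⟦ s (basis e) ⟧ u K.* ⟦ basis e′ ⟧ v)) y) x
        ≈⟨ linear-cong (λ e → linear-sum (splits w) (λ (u , v) e′ → ⟦ s (basis e) ⟧ u K.* ⟦ basis e′ ⟧ v) y) x ⟩
      linear (λ e → sum (splits w) (λ (u , v) → linear (λ e′ → ⟦ s (basis e) ⟧ u K.* ⟦ basis e′ ⟧ v) y)) x
        ≈⟨ linear-sum (splits w) (λ (u , v) e → linear (λ e′ → ⟦ s (basis e) ⟧ u K.* ⟦ basis e′ ⟧ v) y) x ⟩
      sum (splits w) (λ (u , v) → linear (λ e → linear (λ e′ → ⟦ s (basis e) ⟧ u K.* ⟦ basis e′ ⟧ v) y) x)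
        ≈⟨ sum-cong (splits w) (λ (u , v) → K.trans (linear-* x y (λ e → ⟦ s (basis e) ⟧ u) (λ e′ → ⟦ basis e′ ⟧ v))
             (K.*-cong (K.sym (s-linear x (stdʷ u))) (K.trans (linear-cong (λ e′ → coeff-basis e′ (stdʷ v)) y)
                 (K.sym (⟦⟧-linear y v))))) ⟩
      sum (splits w) (λ (u , v) → ⟦ s x ⟧ u K.* ⟦ y ⟧ v)
        ≈⟨ ⟦⟧-* (s x) y w ⟨
      ⟦ s x *ˡ y ⟧ w ∎

    convolve-Σ : ∀ (ts : Tensors) → convolve (Σ[ ts ] λ (t , t′) → t ⊗ t′) ≈ˡ Σ[ ts ] (λ (t , t′) → s t *ˡ t′)
    convolve-Σ ts e = begin
      coeff (convolve (Σ[ ts ] λ (t , t′) → t ⊗ t′)) e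
        ≈⟨ coeff-extend _ (Σ[ ts ] λ (t , t′) → t ⊗ t′) e ⟩
      linear (λ (d , d′) → coeff (s (basis d) *ˡ basis d′) e) (Σ[ ts ] λ (t , t′) → t ⊗ t′)
        ≈⟨ linear-Σ (λ (d , d′) → coeff (s (basis d) *ˡ basis d′) e) ts (λ (t , t′) → t ⊗ t′) ⟩
      sum ts (λ (t , t′) → linear (λ (d , d′) → coeff (s (basis d) *ˡ basis d′) e) (t ⊗ t′))
        ≈⟨ sum-cong ts (λ (t , t′) → K.trans (K.sym (coeff-extend (λ (d , d′) → s (basis d) *ˡ basis d′)
            (t ⊗ t′) e)) (convolve-⊗ t t′ e)) ⟩
      sum ts (λ (t , t′) → coeff (s t *ˡ t′) e)
        ≈⟨ coeff-Σ ts (λ (t , t′) → s t *ˡ t′) e ⟨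
      coeff (Σ[ ts ] (λ (t , t′) → s t *ˡ t′)) e ∎

    antipode-Sᴵ : ∀ 𝐈 → Acc _<_ (degree 𝐈) → IsSym (s (Sᴵ 𝐈))
    antipode-Sᴵ 𝐈 (acc rec) = resp difference (add (scale (ε (Sᴵ 𝐈)) one) (neg (rest-closed smaller)))
      where
      open ReducedCoproduct (reduced-coproduct 𝐈)
      rest : List Term → FQ
      rest ts = Σ[ List.map term ts ] (λ (t , t′) → s t *ˡ t′)
      rest-closed : ∀ {ts} → All (λ t → degree (proj₁ t) < degree 𝐈) ts → IsSym (rest ts)
      rest-closed []                        = zero
      rest-closed {(𝐉 , t) ∷ _} (lt ∷ lts) = add (mul (antipode-Sᴵ 𝐉 (rec lt)) (proj₂ t)) (rest-closed lts)
      -- The antipode axiom for the reduced expansion. The expansion agrees with `Δ (Sᴵ 𝐈)`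
      -- coefficientwise only, so `extend-≈` is used to convolve it instead.
      total : s (Sᴵ 𝐈) *ˡ proj₁ unitTerm +ˡ rest others ≈ˡ ε (Sᴵ 𝐈) ·ˡ 𝟙
      total e = K.trans (K.sym (convolve-Σ (List.map term ((𝐈 , unitTerm) ∷ others)) e)) (K.trans
        (K.sym (extend-≈ (Product.≡-dec _≟ᶜ_ _≟ᶜ_) (λ (e , e′) → s (basis e) *ˡ basis e′)
          {Δ (Sᴵ 𝐈)} {Σ[ List.map term ((𝐈 , unitTerm) ∷ others) ] λ (t , t′) → t ⊗ t′} (Δ≈⇒≈⊗ coproduct) e))
        (s-inverseˡ (Sᴵ 𝐈) e))
      difference : ε (Sᴵ 𝐈) ·ˡ 𝟙 +ˡ (K.- K.1#) ·ˡ rest others ≈ˡ s (Sᴵ 𝐈)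
      difference e = begin
        coeff (ε (Sᴵ 𝐈) ·ˡ 𝟙 +ˡ (K.- K.1#) ·ˡ rest others) e
          ≈⟨ coeff-+ (ε (Sᴵ 𝐈) ·ˡ 𝟙) ((K.- K.1#) ·ˡ rest others) e ⟩
        coeff (ε (Sᴵ 𝐈) ·ˡ 𝟙) e K.+ coeff ((K.- K.1#) ·ˡ rest others) e
          ≈⟨ K.+-cong (K.sym (total e)) (K.trans (coeff-· (K.- K.1#) (rest others) e) (-1*x≈-x _)) ⟩
        coeff (s (Sᴵ 𝐈) *ˡ proj₁ unitTerm +ˡ rest others) e K.- coeff (rest others) e
          ≈⟨ K.+-congʳ (coeff-+ (s (Sᴵ 𝐈) *ˡ proj₁ unitTerm) (rest others) e) ⟩
        (coeff (s (Sᴵ 𝐈) *ˡ proj₁ unitTerm) e K.+ coeff (rest others) e) K.- coeff (rest others) e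
          ≈⟨ K.trans (K.+-assoc _ _ _) (K.trans (K.+-congˡ (K.-‿inverseʳ _)) (K.+-identityʳ _)) ⟩
        coeff (s (Sᴵ 𝐈) *ˡ proj₁ unitTerm) e
          ≈⟨ *ˡ-cong {s (Sᴵ 𝐈)} {s (Sᴵ 𝐈)} {proj₁ unitTerm} {𝟙} (λ _ → K.refl) unitTerm≈𝟙 e ⟩
        coeff (s (Sᴵ 𝐈) *ˡ 𝟙) e
          ≈⟨ *ˡ-identityʳ (s (Sᴵ 𝐈)) e ⟩
        coeff (s (Sᴵ 𝐈)) e ∎
        where open import Algebra.Properties.Ring K.ring using (-1*x≈-x)

    -- An induction on derivations of membership would have to know `s` on arbitrary products, that
    -- is, its antimultiplicativity. Writing elements as linear combinations of the products `Sᴵ 𝐈`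
    -- reduces the claim to these by linearity of `s`.
    antipode-evaluate : ∀ p → IsSym (s (evaluate p))
    antipode-evaluate []            = resp (λ e → K.sym (s-linear [] e)) zero
    antipode-evaluate ((a , u) ∷ p) = resp
      (λ e → K.sym (K.trans (s-+-homo (a ·ˡ monomial u) (evaluate p) e)
        (+ˡ-cong {s (a ·ˡ monomial u)} {a ·ˡ s (monomial u)} {s (evaluate p)} {s (evaluate p)} (s-·-homo a
            (monomial u)) (λ _ → K.refl) e)))
      (add (scale a (≡.subst (IsSym ∘ s) (≡.sym (monomial≡Sᴵ u)) (antipode-Sᴵ (List.map proj₁ u)
          (<-wellFounded _)))) (antipode-evaluate p))

    antipode-closed : ∀ {x} → IsSym x → IsSym (s x)
    antipode-closed {x} d = resp (s-cong {evaluate (polynomial d)} {x} (evaluate-polynomial d)) (antipode-evaluate (polynomial d))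

  Sym-isHopfSubalgebra : IsHopfSubalgebra IsSym
  Sym-isHopfSubalgebra = record
    { isSubalgebra = record
      { resp = resp ; 0-closed = zero ; 1-closed = one ; +-closed = add ; neg-closed = neg ; *-closed = mul ; ·-closed = λ a → scale a }
    ; Δ-closed = Sym-Δ-closed
    ; antipode-closed = Antipode.antipode-closed
    }

theorem3p1 : ∀ {c ℓ} b ℓb (K : CommutativeRing c ℓ) (l : ℕ) → 1 ≤ l →
    let open FQSym K l in
    IsFree K b ℓb Sym S⁺
    × IsHopfSubalgebra IsSym
    × (∀ 𝐧 → Δ (S 𝐧) ≈⊗ Σ[ decompositions 𝐧 ] λ (𝐢 , 𝐣) → S 𝐢 ⊗ S 𝐣)
    × IsCocommutative IsSym
theorem3p1 b ℓb K l _ = Freeness.Sym-isFree K l b ℓb , HopfSubalgebra.Sym-isHopfSubalgebra K l ,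
  Generators.Δ-S K l , HopfSubalgebra.Sym-isCocommutative K l
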